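{- For any coloring sequence $\alpha=(\alpha_1,\ldots,\alpha_\ell)$ of (even) length $\ell\geq 10$, the graph $\mathcal{F}_\alpha$ has a Hamilton cycle.
   Context: A coloring sequence is a sequence $\alpha=(\alpha_1,\ldots,\alpha_\ell)$ of even length $\ell\geq 2$ of integers $\alpha_i\geq 1$; set $N=\sum_{i=1}^\ell\alpha_i$. Label the points of a convex $N$-gon $1,\ldots,N$ counterclockwise and color them according to the pattern $\mathrm{red}^{\alpha_1}\mathrm{blue}^{\alpha_2}\mathrm{red}^{\alpha_3}\cdots\mathrm{red}^{\alpha_{\ell-1}}\mathrm{blue}^{\alpha_\ell}$ (the first $\alpha_1$ points red, the next $\alpha_2$ blue, the next $\alpha_3$ red, etc.). The associahedron $\mathcal{G}_N$ is the graph whose nodes are all triangulations of the convex $N$-gon, two being adjacent if they differ in a flip (removing a diagonal shared by two triangles and replacing it by the other diagonal of the resulting quadrilateral). A triangulation is colorful if no triangle has all three points of the same color. $\mathcal{F}_\alpha$ is the subgraph of $\mathcal{G}_N$ induced by the colorful triangulations. -}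

module Defs where

open import Data.Nat using (ℕ; zero; suc; _+_; _∸_; _<_; _≤_; _<ᵇ_)
open import Data.Bool using (Bool; true; false; not; if_then_else_)
open import Data.Fin using (Fin; toℕ)
open import Data.Vec using (Vec; lookup)
open import Data.List using (List; []; _∷_; _++_; [_]; length)
open import Data.Nat.ListAction using (sum)
open import Data.List.Relation.Unary.All using (All)
open import Data.List.Relation.Unary.Unique.Propositional using (Unique)
open import Data.List.Membership.Propositional using (_∈_)
open import Data.Product using (Σ; ∃; ∃-syntax; _×_; _,_)
open import Data.Sum using (_⊎_)
open import Data.Unit using (⊤)
open import Relation.Binary.PropositionalEquality using (_≡_; _≢_)
open import Relation.Nullary using (¬_)

-- Coloring.  Points of the N-gon are 0,…,N-1 (paper's label p+1 is our p).
-- true = red, false = blue.  The first α₁ points are red, the next α₂ blue, …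

colorAux : Bool → List ℕ → ℕ → Bool
colorAux b []       p = b
colorAux b (a ∷ as) p = if p <ᵇ a then b else colorAux (not b) as (p ∸ a)

color : List ℕ → ℕ → Bool
color α p = colorAux true α p

record ColoringSequence (α : List ℕ) : Set where
  field
    evenLength : ∃[ k ] length α ≡ k + k
    lengthPos  : 2 ≤ length α
    entriesPos : All (λ a → 1 ≤ a) α

IsSide : ℕ → ℕ → ℕ → Set
IsSide N i j = (j ≡ suc i) ⊎ (i ≡ 0 × suc j ≡ N)

IsDiag : ℕ → ℕ → ℕ → Set
IsDiag N i j = i < j × ¬ IsSide N i j

Crosses : ℕ → ℕ → ℕ → ℕ → Set
Crosses i j k l = (i < k × k < j × j < l) ⊎ (k < i × i < l × l < j)

-- A set of diagonals, stored canonically as a Boolean N×N matrix whose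
-- (i,j) entry is true iff {i,j} (with i < j) is in the set.
DiagSet : ℕ → Set
DiagSet N = Vec (Vec Bool N) N

_∋[_,_] : ∀ {N} → DiagSet N → Fin N → Fin N → Bool
D ∋[ i , j ] = lookup (lookup D i) j

record IsTriangulation {N : ℕ} (D : DiagSet N) : Set where
  field
    onlyDiags : ∀ i j → D ∋[ i , j ] ≡ true → IsDiag N (toℕ i) (toℕ j)
    nonCross  : ∀ i j k l → D ∋[ i , j ] ≡ true → D ∋[ k , l ] ≡ true →
                ¬ Crosses (toℕ i) (toℕ j) (toℕ k) (toℕ l)
    maximal   : ∀ i j → IsDiag N (toℕ i) (toℕ j) → D ∋[ i , j ] ≡ false →
                ∃[ k ] ∃[ l ] (D ∋[ k , l ] ≡ true × Crosses (toℕ i) (toℕ j) (toℕ k) (toℕ l))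

IsEdge : ∀ {N} → DiagSet N → Fin N → Fin N → Set
IsEdge {N} D i j = IsSide N (toℕ i) (toℕ j) ⊎ D ∋[ i , j ] ≡ true

IsTriangle : ∀ {N} → DiagSet N → Fin N → Fin N → Fin N → Set
IsTriangle D a b c =
  toℕ a < toℕ b × toℕ b < toℕ c × IsEdge D a b × IsEdge D b c × IsEdge D a c

Colorful : (α : List ℕ) → DiagSet (sum α) → Set
Colorful α D = ∀ a b c → IsTriangle D a b c →
  ¬ (color α (toℕ a) ≡ color α (toℕ b) × color α (toℕ b) ≡ color α (toℕ c))

Flip : ∀ {N} → DiagSet N → DiagSet N → Set
Flip {N} D D' =
  Σ (Fin N) λ e₁ → Σ (Fin N) λ e₂ → Σ (Fin N) λ f₁ → Σ (Fin N) λ f₂ →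
    D ∋[ e₁ , e₂ ] ≡ true × D' ∋[ e₁ , e₂ ] ≡ false ×
    D ∋[ f₁ , f₂ ] ≡ false × D' ∋[ f₁ , f₂ ] ≡ true ×
    (∀ i j → D ∋[ i , j ] ≢ D' ∋[ i , j ] →
       (i ≡ e₁ × j ≡ e₂) ⊎ (i ≡ f₁ × j ≡ f₂))

FNode : (α : List ℕ) → DiagSet (sum α) → Set
FNode α D = IsTriangulation D × Colorful α D

ConsecAdj : {V : Set} → (V → V → Set) → List V → Set
ConsecAdj Adj []           = ⊤
ConsecAdj Adj (x ∷ [])     = ⊤
ConsecAdj Adj (x ∷ y ∷ zs) = Adj x y × ConsecAdj Adj (y ∷ zs)

HamiltonCycle : {V : Set} → (P : V → Set) → (V → V → Set) → Set
HamiltonCycle {V} P Adj =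
  Σ V λ h → Σ (List V) λ rest →
    2 ≤ length rest ×
    Unique (h ∷ rest) ×
    All P (h ∷ rest) ×
    (∀ v → P v → v ∈ (h ∷ rest)) ×
    ConsecAdj Adj ((h ∷ rest) ++ [ h ])

{-# OPTIONS --safe #-}
module Submission where

-- Every triangle of a colorful triangulation has exactly one monochromatic edge.  Pairing the
-- triangles along monochromatic diagonals gives a dissection into q = ℓ/2 - 1 quadrilaterals and
-- triangles on monochromatic sides, and the triangulation is recovered from the dissection and one bit per
-- quadrilateral.  So the nodes over a fixed dissection form a q-dimensional cube, and flipping a
-- bichromatic edge leads to a neighbouring dissection, provided that at most two bits
-- have prescribed values.  The dissections have a spanning tree in which every node has at
-- most two children and the two flips to the children involve at most two bits
-- altogether.  As q ≥ 4, there remain two free bits i and j, and j can be chosen different from the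
-- direction in which the cube is entered.  A Gray code with fastest bit j contains all edges in
-- direction j; two of them, told apart by i, are replaced by tours of the two subtrees.

open import Defs
open import Data.Bool using (Bool; true; false; not)
open import Data.Bool.Properties using (not-¬; ¬-not; not-involutive) renaming (_≟_ to _≟ᵇ_)
open import Data.Empty using (⊥)
open import Data.Fin using (Fin; toℕ; fromℕ<)
open import Data.Fin.Properties as Fin using (toℕ<n; toℕ-fromℕ<; toℕ-injective)
open import Data.List using (List; []; _∷_; _++_; [_]; length; map; filter; replicate; concatMap)
open import Data.List.Membership.Propositional using (_∈_; _∉_)
open import Data.List.Membership.Propositional.Properties
  using (∈-++⁺ˡ; ∈-++⁺ʳ; ∈-++⁻; ∈-map⁺; ∈-map⁻; ∈-filter⁺; ∈-filter⁻)
open import Data.List.Properties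
  using (filter-notAll; ++-assoc; ++-identityʳ; ++-cancelʳ; length-map; length-++; length-replicate;
         map-++; map-∘; map-id; ∷-injective; ∷-injectiveʳ)
open import Data.List.Relation.Binary.Permutation.Propositional
  using (_↭_; ↭-refl; ↭-sym; ↭-trans; ↭-prep; ↭-swap; ↭-reflexive; ↭⇒↭ₛ; module PermutationReasoning)
open import Data.List.Relation.Binary.Permutation.Propositional.Properties
  using (∈-resp-↭; ++-comm; ++⁺; ++⁺ˡ; ++⁺ʳ; shift; shifts; drop-∷; map⁺)
import Data.List.Relation.Binary.Permutation.Setoid.Properties as PermSetoid
open import Data.List.Relation.Unary.All as All using (All; []; _∷_)
import Data.List.Relation.Unary.All.Properties as All
open import Data.List.Relation.Unary.AllPairs using ([]; _∷_)
open import Data.List.Relation.Unary.Any as Any using (here; there; any?)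
open import Data.List.Relation.Unary.Unique.Propositional using (Unique)
import Data.List.Relation.Unary.Unique.Propositional.Properties as Unique
open import Data.Nat
  using (ℕ; zero; suc; _+_; _∸_; _≤_; _<_; z≤n; s≤s; s≤s⁻¹; _≟_; _≤?_; _<?_)
open import Data.Nat.ListAction using (sum)
open import Data.Nat.Properties
  using (≤-refl; ≤-trans; ≤-reflexive; ≤-antisym; <-trans; <-irrefl; <-≤-trans; <-cmp; <⇒≤; <⇒≱; ≤⇒≯; ≰⇒>;
         ≮⇒≥; ≤∧≢⇒<; m≤n⇒m≤1+n; m≤n⇒m<n∨m≡n; n≤1+n; +-mono-≤; +-monoʳ-≤; +-suc; +-identityʳ;
         +-cancelʳ-≡; suc-injective)
open import Data.Nat.Tactic.RingSolver using (solve-∀)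
open import Data.Product using (Σ; ∃; ∃₂; _×_; _,_; proj₁; proj₂)
open import Data.Sum as Sum using (_⊎_; inj₁; inj₂)
open import Data.Unit using (⊤; tt)
open import Data.Vec using (lookup; tabulate)
open import Data.Vec.Properties using (lookup∘tabulate; tabulate∘lookup; tabulate-cong)
open import Function using (_∘_; id)
open import Relation.Binary.Definitions using (DecidableEquality; tri<; tri≈; tri>)
open import Relation.Binary.PropositionalEquality
  using (_≡_; _≢_; refl; sym; trans; cong; cong₂; subst; subst₂; setoid; ≢-sym)
open import Relation.Nullary
  using (¬_; Dec; yes; no; contradiction; ¬?; does; _×-dec_; _⊎-dec_; map′)
open import Relation.Nullary.Decidable using (dec-true; dec-false; decidable-stable)

-- Flipping a bichromatic edge keeps a triangulation colorful exactly when the two apexes over the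
-- edge differ in colour. A triangle on a monochromatic side has a fixed apex, whereas a
-- quadrilateral chooses the colour of its apex by its bit. Hence exchanging two such triangles
-- prescribes no bit, and moving a triangle past a quadrilateral prescribes one. Between two
-- quadrilaterals both bits are prescribed, and the two admissible settings lead to the two other
-- dissections of their common hexagon. So two children involve at most two bits if both come from
-- moves of triangles or both from one hexagon; other branchings are avoided.
--
-- The side from the last point to the first is bichromatic and serves as root, so dissections
-- become trees that depend only on the word of the remaining sides. The spanning tree grows with
-- the polygon: pairs of points are added to a single edge until there are as many points as blocks,
-- and then one block after the other gets its size. Each enlargement projects the new dissections
-- onto the old ones. The obstacle is to refine the old tree along the fibres without creating a
-- third child.

-- Dissections as trees, and the cube of bits over a dissection

data Side : Set where
  same diff : Side

-- A dissection of the polygon on one side of a bichromatic edge ij: just the side ij, a triangle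
-- i, i+1, j or i, j-1, j on a monochromatic side, or a quadrilateral i, b, r, j.
data Tree : Set where
  •   : Tree
  L R : Tree → Tree
  Q   : Tree → Tree → Tree → Tree

-- The sides are read from i to j, without the root edge. The dissections of a given polygon are the
-- trees with a given frontier.
frontier : Tree → List Side
frontier •         = [ diff ]
frontier (L T)     = same ∷ frontier T
frontier (R T)     = frontier T ++ [ same ]
frontier (Q A B C) = frontier A ++ frontier B ++ frontier C

-- A bit selects the diagonal ir (false) or bj (true) of a quadrilateral i, b, r, j.
data Bits : Tree → Set where
  •ᵇ : Bits •
  Lᵇ : ∀ {T} → Bits T → Bits (L T)
  Rᵇ : ∀ {T} → Bits T → Bits (R T)
  Qᵇ : ∀ {A B C} → Bool → Bits A → Bits B → Bits C → Bits (Q A B C)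

-- One position for each quadrilateral; these are the directions of the cube over the tree.
data Pos : Tree → Set where
  root : ∀ {A B C} → Pos (Q A B C)
  inᴸ  : ∀ {T} → Pos T → Pos (L T)
  inᴿ  : ∀ {T} → Pos T → Pos (R T)
  in₁  : ∀ {A B C} → Pos A → Pos (Q A B C)
  in₂  : ∀ {A B C} → Pos B → Pos (Q A B C)
  in₃  : ∀ {A B C} → Pos C → Pos (Q A B C)

inᴸ-inj : ∀ {T} {j k : Pos T} → inᴸ j ≡ inᴸ k → j ≡ k
inᴸ-inj refl = refl

inᴿ-inj : ∀ {T} {j k : Pos T} → inᴿ j ≡ inᴿ k → j ≡ k
inᴿ-inj refl = refl

in₁-inj : ∀ {A B C} {j k : Pos A} → in₁ {A} {B} {C} j ≡ in₁ k → j ≡ k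
in₁-inj refl = refl

in₂-inj : ∀ {A B C} {j k : Pos B} → in₂ {A} {B} {C} j ≡ in₂ k → j ≡ k
in₂-inj refl = refl

in₃-inj : ∀ {A B C} {j k : Pos C} → in₃ {A} {B} {C} j ≡ in₃ k → j ≡ k
in₃-inj refl = refl

infix 4 _≟ᵖ_

_≟ᵖ_ : ∀ {T} → DecidableEquality (Pos T)
root ≟ᵖ root  = yes refl
root ≟ᵖ in₁ _ = no λ ()
root ≟ᵖ in₂ _ = no λ ()
root ≟ᵖ in₃ _ = no λ ()
inᴸ j ≟ᵖ inᴸ k with j ≟ᵖ k
... | yes refl = yes refl
... | no j≢k = no (j≢k ∘ inᴸ-inj)
inᴿ j ≟ᵖ inᴿ k with j ≟ᵖ k
... | yes refl = yes refl
... | no j≢k = no (j≢k ∘ inᴿ-inj)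
in₁ _ ≟ᵖ root  = no λ ()
in₁ j ≟ᵖ in₁ k with j ≟ᵖ k
... | yes refl = yes refl
... | no j≢k = no (j≢k ∘ in₁-inj)
in₁ _ ≟ᵖ in₂ _ = no λ ()
in₁ _ ≟ᵖ in₃ _ = no λ ()
in₂ _ ≟ᵖ root  = no λ ()
in₂ _ ≟ᵖ in₁ _ = no λ ()
in₂ j ≟ᵖ in₂ k with j ≟ᵖ k
... | yes refl = yes refl
... | no j≢k = no (j≢k ∘ in₂-inj)
in₂ _ ≟ᵖ in₃ _ = no λ ()
in₃ _ ≟ᵖ root  = no λ ()
in₃ _ ≟ᵖ in₁ _ = no λ ()
in₃ _ ≟ᵖ in₂ _ = no λ ()
in₃ j ≟ᵖ in₃ k with j ≟ᵖ k
... | yes refl = yes refl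
... | no j≢k = no (j≢k ∘ in₃-inj)

get : ∀ {T} → Pos T → Bits T → Bool
get root    (Qᵇ q a b c) = q
get (inᴸ k) (Lᵇ x)       = get k x
get (inᴿ k) (Rᵇ x)       = get k x
get (in₁ k) (Qᵇ q a b c) = get k a
get (in₂ k) (Qᵇ q a b c) = get k b
get (in₃ k) (Qᵇ q a b c) = get k c

flip : ∀ {T} → Pos T → Bits T → Bits T
flip root    (Qᵇ q a b c) = Qᵇ (not q) a b c
flip (inᴸ k) (Lᵇ x)       = Lᵇ (flip k x)
flip (inᴿ k) (Rᵇ x)       = Rᵇ (flip k x)
flip (in₁ k) (Qᵇ q a b c) = Qᵇ q (flip k a) b c
flip (in₂ k) (Qᵇ q a b c) = Qᵇ q a (flip k b) c
flip (in₃ k) (Qᵇ q a b c) = Qᵇ q a b (flip k c)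

get-flip : ∀ {T} (k : Pos T) x → get k (flip k x) ≡ not (get k x)
get-flip root    (Qᵇ q a b c) = refl
get-flip (inᴸ k) (Lᵇ x)       = get-flip k x
get-flip (inᴿ k) (Rᵇ x)       = get-flip k x
get-flip (in₁ k) (Qᵇ q a b c) = get-flip k a
get-flip (in₂ k) (Qᵇ q a b c) = get-flip k b
get-flip (in₃ k) (Qᵇ q a b c) = get-flip k c

get-flip-≢ : ∀ {T} (j k : Pos T) x → j ≢ k → get j (flip k x) ≡ get j x
get-flip-≢ root    root    (Qᵇ q a b c) ne = contradiction refl ne
get-flip-≢ root    (in₁ k) (Qᵇ q a b c) ne = refl
get-flip-≢ root    (in₂ k) (Qᵇ q a b c) ne = refl
get-flip-≢ root    (in₃ k) (Qᵇ q a b c) ne = refl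
get-flip-≢ (inᴸ j) (inᴸ k) (Lᵇ x)       ne = get-flip-≢ j k x (ne ∘ cong inᴸ)
get-flip-≢ (inᴿ j) (inᴿ k) (Rᵇ x)       ne = get-flip-≢ j k x (ne ∘ cong inᴿ)
get-flip-≢ (in₁ j) root    (Qᵇ q a b c) ne = refl
get-flip-≢ (in₁ j) (in₁ k) (Qᵇ q a b c) ne = get-flip-≢ j k a (ne ∘ cong in₁)
get-flip-≢ (in₁ j) (in₂ k) (Qᵇ q a b c) ne = refl
get-flip-≢ (in₁ j) (in₃ k) (Qᵇ q a b c) ne = refl
get-flip-≢ (in₂ j) root    (Qᵇ q a b c) ne = refl
get-flip-≢ (in₂ j) (in₁ k) (Qᵇ q a b c) ne = refl
get-flip-≢ (in₂ j) (in₂ k) (Qᵇ q a b c) ne = get-flip-≢ j k b (ne ∘ cong in₂)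
get-flip-≢ (in₂ j) (in₃ k) (Qᵇ q a b c) ne = refl
get-flip-≢ (in₃ j) root    (Qᵇ q a b c) ne = refl
get-flip-≢ (in₃ j) (in₁ k) (Qᵇ q a b c) ne = refl
get-flip-≢ (in₃ j) (in₂ k) (Qᵇ q a b c) ne = refl
get-flip-≢ (in₃ j) (in₃ k) (Qᵇ q a b c) ne = get-flip-≢ j k c (ne ∘ cong in₃)

Bits-ext : ∀ {T} (x y : Bits T) → (∀ k → get k x ≡ get k y) → x ≡ y
Bits-ext •ᵇ     •ᵇ     eq = refl
Bits-ext (Lᵇ x) (Lᵇ y) eq = cong Lᵇ (Bits-ext x y (eq ∘ inᴸ))
Bits-ext (Rᵇ x) (Rᵇ y) eq = cong Rᵇ (Bits-ext x y (eq ∘ inᴿ))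
Bits-ext (Qᵇ q a b c) (Qᵇ q' a' b' c') eq
  with refl ← eq root | refl ← Bits-ext a a' (eq ∘ in₁)
     | refl ← Bits-ext b b' (eq ∘ in₂) | refl ← Bits-ext c c' (eq ∘ in₃) = refl

flip-involutive : ∀ {T} (k : Pos T) x → flip k (flip k x) ≡ x
flip-involutive k x = Bits-ext _ _ eq
  where
  eq : ∀ j → get j (flip k (flip k x)) ≡ get j x
  eq j with j ≟ᵖ k
  ... | yes refl = trans (get-flip k _) (trans (cong not (get-flip k x)) (not-involutive _))
  ... | no j≢k   = trans (get-flip-≢ j k _ j≢k) (get-flip-≢ j k x j≢k)

flip-comm : ∀ {T} (j k : Pos T) x → flip j (flip k x) ≡ flip k (flip j x)
flip-comm j k x with j ≟ᵖ k
... | yes refl = refl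
... | no j≢k   = Bits-ext _ _ eq
  where
  eq : ∀ i → get i (flip j (flip k x)) ≡ get i (flip k (flip j x))
  eq i with i ≟ᵖ j | i ≟ᵖ k
  ... | yes refl | yes refl = contradiction refl j≢k
  ... | yes refl | no i≢k   = trans (get-flip i _) (trans (cong not (get-flip-≢ i k x i≢k))
                                (sym (trans (get-flip-≢ i k _ i≢k) (get-flip i x))))
  ... | no i≢j   | yes refl = trans (get-flip-≢ i j _ i≢j) (trans (get-flip i x)
                                (sym (trans (get-flip i _) (cong not (get-flip-≢ i j x i≢j)))))
  ... | no i≢j   | no i≢k   = trans (get-flip-≢ i j _ i≢j) (trans (get-flip-≢ i k x i≢k)
                                (sym (trans (get-flip-≢ i k _ i≢k) (get-flip-≢ i j x i≢j))))

positions : ∀ T → List (Pos T)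
positions •         = []
positions (L T)     = map inᴸ (positions T)
positions (R T)     = map inᴿ (positions T)
positions (Q A B C) =
  root ∷ map in₁ (positions A) ++ map in₂ (positions B) ++ map in₃ (positions C)

∈-positions : ∀ {T} (k : Pos T) → k ∈ positions T
∈-positions root    = here refl
∈-positions (inᴸ k) = ∈-map⁺ inᴸ (∈-positions k)
∈-positions (inᴿ k) = ∈-map⁺ inᴿ (∈-positions k)
∈-positions (in₁ k) = there (∈-++⁺ˡ (∈-map⁺ in₁ (∈-positions k)))
∈-positions {Q A B C} (in₂ k) =
  there (∈-++⁺ʳ (map in₁ (positions A)) (∈-++⁺ˡ (∈-map⁺ in₂ (∈-positions k))))
∈-positions {Q A B C} (in₃ k) =
  there (∈-++⁺ʳ (map in₁ (positions A)) (∈-++⁺ʳ (map in₂ (positions B)) (∈-map⁺ in₃ (∈-positions k))))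

positions-unique : ∀ T → Unique (positions T)
positions-unique •     = []
positions-unique (L T) = Unique.map⁺ inᴸ-inj (positions-unique T)
positions-unique (R T) = Unique.map⁺ inᴿ-inj (positions-unique T)
positions-unique (Q A B C) =
  All.tabulate root∉ ∷
  Unique.++⁺ (Unique.map⁺ in₁-inj (positions-unique A))
    (Unique.++⁺ (Unique.map⁺ in₂-inj (positions-unique B)) (Unique.map⁺ in₃-inj (positions-unique C)) dis₂₃)
    dis₁
  where
  dis₂₃ : ∀ {k} → ¬ (k ∈ map in₂ (positions B) × k ∈ map in₃ (positions C))
  dis₂₃ (p , q) with ∈-map⁻ in₂ p | ∈-map⁻ in₃ q
  ... | _ , _ , refl | _ , _ , ()
  dis₁ : ∀ {k} → ¬ (k ∈ map in₁ (positions A) × k ∈ map in₂ (positions B) ++ map in₃ (positions C))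
  dis₁ (p , q) with ∈-map⁻ in₁ p | ∈-++⁻ (map in₂ (positions B)) q
  ... | _ , _ , refl | inj₁ r with ∈-map⁻ in₂ r
  ...   | _ , _ , ()
  dis₁ (p , q) | _ , _ , refl | inj₂ r with ∈-map⁻ in₃ r
  ...   | _ , _ , ()
  root∉ : ∀ {k} → k ∈ map in₁ (positions A) ++ map in₂ (positions B) ++ map in₃ (positions C) → root ≢ k
  root∉ p refl with ∈-++⁻ (map in₁ (positions A)) p
  ... | inj₁ q with ∈-map⁻ in₁ q
  ...   | _ , _ , ()
  root∉ p refl | inj₂ q with ∈-++⁻ (map in₂ (positions B)) q
  ... | inj₁ r with ∈-map⁻ in₂ r
  ...   | _ , _ , ()
  root∉ p refl | inj₂ q | inj₂ r with ∈-map⁻ in₃ r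
  ...   | _ , _ , ()

-- Triangulations as binary trees, flips as rotations

-- Triangulations of a polygon, rooted at one of its sides.
data Bin : Set where
  leaf : Side → Bin
  node : Bin → Bin → Bin

-- The two sides of `rot` are the two ways to cut the quadrilateral formed by the root edge and the
-- root edges of `a`, `b`, `c`, so a rotation is a diagonal flip.
data Rot : Bin → Bin → Set where
  rot : ∀ {a b c} → Rot (node (node a b) c) (node a (node b c))
  rotˡ : ∀ {a a' b} → Rot a a' → Rot (node a b) (node a' b)
  rotʳ : ∀ {a b b'} → Rot b b' → Rot (node a b) (node a b')

Rot± : Bin → Bin → Set
Rot± t t' = Rot t t' ⊎ Rot t' t

Rot±-sym : ∀ {t t'} → Rot± t t' → Rot± t' t
Rot±-sym (inj₁ r) = inj₂ r
Rot±-sym (inj₂ r) = inj₁ r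

rot±ˡ : ∀ {a a' b} → Rot± a a' → Rot± (node a b) (node a' b)
rot±ˡ (inj₁ r) = inj₁ (rotˡ r)
rot±ˡ (inj₂ r) = inj₂ (rotˡ r)

rot±ʳ : ∀ {a b b'} → Rot± b b' → Rot± (node a b) (node a b')
rot±ʳ (inj₁ r) = inj₁ (rotʳ r)
rot±ʳ (inj₂ r) = inj₂ (rotʳ r)

bin : ∀ {T} → Bits T → Bin
bin •ᵇ               = leaf diff
bin (Lᵇ x)           = node (leaf same) (bin x)
bin (Rᵇ x)           = node (bin x) (leaf same)
bin (Qᵇ false a b c) = node (node (bin a) (bin b)) (bin c)
bin (Qᵇ true a b c)  = node (bin a) (node (bin b) (bin c))

bin-cong₁ : ∀ {A A' B C} q {x : Bits A} {x' : Bits A'} {b : Bits B} {c : Bits C} →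
  Rot± (bin x) (bin x') → Rot± (bin (Qᵇ q x b c)) (bin (Qᵇ q x' b c))
bin-cong₁ false r = rot±ˡ (rot±ˡ r)
bin-cong₁ true  r = rot±ˡ r

bin-cong₂ : ∀ {A B B' C} q {a : Bits A} {x : Bits B} {x' : Bits B'} {c : Bits C} →
  Rot± (bin x) (bin x') → Rot± (bin (Qᵇ q a x c)) (bin (Qᵇ q a x' c))
bin-cong₂ false r = rot±ˡ (rot±ʳ r)
bin-cong₂ true  r = rot±ʳ (rot±ˡ r)

bin-cong₃ : ∀ {A B C C'} q {a : Bits A} {b : Bits B} {x : Bits C} {x' : Bits C'} →
  Rot± (bin x) (bin x') → Rot± (bin (Qᵇ q a b x)) (bin (Qᵇ q a b x'))
bin-cong₃ false r = rot±ʳ r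
bin-cong₃ true  r = rot±ʳ (rot±ʳ r)

bin-flip : ∀ {T} (k : Pos T) x → Rot± (bin x) (bin (flip k x))
bin-flip root    (Qᵇ false a b c) = inj₁ rot
bin-flip root    (Qᵇ true a b c)  = inj₂ rot
bin-flip (inᴸ k) (Lᵇ x)           = rot±ʳ (bin-flip k x)
bin-flip (inᴿ k) (Rᵇ x)           = rot±ˡ (bin-flip k x)
bin-flip (in₁ k) (Qᵇ q a b c)     = bin-cong₁ q (bin-flip k a)
bin-flip (in₂ k) (Qᵇ q a b c)     = bin-cong₂ q (bin-flip k b)
bin-flip (in₃ k) (Qᵇ q a b c)     = bin-cong₃ q (bin-flip k c)

-- Paths through decorated dissections, and detours

State : Set
State = Σ Tree Bits

_∼_ : State → State → Set
(_ , x) ∼ (_ , y) = Rot± (bin x) (bin y)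

data Path : State → State → List State → Set where
  end  : ∀ {u} → Path u u [ u ]
  step : ∀ {u v w vs} → u ∼ v → Path v w vs → Path u w (u ∷ vs)

join : ∀ {a b c d vs ws} → Path a b vs → b ∼ c → Path c d ws → Path a d (vs ++ ws)
join end        r q = step r q
join (step s p) r q = step s (join p r q)

data Consecutive (u v : State) : List State → Set where
  here  : ∀ {vs} → Consecutive u v (u ∷ v ∷ vs)
  there : ∀ {w vs} → Consecutive u v vs → Consecutive u v (w ∷ vs)

Consecutive-++ˡ : ∀ {u v vs ws} → Consecutive u v vs → Consecutive u v (vs ++ ws)
Consecutive-++ˡ here      = here
Consecutive-++ˡ (there c) = there (Consecutive-++ˡ c)

Consecutive-++ʳ : ∀ {u v} vs {ws} → Consecutive u v ws → Consecutive u v (vs ++ ws)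
Consecutive-++ʳ []       c = c
Consecutive-++ʳ (_ ∷ vs) c = there (Consecutive-++ʳ vs c)

path-head : ∀ {a b v vs} → Path a b (v ∷ vs) → a ≡ v
path-head end        = refl
path-head (step _ _) = refl

-- Only the step from `u` to `v` is broken up. The last component records that all other steps
-- survive, which permits a second detour on the same path.
detour : ∀ {a b u v c d vs ws} → Path a b vs → Consecutive u v vs →
  u ∼ c → Path c d ws → d ∼ v →
  ∃ λ vs' → Path a b vs' × vs' ↭ vs ++ ws ×
    (∀ {u' v'} → Consecutive u' v' vs → u' ≢ u ⊎ v' ≢ v → Consecutive u' v' vs')
detour {u = u} {v} {ws = ws} (step {vs = _ ∷ vs} _ p) here r q s with refl ← path-head p =
  u ∷ ws ++ v ∷ vs , step r (join q s p) , ↭-prep u (++-comm ws (v ∷ vs)) , keep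
  where
  keep : ∀ {u' v'} → Consecutive u' v' (u ∷ v ∷ vs) → u' ≢ u ⊎ v' ≢ v →
    Consecutive u' v' (u ∷ ws ++ v ∷ vs)
  keep here (inj₁ ne) = contradiction refl ne
  keep here (inj₂ ne) = contradiction refl ne
  keep (there e) _    = there (Consecutive-++ʳ ws e)
detour (step {vs = _ ∷ _} e p) (there k) r q s with refl ← path-head p
  with detour p k r q s
-- The new path is split only to expose its first vertex, so that the step `e` is seen to remain
-- consecutive.
... | _ , end        , perm , keep = _ , step e end , ↭-prep _ perm , keep'
  where
  keep' : ∀ {u' v'} → Consecutive u' v' _ → _ → Consecutive u' v' _
  keep' here _ = here
  keep' (there c) ne = there (keep c ne)
... | _ , step e' p' , perm , keep = _ , step e (step e' p') , ↭-prep _ perm , keep'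
  where
  keep' : ∀ {u' v'} → Consecutive u' v' _ → _ → Consecutive u' v' _
  keep' here _ = here
  keep' (there c) ne = there (keep c ne)

-- Gray codes

-- The reflected Gray code flipping the bits at the positions ps; its two
-- ends differ in the first position only.

gray-end : ∀ {T} → List (Pos T) → Bits T → Bits T
gray-end []       x = x
gray-end (p ∷ ps) x = flip p x

gray : ∀ {T} → List (Pos T) → Bits T → List (Bits T)
gray []       x = [ x ]
gray (p ∷ ps) x = gray ps x ++ gray ps (flip p (gray-end ps x))

-- The second half undoes the flip of the slowest bit made by the first half, so only the flip of
-- `p` between the halves remains.
gray-end-reflect : ∀ {T} p (ps : List (Pos T)) x → gray-end ps (flip p (gray-end ps x)) ≡ flip p x
gray-end-reflect p []       x = refl
gray-end-reflect p (r ∷ ps) x =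
  trans (cong (flip r) (flip-comm p r x)) (flip-involutive r _)

gray-path : ∀ {T} (ps : List (Pos T)) x →
  Path (T , x) (T , gray-end ps x) (map (T ,_) (gray ps x))
gray-path []       x = end
gray-path {T} (p ∷ ps) x =
  subst₂ (λ y vs → Path (T , x) (T , y) vs) (gray-end-reflect p ps x)
    (sym (map-++ (T ,_) (gray ps x) _))
    (join (gray-path ps x) (bin-flip p _) (gray-path ps _))

-- The subcube through `x` spanned by the directions `ps`.
AgreeOff : ∀ {T} → List (Pos T) → Bits T → Bits T → Set
AgreeOff ps x y = ∀ k → k ∉ ps → get k y ≡ get k x

gray-end-agree : ∀ {T} (ps : List (Pos T)) x → AgreeOff ps x (gray-end ps x)
gray-end-agree []       x k _  = refl
gray-end-agree (p ∷ ps) x k k∉ = get-flip-≢ k p x (k∉ ∘ here)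

gray-sound : ∀ {T} (ps : List (Pos T)) x {y} → y ∈ gray ps x → AgreeOff ps x y
gray-sound []       x (here refl) k _ = refl
gray-sound (p ∷ ps) x y∈ k k∉ with ∈-++⁻ (gray ps x) y∈
... | inj₁ y∈ˡ = gray-sound ps x y∈ˡ k (k∉ ∘ there)
... | inj₂ y∈ʳ = trans (gray-sound ps _ y∈ʳ k (k∉ ∘ there))
                   (trans (get-flip-≢ k p _ (k∉ ∘ here)) (gray-end-agree ps x k (k∉ ∘ there)))

gray-complete : ∀ {T} (ps : List (Pos T)) x y → AgreeOff ps x y → y ∈ gray ps x
gray-complete []       x y ag = here (Bits-ext y x λ k → ag k λ ())
gray-complete (p ∷ ps) x y ag with get p y ≟ᵇ get p x
... | yes eq = ∈-++⁺ˡ (gray-complete ps x y ag')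
  where
  ag' : AgreeOff ps x y
  ag' k k∉ with k ≟ᵖ p
  ... | yes refl = eq
  ... | no k≢p   = ag k λ { (here e) → k≢p e ; (there k∈) → k∉ k∈ }
... | no ne = ∈-++⁺ʳ (gray ps x) (gray-complete ps _ y ag')
  where
  ag' : AgreeOff ps (flip p (gray-end ps x)) y
  ag' k k∉ with k ≟ᵖ p
  ... | yes refl = trans (¬-not ne) (sym (trans (get-flip p _) (cong not (gray-end-agree ps x p k∉))))
  ... | no k≢p   = trans (ag k λ { (here e) → k≢p e ; (there k∈) → k∉ k∈ })
                     (sym (trans (get-flip-≢ k p _ k≢p) (gray-end-agree ps x k k∉)))

gray-unique : ∀ {T} (ps : List (Pos T)) x → Unique ps → Unique (gray ps x)
gray-unique []       x _          = [] ∷ []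
gray-unique (p ∷ ps) x (p# ∷ ps!) =
  Unique.++⁺ (gray-unique ps x ps!) (gray-unique ps _ ps!) disjoint
  where
  p∉ : p ∉ ps
  p∉ p∈ = All.lookup p# p∈ refl
  disjoint : ∀ {y} → ¬ (y ∈ gray ps x × y ∈ gray ps (flip p (gray-end ps x)))
  disjoint (y∈ˡ , y∈ʳ) = not-¬ refl (trans (sym (gray-sound ps x y∈ˡ p p∉))
    (trans (gray-sound ps _ y∈ʳ p p∉) (trans (get-flip p _) (cong not (gray-end-agree ps x p p∉)))))

-- The Gray code may use an edge in either direction, and which one is not tracked.
Joined : List State → State → State → Set
Joined vs u v = Consecutive u v vs ⊎ Consecutive v u vs

-- The last position is flipped inside each innermost block of two, so every vertex meets its
-- neighbour in direction `k` within its own block.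
gray-joined : ∀ {T} (ps : List (Pos T)) k x y → y ∈ gray (ps ++ [ k ]) x →
  Joined (map (T ,_) (gray (ps ++ [ k ]) x)) (T , y) (T , flip k y)
gray-joined [] k x y (here refl)         = inj₁ here
gray-joined {T} [] k x y (there (here refl)) =
  inj₂ (subst (λ z → Consecutive (T , z) (T , flip k x) ((T , x) ∷ (T , flip k x) ∷ [])) (sym (flip-involutive k x)) here)
gray-joined {T} (p ∷ ps) k x y y∈ =
  subst (λ vs → Joined vs (T , y) (T , flip k y)) (sym (map-++ (T ,_) (gray (ps ++ [ k ]) x) _))
    (halves (∈-++⁻ (gray (ps ++ [ k ]) x) y∈))
  where
  halves : _ → Joined (map (T ,_) (gray (ps ++ [ k ]) x) ++ _) (T , y) (T , flip k y)
  halves (inj₁ y∈ˡ) = Sum.map Consecutive-++ˡ Consecutive-++ˡ (gray-joined ps k x y y∈ˡ)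
  halves (inj₂ y∈ʳ) = Sum.map (Consecutive-++ʳ _) (Consecutive-++ʳ _) (gray-joined ps k _ y y∈ʳ)

Unique-resp-↭ : ∀ {A : Set} {xs ys : List A} → xs ↭ ys → Unique xs → Unique ys
Unique-resp-↭ {A} p = PermSetoid.Unique-resp-↭ (setoid A) (↭⇒↭ₛ p)

Unique-++⁻ : ∀ {A : Set} (xs : List A) {ys} → Unique (xs ++ ys) →
  Unique xs × Unique ys × (∀ {v} → v ∈ xs → v ∈ ys → ⊥)
Unique-++⁻ []       u       = [] , u , λ ()
Unique-++⁻ (x ∷ xs) (x# ∷ u) with uˡ , uʳ , dis ← Unique-++⁻ xs u =
  All.++⁻ˡ xs x# ∷ uˡ , uʳ ,
  λ { (here refl) v∈ → All.lookup (All.++⁻ʳ xs x#) v∈ refl ; (there v∈) → dis v∈ }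

-- Links: flips of bichromatic edges between dissections

-- Two dissections related by a flip that is available as soon as the bits at
-- the positions K have the right values.  The map near sets these bits to the right values,
-- and far gives the decorated tree on the other side of the flip.
record Link (S S' : Tree) (K : List (Pos S)) : Set where
  field
    near : Bits S → Bits S
    far  : Bits S → Bits S'
    adjacent : ∀ x → Rot± (bin (near x)) (bin (far x))
    free : ∀ k x → k ∉ K → near (flip k x) ≡ flip k (near x)
                         × get k (near x) ≡ get k x
                         × ∃ λ k' → far (flip k x) ≡ flip k' (far x)

open Link

module _ {T T' : Tree} {K : List (Pos T)} (e : Link T T' K) where

  -- A flip inside a subtree leaves all other cells alone; their bits are free and correspond to
  -- themselves on the far side.
  link-L : Link (L T) (L T') (map inᴸ K)
  link-L .near (Lᵇ x) = Lᵇ (near e x)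
  link-L .far  (Lᵇ x) = Lᵇ (far e x)
  link-L .adjacent (Lᵇ x) = rot±ʳ (adjacent e x)
  link-L .free (inᴸ k) (Lᵇ x) k∉ with n , g , k' , f ← free e k x (k∉ ∘ ∈-map⁺ inᴸ) =
    cong Lᵇ n , g , inᴸ k' , cong Lᵇ f

  link-R : Link (R T) (R T') (map inᴿ K)
  link-R .near (Rᵇ x) = Rᵇ (near e x)
  link-R .far  (Rᵇ x) = Rᵇ (far e x)
  link-R .adjacent (Rᵇ x) = rot±ˡ (adjacent e x)
  link-R .free (inᴿ k) (Rᵇ x) k∉ with n , g , k' , f ← free e k x (k∉ ∘ ∈-map⁺ inᴿ) =
    cong Rᵇ n , g , inᴿ k' , cong Rᵇ f

  module _ {A B : Tree} where

    link-Q₁ : Link (Q T A B) (Q T' A B) (map in₁ K)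
    link-Q₁ .near (Qᵇ q x a b) = Qᵇ q (near e x) a b
    link-Q₁ .far  (Qᵇ q x a b) = Qᵇ q (far e x) a b
    link-Q₁ .adjacent (Qᵇ q x a b) = bin-cong₁ q (adjacent e x)
    link-Q₁ .free root    (Qᵇ q x a b) k∉ = refl , refl , root , refl
    link-Q₁ .free (in₁ k) (Qᵇ q x a b) k∉ with n , g , k' , f ← free e k x (k∉ ∘ ∈-map⁺ in₁) =
      cong (λ y → Qᵇ q y a b) n , g , in₁ k' , cong (λ y → Qᵇ q y a b) f
    link-Q₁ .free (in₂ k) (Qᵇ q x a b) k∉ = refl , refl , in₂ k , refl
    link-Q₁ .free (in₃ k) (Qᵇ q x a b) k∉ = refl , refl , in₃ k , refl

    link-Q₂ : Link (Q A T B) (Q A T' B) (map in₂ K)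
    link-Q₂ .near (Qᵇ q a x b) = Qᵇ q a (near e x) b
    link-Q₂ .far  (Qᵇ q a x b) = Qᵇ q a (far e x) b
    link-Q₂ .adjacent (Qᵇ q a x b) = bin-cong₂ q (adjacent e x)
    link-Q₂ .free root    (Qᵇ q a x b) k∉ = refl , refl , root , refl
    link-Q₂ .free (in₁ k) (Qᵇ q a x b) k∉ = refl , refl , in₁ k , refl
    link-Q₂ .free (in₂ k) (Qᵇ q a x b) k∉ with n , g , k' , f ← free e k x (k∉ ∘ ∈-map⁺ in₂) =
      cong (λ y → Qᵇ q a y b) n , g , in₂ k' , cong (λ y → Qᵇ q a y b) f
    link-Q₂ .free (in₃ k) (Qᵇ q a x b) k∉ = refl , refl , in₃ k , refl

    link-Q₃ : Link (Q A B T) (Q A B T') (map in₃ K)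
    link-Q₃ .near (Qᵇ q a b x) = Qᵇ q a b (near e x)
    link-Q₃ .far  (Qᵇ q a b x) = Qᵇ q a b (far e x)
    link-Q₃ .adjacent (Qᵇ q a b x) = bin-cong₃ q (adjacent e x)
    link-Q₃ .free root    (Qᵇ q a b x) k∉ = refl , refl , root , refl
    link-Q₃ .free (in₁ k) (Qᵇ q a b x) k∉ = refl , refl , in₁ k , refl
    link-Q₃ .free (in₂ k) (Qᵇ q a b x) k∉ = refl , refl , in₂ k , refl
    link-Q₃ .free (in₃ k) (Qᵇ q a b x) k∉ with n , g , k' , f ← free e k x (k∉ ∘ ∈-map⁺ in₃) =
      cong (λ y → Qᵇ q a b y) n , g , in₃ k' , cong (λ y → Qᵇ q a b y) f

link-weaken : ∀ {S S' K K'} → (∀ {k} → k ∈ K → k ∈ K') → Link S S' K → Link S S' K'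
link-weaken K⊆K' e .near = near e
link-weaken K⊆K' e .far = far e
link-weaken K⊆K' e .adjacent = adjacent e
link-weaken K⊆K' e .free k x k∉ = free e k x (k∉ ∘ K⊆K')

-- Flips moving a triangle with a monochromatic side across another cell.
data Swap : Tree → Tree → Set where
  LR  : ∀ {T} → Swap (L (R T)) (R (L T))
  LQ  : ∀ {A B C} → Swap (L (Q A B C)) (Q (L A) B C)
  Q₁₂ : ∀ {A B C} → Swap (Q (R A) B C) (Q A (L B) C)
  Q₂₃ : ∀ {A B C} → Swap (Q A (R B) C) (Q A B (L C))
  QR  : ∀ {A B C} → Swap (Q A B (R C)) (R (Q A B C))
  swap-sym : ∀ {T T'} → Swap T T' → Swap T' T
  swap-L  : ∀ {T T'} → Swap T T' → Swap (L T) (L T')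
  swap-R  : ∀ {T T'} → Swap T T' → Swap (R T) (R T')
  swap-Q₁ : ∀ {T T' A B} → Swap T T' → Swap (Q T A B) (Q T' A B)
  swap-Q₂ : ∀ {T T' A B} → Swap T T' → Swap (Q A T B) (Q A T' B)
  swap-Q₃ : ∀ {T T' A B} → Swap T T' → Swap (Q A B T) (Q A B T')

-- The three ways to cut a hexagon into two quadrilaterals.
data Hex : Tree → Tree → Tree → Set where
  hexagon : ∀ {A B C D E} → Hex (Q (Q A B C) D E) (Q A (Q B C D) E) (Q A B (Q C D E))
  hex-rotate : ∀ {S T U} → Hex S T U → Hex T U S
  hex-mirror : ∀ {S T U} → Hex S T U → Hex S U T
  hex-L  : ∀ {S T U} → Hex S T U → Hex (L S) (L T) (L U)
  hex-R  : ∀ {S T U} → Hex S T U → Hex (R S) (R T) (R U)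
  hex-Q₁ : ∀ {S T U A B} → Hex S T U → Hex (Q S A B) (Q T A B) (Q U A B)
  hex-Q₂ : ∀ {S T U A B} → Hex S T U → Hex (Q A S B) (Q A T B) (Q A U B)
  hex-Q₃ : ∀ {S T U A B} → Hex S T U → Hex (Q A B S) (Q A B T) (Q A B U)

swap-frontier : ∀ {T T'} → Swap T T' → frontier T ≡ frontier T'
swap-frontier LR = refl
swap-frontier LQ = refl
swap-frontier (Q₁₂ {A}) = ++-assoc (frontier A) _ _
swap-frontier (Q₂₃ {A} {B}) = cong (frontier A ++_) (++-assoc (frontier B) _ _)
swap-frontier (QR {A} {B}) =
  sym (trans (++-assoc (frontier A) _ _) (cong (frontier A ++_) (++-assoc (frontier B) _ _)))
swap-frontier (swap-sym s) = sym (swap-frontier s)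
swap-frontier (swap-L s)   = cong (same ∷_) (swap-frontier s)
swap-frontier (swap-R s)   = cong (_++ _) (swap-frontier s)
swap-frontier (swap-Q₁ s)  = cong (_++ _) (swap-frontier s)
swap-frontier (swap-Q₂ {A = A} s) = cong (λ w → frontier A ++ w ++ _) (swap-frontier s)
swap-frontier (swap-Q₃ {A = A} {B} s) = cong (λ w → frontier A ++ frontier B ++ w) (swap-frontier s)

hex-frontier : ∀ {S T U} → Hex S T U → frontier S ≡ frontier T × frontier T ≡ frontier U
hex-frontier (hexagon {A} {B} {C} {D} {E}) =
  trans (++-assoc a _ _) (cong (a ++_) (trans (++-assoc b _ _) (sym bcde))) , cong (a ++_) bcde
  where
  a = frontier A
  b = frontier B
  c = frontier C
  d = frontier D
  bcde : (b ++ c ++ d) ++ frontier E ≡ b ++ c ++ d ++ frontier E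
  bcde = trans (++-assoc b _ _) (cong (b ++_) (++-assoc c _ _))
hex-frontier (hex-rotate h) with p , q ← hex-frontier h = q , sym (trans p q)
hex-frontier (hex-mirror h) with p , q ← hex-frontier h = trans p q , sym q
hex-frontier (hex-L h) with p , q ← hex-frontier h = cong (same ∷_) p , cong (same ∷_) q
hex-frontier (hex-R h) with p , q ← hex-frontier h = cong (_++ _) p , cong (_++ _) q
hex-frontier (hex-Q₁ h) with p , q ← hex-frontier h = cong (_++ _) p , cong (_++ _) q
hex-frontier (hex-Q₂ {A = A} {B} h) with p , q ← hex-frontier h = cong f p , cong f q
  where f = λ w → frontier A ++ w ++ frontier B
hex-frontier (hex-Q₃ {A = A} {B} h) with p , q ← hex-frontier h = cong f p , cong f q
  where f = λ w → frontier A ++ frontier B ++ w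

module _ {T : Tree} where

  -- The two triangles rest on sides of different colours, so the apexes over their common edge
  -- differ without any condition on bits.
  link-LR : Link (L (R T)) (R (L T)) []
  link-LR .near x = x
  link-LR .far (Lᵇ (Rᵇ x)) = Rᵇ (Lᵇ x)
  link-LR .adjacent (Lᵇ (Rᵇ x)) = inj₂ rot
  link-LR .free (inᴸ (inᴿ k)) (Lᵇ (Rᵇ x)) _ = refl , refl , inᴿ (inᴸ k) , refl

  link-RL : Link (R (L T)) (L (R T)) []
  link-RL .near x = x
  link-RL .far (Rᵇ (Lᵇ x)) = Lᵇ (Rᵇ x)
  link-RL .adjacent (Rᵇ (Lᵇ x)) = inj₁ rot
  link-RL .free (inᴿ (inᴸ k)) (Rᵇ (Lᵇ x)) _ = refl , refl , inᴸ (inᴿ k) , refl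

module _ {A B C : Tree} where

  -- The triangle has a fixed apex over the flipped edge, and the quadrilateral must offer the
  -- opposite colour there. This dictates its diagonal, here and in the next seven links.
  link-LQ : Link (L (Q A B C)) (Q (L A) B C) [ inᴸ root ]
  link-LQ .near (Lᵇ (Qᵇ _ a b c)) = Lᵇ (Qᵇ true a b c)
  link-LQ .far (Lᵇ (Qᵇ _ a b c)) = Qᵇ true (Lᵇ a) b c
  link-LQ .adjacent (Lᵇ (Qᵇ _ a b c)) = inj₂ rot
  link-LQ .free (inᴸ root) _ k∉ = contradiction (here refl) k∉
  link-LQ .free (inᴸ (in₁ k)) (Lᵇ (Qᵇ _ a b c)) _ = refl , refl , in₁ (inᴸ k) , refl
  link-LQ .free (inᴸ (in₂ k)) (Lᵇ (Qᵇ _ a b c)) _ = refl , refl , in₂ k , refl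
  link-LQ .free (inᴸ (in₃ k)) (Lᵇ (Qᵇ _ a b c)) _ = refl , refl , in₃ k , refl

  link-QL : Link (Q (L A) B C) (L (Q A B C)) [ root ]
  link-QL .near (Qᵇ _ a b c) = Qᵇ true a b c
  link-QL .far (Qᵇ _ (Lᵇ a) b c) = Lᵇ (Qᵇ true a b c)
  link-QL .adjacent (Qᵇ _ (Lᵇ a) b c) = inj₁ rot
  link-QL .free root _ k∉ = contradiction (here refl) k∉
  link-QL .free (in₁ (inᴸ k)) (Qᵇ _ (Lᵇ a) b c) _ = refl , refl , inᴸ (in₁ k) , refl
  link-QL .free (in₂ k) (Qᵇ _ (Lᵇ a) b c) _ = refl , refl , inᴸ (in₂ k) , refl
  link-QL .free (in₃ k) (Qᵇ _ (Lᵇ a) b c) _ = refl , refl , inᴸ (in₃ k) , refl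

  link-Q₁₂ : Link (Q (R A) B C) (Q A (L B) C) [ root ]
  link-Q₁₂ .near (Qᵇ _ a b c) = Qᵇ false a b c
  link-Q₁₂ .far (Qᵇ _ (Rᵇ a) b c) = Qᵇ false a (Lᵇ b) c
  link-Q₁₂ .adjacent (Qᵇ _ (Rᵇ a) b c) = inj₁ (rotˡ rot)
  link-Q₁₂ .free root _ k∉ = contradiction (here refl) k∉
  link-Q₁₂ .free (in₁ (inᴿ k)) (Qᵇ _ (Rᵇ a) b c) _ = refl , refl , in₁ k , refl
  link-Q₁₂ .free (in₂ k) (Qᵇ _ (Rᵇ a) b c) _ = refl , refl , in₂ (inᴸ k) , refl
  link-Q₁₂ .free (in₃ k) (Qᵇ _ (Rᵇ a) b c) _ = refl , refl , in₃ k , refl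

  link-Q₂₁ : Link (Q A (L B) C) (Q (R A) B C) [ root ]
  link-Q₂₁ .near (Qᵇ _ a b c) = Qᵇ false a b c
  link-Q₂₁ .far (Qᵇ _ a (Lᵇ b) c) = Qᵇ false (Rᵇ a) b c
  link-Q₂₁ .adjacent (Qᵇ _ a (Lᵇ b) c) = inj₂ (rotˡ rot)
  link-Q₂₁ .free root _ k∉ = contradiction (here refl) k∉
  link-Q₂₁ .free (in₁ k) (Qᵇ _ a (Lᵇ b) c) _ = refl , refl , in₁ (inᴿ k) , refl
  link-Q₂₁ .free (in₂ (inᴸ k)) (Qᵇ _ a (Lᵇ b) c) _ = refl , refl , in₂ k , refl
  link-Q₂₁ .free (in₃ k) (Qᵇ _ a (Lᵇ b) c) _ = refl , refl , in₃ k , refl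

  link-Q₂₃ : Link (Q A (R B) C) (Q A B (L C)) [ root ]
  link-Q₂₃ .near (Qᵇ _ a b c) = Qᵇ true a b c
  link-Q₂₃ .far (Qᵇ _ a (Rᵇ b) c) = Qᵇ true a b (Lᵇ c)
  link-Q₂₃ .adjacent (Qᵇ _ a (Rᵇ b) c) = inj₁ (rotʳ rot)
  link-Q₂₃ .free root _ k∉ = contradiction (here refl) k∉
  link-Q₂₃ .free (in₁ k) (Qᵇ _ a (Rᵇ b) c) _ = refl , refl , in₁ k , refl
  link-Q₂₃ .free (in₂ (inᴿ k)) (Qᵇ _ a (Rᵇ b) c) _ = refl , refl , in₂ k , refl
  link-Q₂₃ .free (in₃ k) (Qᵇ _ a (Rᵇ b) c) _ = refl , refl , in₃ (inᴸ k) , refl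

  link-Q₃₂ : Link (Q A B (L C)) (Q A (R B) C) [ root ]
  link-Q₃₂ .near (Qᵇ _ a b c) = Qᵇ true a b c
  link-Q₃₂ .far (Qᵇ _ a b (Lᵇ c)) = Qᵇ true a (Rᵇ b) c
  link-Q₃₂ .adjacent (Qᵇ _ a b (Lᵇ c)) = inj₂ (rotʳ rot)
  link-Q₃₂ .free root _ k∉ = contradiction (here refl) k∉
  link-Q₃₂ .free (in₁ k) (Qᵇ _ a b (Lᵇ c)) _ = refl , refl , in₁ k , refl
  link-Q₃₂ .free (in₂ k) (Qᵇ _ a b (Lᵇ c)) _ = refl , refl , in₂ (inᴿ k) , refl
  link-Q₃₂ .free (in₃ (inᴸ k)) (Qᵇ _ a b (Lᵇ c)) _ = refl , refl , in₃ k , refl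

  link-QR : Link (Q A B (R C)) (R (Q A B C)) [ root ]
  link-QR .near (Qᵇ _ a b c) = Qᵇ false a b c
  link-QR .far (Qᵇ _ a b (Rᵇ c)) = Rᵇ (Qᵇ false a b c)
  link-QR .adjacent (Qᵇ _ a b (Rᵇ c)) = inj₂ rot
  link-QR .free root _ k∉ = contradiction (here refl) k∉
  link-QR .free (in₁ k) (Qᵇ _ a b (Rᵇ c)) _ = refl , refl , inᴿ (in₁ k) , refl
  link-QR .free (in₂ k) (Qᵇ _ a b (Rᵇ c)) _ = refl , refl , inᴿ (in₂ k) , refl
  link-QR .free (in₃ (inᴿ k)) (Qᵇ _ a b (Rᵇ c)) _ = refl , refl , inᴿ (in₃ k) , refl

  link-RQ : Link (R (Q A B C)) (Q A B (R C)) [ inᴿ root ]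
  link-RQ .near (Rᵇ (Qᵇ _ a b c)) = Rᵇ (Qᵇ false a b c)
  link-RQ .far (Rᵇ (Qᵇ _ a b c)) = Qᵇ false a b (Rᵇ c)
  link-RQ .adjacent (Rᵇ (Qᵇ _ a b c)) = inj₁ rot
  link-RQ .free (inᴿ root) _ k∉ = contradiction (here refl) k∉
  link-RQ .free (inᴿ (in₁ k)) (Rᵇ (Qᵇ _ a b c)) _ = refl , refl , in₁ k , refl
  link-RQ .free (inᴿ (in₂ k)) (Rᵇ (Qᵇ _ a b c)) _ = refl , refl , in₂ k , refl
  link-RQ .free (inᴿ (in₃ k)) (Rᵇ (Qᵇ _ a b c)) _ = refl , refl , in₃ (inᴿ k) , refl

module _ {A B C D E : Tree} where

  private
    X = Q (Q A B C) D E
    Y = Q A (Q B C D) E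
    Z = Q A B (Q C D E)

  -- Of the four settings of the two bits, the two in which the apexes over the common edge differ
  -- in colour lead to the two other dissections; the links below list all six passages.
  link-XY : Link X Y (root ∷ in₁ root ∷ [])
  link-XY .near (Qᵇ _ (Qᵇ _ a b c) d e) = Qᵇ false (Qᵇ true a b c) d e
  link-XY .far (Qᵇ _ (Qᵇ _ a b c) d e) = Qᵇ false a (Qᵇ false b c d) e
  link-XY .adjacent (Qᵇ _ (Qᵇ _ a b c) d e) = inj₁ (rotˡ rot)
  link-XY .free root _ k∉ = contradiction (here refl) k∉
  link-XY .free (in₁ root) _ k∉ = contradiction (there (here refl)) k∉
  link-XY .free (in₁ (in₁ k)) (Qᵇ _ (Qᵇ _ a b c) d e) _ = refl , refl , in₁ k , refl
  link-XY .free (in₁ (in₂ k)) (Qᵇ _ (Qᵇ _ a b c) d e) _ = refl , refl , in₂ (in₁ k) , refl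
  link-XY .free (in₁ (in₃ k)) (Qᵇ _ (Qᵇ _ a b c) d e) _ = refl , refl , in₂ (in₂ k) , refl
  link-XY .free (in₂ k) (Qᵇ _ (Qᵇ _ a b c) d e) _ = refl , refl , in₂ (in₃ k) , refl
  link-XY .free (in₃ k) (Qᵇ _ (Qᵇ _ a b c) d e) _ = refl , refl , in₃ k , refl

  link-XZ : Link X Z (root ∷ in₁ root ∷ [])
  link-XZ .near (Qᵇ _ (Qᵇ _ a b c) d e) = Qᵇ true (Qᵇ false a b c) d e
  link-XZ .far (Qᵇ _ (Qᵇ _ a b c) d e) = Qᵇ false a b (Qᵇ true c d e)
  link-XZ .adjacent (Qᵇ _ (Qᵇ _ a b c) d e) = inj₁ rot
  link-XZ .free root _ k∉ = contradiction (here refl) k∉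
  link-XZ .free (in₁ root) _ k∉ = contradiction (there (here refl)) k∉
  link-XZ .free (in₁ (in₁ k)) (Qᵇ _ (Qᵇ _ a b c) d e) _ = refl , refl , in₁ k , refl
  link-XZ .free (in₁ (in₂ k)) (Qᵇ _ (Qᵇ _ a b c) d e) _ = refl , refl , in₂ k , refl
  link-XZ .free (in₁ (in₃ k)) (Qᵇ _ (Qᵇ _ a b c) d e) _ = refl , refl , in₃ (in₁ k) , refl
  link-XZ .free (in₂ k) (Qᵇ _ (Qᵇ _ a b c) d e) _ = refl , refl , in₃ (in₂ k) , refl
  link-XZ .free (in₃ k) (Qᵇ _ (Qᵇ _ a b c) d e) _ = refl , refl , in₃ (in₃ k) , refl

  link-YX : Link Y X (root ∷ in₂ root ∷ [])
  link-YX .near (Qᵇ _ a (Qᵇ _ b c d) e) = Qᵇ false a (Qᵇ false b c d) e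
  link-YX .far (Qᵇ _ a (Qᵇ _ b c d) e) = Qᵇ false (Qᵇ true a b c) d e
  link-YX .adjacent (Qᵇ _ a (Qᵇ _ b c d) e) = inj₂ (rotˡ rot)
  link-YX .free root _ k∉ = contradiction (here refl) k∉
  link-YX .free (in₁ k) (Qᵇ _ a (Qᵇ _ b c d) e) _ = refl , refl , in₁ (in₁ k) , refl
  link-YX .free (in₂ root) _ k∉ = contradiction (there (here refl)) k∉
  link-YX .free (in₂ (in₁ k)) (Qᵇ _ a (Qᵇ _ b c d) e) _ = refl , refl , in₁ (in₂ k) , refl
  link-YX .free (in₂ (in₂ k)) (Qᵇ _ a (Qᵇ _ b c d) e) _ = refl , refl , in₁ (in₃ k) , refl
  link-YX .free (in₂ (in₃ k)) (Qᵇ _ a (Qᵇ _ b c d) e) _ = refl , refl , in₂ k , refl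
  link-YX .free (in₃ k) (Qᵇ _ a (Qᵇ _ b c d) e) _ = refl , refl , in₃ k , refl

  link-YZ : Link Y Z (root ∷ in₂ root ∷ [])
  link-YZ .near (Qᵇ _ a (Qᵇ _ b c d) e) = Qᵇ true a (Qᵇ true b c d) e
  link-YZ .far (Qᵇ _ a (Qᵇ _ b c d) e) = Qᵇ true a b (Qᵇ false c d e)
  link-YZ .adjacent (Qᵇ _ a (Qᵇ _ b c d) e) = inj₁ (rotʳ rot)
  link-YZ .free root _ k∉ = contradiction (here refl) k∉
  link-YZ .free (in₁ k) (Qᵇ _ a (Qᵇ _ b c d) e) _ = refl , refl , in₁ k , refl
  link-YZ .free (in₂ root) _ k∉ = contradiction (there (here refl)) k∉
  link-YZ .free (in₂ (in₁ k)) (Qᵇ _ a (Qᵇ _ b c d) e) _ = refl , refl , in₂ k , refl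
  link-YZ .free (in₂ (in₂ k)) (Qᵇ _ a (Qᵇ _ b c d) e) _ = refl , refl , in₃ (in₁ k) , refl
  link-YZ .free (in₂ (in₃ k)) (Qᵇ _ a (Qᵇ _ b c d) e) _ = refl , refl , in₃ (in₂ k) , refl
  link-YZ .free (in₃ k) (Qᵇ _ a (Qᵇ _ b c d) e) _ = refl , refl , in₃ (in₃ k) , refl

  link-ZX : Link Z X (root ∷ in₃ root ∷ [])
  link-ZX .near (Qᵇ _ a b (Qᵇ _ c d e)) = Qᵇ false a b (Qᵇ true c d e)
  link-ZX .far (Qᵇ _ a b (Qᵇ _ c d e)) = Qᵇ true (Qᵇ false a b c) d e
  link-ZX .adjacent (Qᵇ _ a b (Qᵇ _ c d e)) = inj₂ rot
  link-ZX .free root _ k∉ = contradiction (here refl) k∉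
  link-ZX .free (in₁ k) (Qᵇ _ a b (Qᵇ _ c d e)) _ = refl , refl , in₁ (in₁ k) , refl
  link-ZX .free (in₂ k) (Qᵇ _ a b (Qᵇ _ c d e)) _ = refl , refl , in₁ (in₂ k) , refl
  link-ZX .free (in₃ root) _ k∉ = contradiction (there (here refl)) k∉
  link-ZX .free (in₃ (in₁ k)) (Qᵇ _ a b (Qᵇ _ c d e)) _ = refl , refl , in₁ (in₃ k) , refl
  link-ZX .free (in₃ (in₂ k)) (Qᵇ _ a b (Qᵇ _ c d e)) _ = refl , refl , in₂ k , refl
  link-ZX .free (in₃ (in₃ k)) (Qᵇ _ a b (Qᵇ _ c d e)) _ = refl , refl , in₃ k , refl

  link-ZY : Link Z Y (root ∷ in₃ root ∷ [])
  link-ZY .near (Qᵇ _ a b (Qᵇ _ c d e)) = Qᵇ true a b (Qᵇ false c d e)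
  link-ZY .far (Qᵇ _ a b (Qᵇ _ c d e)) = Qᵇ true a (Qᵇ true b c d) e
  link-ZY .adjacent (Qᵇ _ a b (Qᵇ _ c d e)) = inj₂ (rotʳ rot)
  link-ZY .free root _ k∉ = contradiction (here refl) k∉
  link-ZY .free (in₁ k) (Qᵇ _ a b (Qᵇ _ c d e)) _ = refl , refl , in₁ k , refl
  link-ZY .free (in₂ k) (Qᵇ _ a b (Qᵇ _ c d e)) _ = refl , refl , in₂ (in₁ k) , refl
  link-ZY .free (in₃ root) _ k∉ = contradiction (there (here refl)) k∉
  link-ZY .free (in₃ (in₁ k)) (Qᵇ _ a b (Qᵇ _ c d e)) _ = refl , refl , in₂ (in₂ k) , refl
  link-ZY .free (in₃ (in₂ k)) (Qᵇ _ a b (Qᵇ _ c d e)) _ = refl , refl , in₂ (in₃ k) , refl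
  link-ZY .free (in₃ (in₃ k)) (Qᵇ _ a b (Qᵇ _ c d e)) _ = refl , refl , in₃ k , refl

Link₁ : Tree → Tree → Set
Link₁ S S' = ∃ λ K → length K ≤ 1 × Link S S' K

-- The two links may prescribe different values, but at the same positions `K`; hence both together
-- block only two directions.
Links₂ : Tree → Tree → Tree → Set
Links₂ S T U = ∃ λ K → length K ≤ 2 × Link S T K × Link S U K

map-bound : ∀ {A B : Set} (f : A → B) {n} (xs : List A) → length xs ≤ n → length (map f xs) ≤ n
map-bound f xs = ≤-trans (≤-reflexive (length-map f xs))

lift₁ : ∀ {F : Tree → Tree} {ι : ∀ {T} → Pos T → Pos (F T)} →
  (∀ {S S' K} → Link S S' K → Link (F S) (F S') (map ι K)) →
  ∀ {S S'} → Link₁ S S' → Link₁ (F S) (F S')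
lift₁ f (K , K≤ , e) = _ , map-bound _ K K≤ , f e

lift₂ : ∀ {F : Tree → Tree} {ι : ∀ {T} → Pos T → Pos (F T)} →
  (∀ {S S' K} → Link S S' K → Link (F S) (F S') (map ι K)) →
  ∀ {S T U} → Links₂ S T U → Links₂ (F S) (F T) (F U)
lift₂ f (K , K≤ , e , e') = _ , map-bound _ K K≤ , f e , f e'

swap-links : ∀ {S S'} → Swap S S' → Link₁ S S' × Link₁ S' S
swap-links LR = (_ , z≤n , link-LR) , (_ , z≤n , link-RL)
swap-links LQ = (_ , s≤s z≤n , link-LQ) , (_ , s≤s z≤n , link-QL)
swap-links Q₁₂ = (_ , s≤s z≤n , link-Q₁₂) , (_ , s≤s z≤n , link-Q₂₁)
swap-links Q₂₃ = (_ , s≤s z≤n , link-Q₂₃) , (_ , s≤s z≤n , link-Q₃₂)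
swap-links QR = (_ , s≤s z≤n , link-QR) , (_ , s≤s z≤n , link-RQ)
swap-links (swap-sym s) with e , e' ← swap-links s = e' , e
swap-links (swap-L s) with e , e' ← swap-links s = lift₁ link-L e , lift₁ link-L e'
swap-links (swap-R s) with e , e' ← swap-links s = lift₁ link-R e , lift₁ link-R e'
swap-links (swap-Q₁ s) with e , e' ← swap-links s =
  lift₁ {λ T → Q T _ _} {in₁} (λ l → link-Q₁ l) e , lift₁ {λ T → Q T _ _} {in₁} (λ l → link-Q₁ l) e'
swap-links (swap-Q₂ s) with e , e' ← swap-links s =
  lift₁ {λ T → Q _ T _} {in₂} (λ l → link-Q₂ l) e , lift₁ {λ T → Q _ T _} {in₂} (λ l → link-Q₂ l) e'
swap-links (swap-Q₃ s) with e , e' ← swap-links s =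
  lift₁ {λ T → Q _ _ T} {in₃} (λ l → link-Q₃ l) e , lift₁ {λ T → Q _ _ T} {in₃} (λ l → link-Q₃ l) e'

HexLinks : Tree → Tree → Tree → Set
HexLinks S T U = Links₂ S T U × Links₂ T U S × Links₂ U S T

lift-hex : ∀ {F : Tree → Tree} {ι : ∀ {T} → Pos T → Pos (F T)} →
  (∀ {S S' K} → Link S S' K → Link (F S) (F S') (map ι K)) →
  ∀ {S T U} → HexLinks S T U → HexLinks (F S) (F T) (F U)
lift-hex f (l , l' , l'') = lift₂ f l , lift₂ f l' , lift₂ f l''

-- All three starting points are treated at once, because `hex-rotate` and `hex-mirror` permute
-- them.
hex-links : ∀ {S T U} → Hex S T U → HexLinks S T U
hex-links hexagon =
  (_ , s≤s (s≤s z≤n) , link-XY , link-XZ) ,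
  (_ , s≤s (s≤s z≤n) , link-YZ , link-YX) ,
  (_ , s≤s (s≤s z≤n) , link-ZX , link-ZY)
hex-links (hex-rotate h) with s , t , u ← hex-links h = t , u , s
hex-links (hex-mirror h)
  with (_ , s≤ , st , su) , (_ , t≤ , tu , ts) , (_ , u≤ , us , ut) ← hex-links h =
  (_ , s≤ , su , st) , (_ , u≤ , ut , us) , (_ , t≤ , ts , tu)
hex-links (hex-L h) = lift-hex link-L (hex-links h)
hex-links (hex-R h) = lift-hex link-R (hex-links h)
hex-links (hex-Q₁ h) = lift-hex {λ T → Q T _ _} {in₁} (λ l → link-Q₁ l) (hex-links h)
hex-links (hex-Q₂ h) = lift-hex {λ T → Q _ T _} {in₂} (λ l → link-Q₂ l) (hex-links h)
hex-links (hex-Q₃ h) = lift-hex {λ T → Q _ _ T} {in₃} (λ l → link-Q₃ l) (hex-links h)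

open Link

-- Spanning trees of dissections, and the tours along them

-- The branchings that block at most two directions: two swaps block at most one each, and the two
-- partners in one hexagon share theirs. A swap together with a hexagon might block three.
data Skeleton : Tree → Set where
  tip   : ∀ {S} → Skeleton S
  swap₁ : ∀ {S T} → Swap S T → Skeleton T → Skeleton S
  swap₂ : ∀ {S T U} → Swap S T → Swap S U → Skeleton T → Skeleton U → Skeleton S
  hex₁  : ∀ {S T U} → Hex S T U → Skeleton T → Skeleton S
  hex₂  : ∀ {S T U} → Hex S T U → Skeleton T → Skeleton U → Skeleton S

nodes : ∀ {S} → Skeleton S → List Tree
nodes {S} tip               = [ S ]
nodes {S} (swap₁ _ t)       = S ∷ nodes t
nodes {S} (swap₂ _ _ t t')  = S ∷ nodes t ++ nodes t'
nodes {S} (hex₁ _ t)        = S ∷ nodes t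
nodes {S} (hex₂ _ t t')     = S ∷ nodes t ++ nodes t'

nodes-frontier : ∀ {S T} (t : Skeleton S) → T ∈ nodes t → frontier T ≡ frontier S
nodes-frontier tip            (here refl) = refl
nodes-frontier (swap₁ _ _)    (here refl) = refl
nodes-frontier (swap₁ s t)    (there T∈)  = trans (nodes-frontier t T∈) (sym (swap-frontier s))
nodes-frontier (swap₂ _ _ _ _) (here refl) = refl
nodes-frontier (swap₂ s s' t t') (there T∈) with ∈-++⁻ (nodes t) T∈
... | inj₁ T∈t  = trans (nodes-frontier t T∈t) (sym (swap-frontier s))
... | inj₂ T∈t' = trans (nodes-frontier t' T∈t') (sym (swap-frontier s'))
nodes-frontier (hex₁ _ _)   (here refl) = refl
nodes-frontier (hex₁ h t)   (there T∈)  = trans (nodes-frontier t T∈) (sym (proj₁ (hex-frontier h)))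
nodes-frontier (hex₂ _ _ _) (here refl) = refl
nodes-frontier (hex₂ h t t') (there T∈) with ∈-++⁻ (nodes t) T∈ | hex-frontier h
... | inj₁ T∈t  | p , q = trans (nodes-frontier t T∈t) (sym p)
... | inj₂ T∈t' | p , q = trans (nodes-frontier t' T∈t') (sym (trans p q))

-- `distinct` is an implication, so tours can be built along any skeleton and the distinctness of
-- its nodes enters only at the end.
record Covers (vs : List State) (Ts : List Tree) : Set where
  field
    distinct : Unique Ts → Unique vs
    sound    : ∀ {v} → v ∈ vs → proj₁ v ∈ Ts
    complete : ∀ {v} → proj₁ v ∈ Ts → v ∈ vs

open Covers

Covers-++ : ∀ {vs ws us Ts Us} → us ↭ vs ++ ws → Covers vs Ts → Covers ws Us → Covers us (Ts ++ Us)
Covers-++ {vs} {Ts = Ts} p c d .distinct u with uˡ , uʳ , dis ← Unique-++⁻ Ts u =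
  Unique-resp-↭ (↭-sym p)
    (Unique.++⁺ (distinct c uˡ) (distinct d uʳ) λ (v∈ , v∈') → dis (sound c v∈) (sound d v∈'))
Covers-++ {vs} {Ts = Ts} p c d .sound v∈ with ∈-++⁻ vs (∈-resp-↭ p v∈)
... | inj₁ v∈ˡ = ∈-++⁺ˡ (sound c v∈ˡ)
... | inj₂ v∈ʳ = ∈-++⁺ʳ Ts (sound d v∈ʳ)
Covers-++ {vs} {Ts = Ts} p c d .complete v∈ with ∈-++⁻ Ts v∈
... | inj₁ v∈ˡ = ∈-resp-↭ (↭-sym p) (∈-++⁺ˡ (complete c v∈ˡ))
... | inj₂ v∈ʳ = ∈-resp-↭ (↭-sym p) (∈-++⁺ʳ vs (complete d v∈ʳ))

-- If the head `k` occurs in `js`, filtering it out shortens `js`. The position found in the tail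
-- differs from `k`, so if it were in `js` it would have survived the filter.
fresh : ∀ {T} (ks js : List (Pos T)) → Unique ks → length js < length ks → ∃ λ k → k ∈ ks × k ∉ js
fresh (k ∷ ks) js (k# ∷ ks!) lt with any? (k ≟ᵖ_) js
... | no k∉ = k , here refl , k∉
... | yes k∈ = j , there j∈ , λ j∈js → j∉ (∈-filter⁺ k≢? j∈js (All.lookup k# j∈))
  where
  k≢? = λ j → ¬? (k ≟ᵖ j)
  shorter : length (filter k≢? js) < length ks
  shorter = <-≤-trans (filter-notAll k≢? js (Any.map (λ k≡j k≢j → k≢j k≡j) k∈)) (s≤s⁻¹ lt)
  rec = fresh ks (filter k≢? js) ks! shorter
  j  = proj₁ rec
  j∈ = proj₁ (proj₂ rec)
  j∉ = proj₂ (proj₂ rec)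

-- The direction `k` is arbitrary because the parent cannot choose it: a flip of a free bit becomes
-- the flip of some bit on the far side of the link.
Tour : Tree → List Tree → Set
Tour S Ts = ∀ k x → ∃ λ vs → Path (S , x) (S , flip k x) vs × Covers vs Ts

-- The slowest bit of the Gray code is k, so its ends differ at k; the fastest is j, so it
-- uses all edges in direction j.
cube-path : ∀ {S} {j k : Pos S} → j ≢ k → ∀ x →
  ∃ λ vs → Path (S , x) (S , flip k x) vs × Covers vs [ S ] ×
    (∀ y → Joined vs (S , y) (S , flip j y))
cube-path {S} {j} {k} j≢k x =
  _ , gray-path (ps ++ [ j ]) x , covers , λ y → gray-joined ps j x y (all y)
  where
  other? = λ i → ¬? (any? (i ≟ᵖ_) (j ∷ k ∷ []))
  ps     = k ∷ filter other? (positions S)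
  all-ps : ∀ i → i ∈ ps ++ [ j ]
  all-ps i with any? (i ≟ᵖ_) (j ∷ k ∷ [])
  ... | yes (here refl)         = ∈-++⁺ʳ ps (here refl)
  ... | yes (there (here refl)) = here refl
  ... | no i∉ = there (∈-++⁺ˡ (∈-filter⁺ other? (∈-positions i) i∉))
  all : ∀ y → y ∈ gray (ps ++ [ j ]) x
  all y = gray-complete (ps ++ [ j ]) x y λ i i∉ → contradiction (all-ps i) i∉
  ps-unique : Unique (ps ++ [ j ])
  ps-unique = Unique.++⁺
    (All.tabulate (λ i∈ e → proj₂ (∈-filter⁻ other? {xs = positions S} i∈) (there (here (sym e))))
      ∷ Unique.filter⁺ other? (positions-unique S))
    ([] ∷ [])
    λ { (here refl , here refl) → j≢k refl
      ; (there i∈ , here refl) → proj₂ (∈-filter⁻ other? {xs = positions S} i∈) (here refl) }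
  covers : Covers (map (S ,_) (gray (ps ++ [ j ]) x)) [ S ]
  covers .distinct _ = Unique.map⁺ (λ { refl → refl }) (gray-unique (ps ++ [ j ]) x ps-unique)
  covers .sound v∈ with _ , _ , refl ← ∈-map⁻ (S ,_) v∈ = here refl
  covers .complete {_ , y} (here refl) = ∈-map⁺ (S ,_) (all y)

-- Since `k` is free, the link is available at both ends of the edge in direction `k`, and its two
-- far ends differ in one bit. A tour of the subtree between these far ends replaces the edge.
attach : ∀ {S S' K Ts a b vs} (e : Link S S' K) (k : Pos S) x → k ∉ K → Tour S' Ts →
  Path a b vs → Joined vs (S , near e x) (S , flip k (near e x)) →
  ∃₂ λ vs' ws → Path a b vs' × Covers ws Ts × vs' ↭ vs ++ ws ×
    (∀ {u v} → Consecutive u v vs → u ≢ (S , near e x) → u ≢ (S , flip k (near e x)) →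
      Consecutive u v vs')
attach {S} {S'} e k x k∉ tour p (inj₁ c)
  with n , _ , k' , f ← free e k x k∉
  with ws , q , cov ← tour k' (far e x)
  with vs' , p' , perm , keep ← detour p c (adjacent e x) q
         (subst₂ (λ y z → (S' , y) ∼ (S , z)) f n (Rot±-sym (adjacent e (flip k x))))
  = vs' , ws , p' , cov , perm , λ d u≢ _ → keep d (inj₁ u≢)
attach {S} {S'} {vs = vs} e k x k∉ tour p (inj₂ c)
  with n , _ , k' , f ← free e k x k∉
  -- The edge is used backwards; starting from `flip k x` exchanges its ends.
  with vs' , ws , p' , cov , perm , keep ← attach e k (flip k x) k∉ tour p
         (inj₁ (subst₂ (λ y z → Consecutive (S , y) (S , z) vs) (sym n)
                 (sym (trans (cong (flip k) n) (flip-involutive k _))) c))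
  = vs' , ws , p' , cov , perm ,
    λ d u≢ u≢' → keep d (λ e≡ → u≢' (trans e≡ (cong (S ,_) n)))
      (λ e≡ → u≢ (trans e≡ (cong (S ,_) (trans (cong (flip k) n) (flip-involutive k _)))))

-- Edges in direction j for two links are made distinct by means of a second free bit i.
edges-apart : ∀ {S S' S'' K} (e : Link S S' K) (e' : Link S S'' K) {i j} x → i ∉ (j ∷ K) →
  let y = near e x ; z = near e' (flip i x) in
  ∀ {u v : Bits S} → u ∈ (y ∷ flip j y ∷ []) → v ∈ (z ∷ flip j z ∷ []) → _≢_ {A = State} (S , v) (S , u)
edges-apart {S} e e' {i} {j} x i∉ u∈ v∈ refl = not-¬ refl (trans (sym (bit u∈)) (trans (bit v∈) flipped))
  where
  bit : ∀ {y u} → u ∈ (y ∷ flip j y ∷ []) → get i u ≡ get i y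
  bit (here refl)         = refl
  bit (there (here refl)) = get-flip-≢ i j _ (i∉ ∘ here)
  flipped : get i (near e' (flip i x)) ≡ not (get i (near e x))
  flipped with _ , g , _ ← free e i x (i∉ ∘ there) | _ , g' , _ ← free e' i (flip i x) (i∉ ∘ there) =
    trans g' (trans (get-flip i x) (cong not (sym g)))

module _ {S : Tree} (4≤ : 4 ≤ length (positions S)) where

  -- The bound three is the direction of entry together with two prescribed bits; avoiding them is
  -- what four quadrilaterals are for.
  pick : ∀ js → length js ≤ 3 → ∃ λ (k : Pos S) → k ∉ js
  pick js js≤ with k , _ , k∉ ← fresh (positions S) js (positions-unique S) (≤-trans (s≤s js≤) 4≤) = k , k∉

  tour₀ : Tour S [ S ]
  tour₀ k x with j , j∉ ← pick [ k ] (s≤s z≤n)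
    with vs , p , cov , _ ← cube-path (j∉ ∘ here) x = vs , p , cov

  tour₁ : ∀ {S' K Ts} → length K ≤ 2 → Link S S' K → Tour S' Ts → Tour S (S ∷ Ts)
  tour₁ K≤ e tour k x
    with j , j∉ ← pick (k ∷ _) (s≤s K≤)
    with vs , p , cov , joined ← cube-path (j∉ ∘ here) x
    with vs' , ws , p' , cov' , perm , _ ← attach e j x (j∉ ∘ there) tour p (joined _)
    = vs' , p' , Covers-++ perm cov cov'

  tour₂ : ∀ {S' S'' K Ts Us} → length K ≤ 2 → Link S S' K → Link S S'' K →
    Tour S' Ts → Tour S'' Us → Tour S (S ∷ Ts ++ Us)
  tour₂ {K = K} K≤ e e' tour tour' k x
    with j , j∉ ← pick (k ∷ K) (s≤s K≤)
    -- `i` may coincide with `k`: it only tells the two replaced edges apart.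
    with i , i∉ ← pick (j ∷ K) (s≤s K≤)
    with vs , p , cov , joined ← cube-path (j∉ ∘ here) x
    with vs' , ws , p' , cov' , perm , keep ← attach e j x (j∉ ∘ there) tour p (joined _)
    with apart ← edges-apart e e' x i∉
    with vs'' , ws' , p'' , cov'' , perm' , _ ← attach e' j (flip i x) (j∉ ∘ there) tour' p'
           (Sum.map
             (λ c → keep c (apart (here refl) (here refl)) (apart (there (here refl)) (here refl)))
             (λ c → keep c (apart (here refl) (there (here refl)))
                           (apart (there (here refl)) (there (here refl))))
             (joined _))
    = vs'' , p'' , Covers-++ perm' (Covers-++ perm cov cov') cov''

module _ {w : List Side} (4≤ : ∀ T → frontier T ≡ w → 4 ≤ length (positions T)) where

  skeleton-tour : ∀ {S} (t : Skeleton S) → frontier S ≡ w → Tour S (nodes t)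
  skeleton-tour {S} tip eq = tour₀ (4≤ S eq)
  skeleton-tour {S} (swap₁ s t) eq with (_ , K≤ , e) , _ ← swap-links s =
    tour₁ (4≤ S eq) (≤-trans K≤ (n≤1+n 1)) e (skeleton-tour t (trans (sym (swap-frontier s)) eq))
  skeleton-tour {S} (swap₂ s s' t t') eq
    with (K , K≤ , e) , _ ← swap-links s | (K' , K'≤ , e') , _ ← swap-links s' =
    tour₂ (4≤ S eq) (≤-trans (≤-reflexive (length-++ K)) (+-mono-≤ K≤ K'≤))
      (link-weaken ∈-++⁺ˡ e) (link-weaken (∈-++⁺ʳ K) e')
      (skeleton-tour t (trans (sym (swap-frontier s)) eq))
      (skeleton-tour t' (trans (sym (swap-frontier s')) eq))
  skeleton-tour {S} (hex₁ h t) eq with (_ , K≤ , e , _) , _ ← hex-links h | p , _ ← hex-frontier h =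
    tour₁ (4≤ S eq) K≤ e (skeleton-tour t (trans (sym p) eq))
  skeleton-tour {S} (hex₂ h t t') eq with (_ , K≤ , e , e') , _ ← hex-links h | p , q ← hex-frontier h =
    tour₂ (4≤ S eq) K≤ e e' (skeleton-tour t (trans (sym p) eq))
      (skeleton-tour t' (trans (sym (trans p q)) eq))

-- Spans, and their invariance under rotation of the polygon

record Span (w : List Side) : Set where
  field
    {top}        : Tree
    skeleton     : Skeleton top
    top-frontier : frontier top ≡ w
    unique       : Unique (nodes skeleton)
    spanning     : ∀ T → frontier T ≡ w → T ∈ nodes skeleton

module _ (f : Tree → Tree) (f-swap : ∀ {S T} → Swap S T → Swap (f S) (f T))
         (f-hex : ∀ {S T U} → Hex S T U → Hex (f S) (f T) (f U)) where

  map-skeleton : ∀ {S} → Skeleton S → Skeleton (f S)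
  map-skeleton tip              = tip
  map-skeleton (swap₁ s t)      = swap₁ (f-swap s) (map-skeleton t)
  map-skeleton (swap₂ s s' t u) = swap₂ (f-swap s) (f-swap s') (map-skeleton t) (map-skeleton u)
  map-skeleton (hex₁ h t)       = hex₁ (f-hex h) (map-skeleton t)
  map-skeleton (hex₂ h t u)     = hex₂ (f-hex h) (map-skeleton t) (map-skeleton u)

  nodes-map : ∀ {S} (t : Skeleton S) → nodes (map-skeleton t) ≡ map f (nodes t)
  nodes-map tip              = refl
  nodes-map (swap₁ s t)      = cong (_ ∷_) (nodes-map t)
  nodes-map (swap₂ s s' t u) = cong (_ ∷_) (trans (cong₂ _++_ (nodes-map t) (nodes-map u)) (sym (map-++ f (nodes t) _)))
  nodes-map (hex₁ h t)       = cong (_ ∷_) (nodes-map t)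
  nodes-map (hex₂ h t u)     = cong (_ ∷_) (trans (cong₂ _++_ (nodes-map t) (nodes-map u)) (sym (map-++ f (nodes t) _)))

sames : ℕ → List Side
sames k = replicate k same

diff∉sames : ∀ k p {q} → sames k ≢ p ++ diff ∷ q
diff∉sames zero    []      ()
diff∉sames (suc k) []      ()
diff∉sames (suc k) (same ∷ p) eq = diff∉sames k p (∷-injectiveʳ eq)

sames-inj : ∀ k k' → sames k ≡ sames k' → k ≡ k'
sames-inj k k' eq = trans (sym (length-replicate k)) (trans (cong length eq) (length-replicate k'))

last-run : ∀ p p' {k k'} → p ++ diff ∷ sames k ≡ p' ++ diff ∷ sames k' → p ≡ p' × k ≡ k'
last-run []      []       eq = refl , sames-inj _ _ (∷-injectiveʳ eq)
last-run []      (_ ∷ p') eq = contradiction (∷-injectiveʳ eq) (diff∉sames _ p')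
last-run (_ ∷ p) []       eq = contradiction (sym (∷-injectiveʳ eq)) (diff∉sames _ p)
last-run (_ ∷ p) (_ ∷ p') eq with refl , eq' ← ∷-injective eq
  with refl , refl ← last-run p p' eq' = refl , refl

first-run : ∀ k k' {p p'} → sames k ++ diff ∷ p ≡ sames k' ++ diff ∷ p' → p ≡ p' × k ≡ k'
first-run zero    zero     eq = ∷-injectiveʳ eq , refl
first-run (suc k) (suc k') eq with refl , refl ← first-run k k' (∷-injectiveʳ eq) = refl , refl

sames-snoc : ∀ k → sames k ++ [ same ] ≡ sames (suc k)
sames-snoc zero    = refl
sames-snoc (suc k) = cong (same ∷_) (sames-snoc k)

-- Moving the root to the neighbouring diff side turns the right spine of a
-- tree into a left spine, and back.

spinʳ spinˡ : Tree → Tree → Tree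
spinʳ •         acc = acc
spinʳ (L T)     acc = spinʳ T (R acc)
spinʳ (R T)     acc = spinʳ T (L acc)
spinʳ (Q A B C) acc = spinʳ C (Q acc A B)
spinˡ •         acc = acc
spinˡ (L T)     acc = spinˡ T (R acc)
spinˡ (R T)     acc = spinˡ T (L acc)
spinˡ (Q A B C) acc = spinˡ A (Q B C acc)

-- As for list reversal with an accumulator: both functions carry one cell at a time from one spine
-- to the other.
spinʳ-spinˡ : ∀ T acc → spinʳ (spinˡ T acc) • ≡ spinʳ acc T
spinʳ-spinˡ •         acc = refl
spinʳ-spinˡ (L T)     acc = spinʳ-spinˡ T (R acc)
spinʳ-spinˡ (R T)     acc = spinʳ-spinˡ T (L acc)
spinʳ-spinˡ (Q A B C) acc = spinʳ-spinˡ A (Q B C acc)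

spinˡ-spinʳ : ∀ T acc → spinˡ (spinʳ T acc) • ≡ spinˡ acc T
spinˡ-spinʳ •         acc = refl
spinˡ-spinʳ (L T)     acc = spinˡ-spinʳ T (R acc)
spinˡ-spinʳ (R T)     acc = spinˡ-spinʳ T (L acc)
spinˡ-spinʳ (Q A B C) acc = spinˡ-spinʳ C (Q acc A B)

-- The last `diff` side becomes the root. The `same` sides behind it come first, then `acc`, which
-- stands at the old root, then the rest in the old order.
spinʳ-frontier : ∀ T acc → ∃₂ λ p k →
  frontier T ≡ p ++ diff ∷ sames k × frontier (spinʳ T acc) ≡ sames k ++ frontier acc ++ p
spinʳ-frontier • acc = [] , 0 , refl , sym (++-identityʳ _)
spinʳ-frontier (L T) acc with p , k , eq , eq' ← spinʳ-frontier T (R acc) =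
  same ∷ p , k , cong (same ∷_) eq , trans eq' (cong (sames k ++_) (++-assoc (frontier acc) _ p))
spinʳ-frontier (R T) acc with p , k , eq , eq' ← spinʳ-frontier T (L acc) =
  p , suc k ,
  trans (cong (_++ [ same ]) eq) (trans (++-assoc p _ _) (cong (λ w → p ++ diff ∷ w) (sames-snoc k))) ,
  trans eq' (trans (sym (++-assoc (sames k) [ same ] _)) (cong (_++ _) (sames-snoc k)))
spinʳ-frontier (Q A B C) acc with p , k , eq , eq' ← spinʳ-frontier C (Q acc A B) =
  frontier A ++ frontier B ++ p , k ,
  trans (cong (λ w → a ++ b ++ w) eq)
    (sym (trans (++-assoc a _ _) (cong (a ++_) (++-assoc b p _)))) ,
  trans eq' (cong (sames k ++_)
    (trans (++-assoc (frontier acc) _ p) (cong (frontier acc ++_) (++-assoc a b p))))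
  where
  a = frontier A
  b = frontier B

spinʳ-swap-acc : ∀ T {acc acc'} → Swap acc acc' → Swap (spinʳ T acc) (spinʳ T acc')
spinʳ-swap-acc •         s = s
spinʳ-swap-acc (L T)     s = spinʳ-swap-acc T (swap-R s)
spinʳ-swap-acc (R T)     s = spinʳ-swap-acc T (swap-L s)
spinʳ-swap-acc (Q A B C) s = spinʳ-swap-acc C (swap-Q₁ s)

-- Flips do not depend on the root. The turn permutes the four corners of a quadrilateral that a
-- triangle may pass: `LQ`, `Q₁₂`, `Q₂₃`, `QR` and back to `LQ`.
spinʳ-swap : ∀ {T T'} acc → Swap T T' → Swap (spinʳ T acc) (spinʳ T' acc)
spinʳ-swap acc (LR {T})           = spinʳ-swap-acc T LR
spinʳ-swap acc (LQ {C = C})       = spinʳ-swap-acc C Q₁₂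
spinʳ-swap acc (Q₁₂ {C = C})      = spinʳ-swap-acc C Q₂₃
spinʳ-swap acc (Q₂₃ {C = C})      = spinʳ-swap-acc C QR
spinʳ-swap acc (QR {C = C})       = spinʳ-swap-acc C LQ
spinʳ-swap acc (swap-sym s)       = swap-sym (spinʳ-swap acc s)
spinʳ-swap acc (swap-L s)         = spinʳ-swap _ s
spinʳ-swap acc (swap-R s)         = spinʳ-swap _ s
spinʳ-swap acc (swap-Q₁ {B = B} s) = spinʳ-swap-acc B (swap-Q₂ s)
spinʳ-swap acc (swap-Q₂ {B = B} s) = spinʳ-swap-acc B (swap-Q₃ s)
spinʳ-swap acc (swap-Q₃ s)        = spinʳ-swap _ s

spinʳ-hex-acc : ∀ T {S S' S''} → Hex S S' S'' → Hex (spinʳ T S) (spinʳ T S') (spinʳ T S'')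
spinʳ-hex-acc •         h = h
spinʳ-hex-acc (L T)     h = spinʳ-hex-acc T (hex-R h)
spinʳ-hex-acc (R T)     h = spinʳ-hex-acc T (hex-L h)
spinʳ-hex-acc (Q A B C) h = spinʳ-hex-acc C (hex-Q₁ h)

spinʳ-hex : ∀ {S T U} acc → Hex S T U → Hex (spinʳ S acc) (spinʳ T acc) (spinʳ U acc)
spinʳ-hex acc (hexagon {E = E})   = spinʳ-hex-acc E (hex-rotate hexagon)
spinʳ-hex acc (hex-rotate h)      = hex-rotate (spinʳ-hex acc h)
spinʳ-hex acc (hex-mirror h)      = hex-mirror (spinʳ-hex acc h)
spinʳ-hex acc (hex-L h)           = spinʳ-hex _ h
spinʳ-hex acc (hex-R h)           = spinʳ-hex _ h
spinʳ-hex acc (hex-Q₁ {B = B} h)  = spinʳ-hex-acc B (hex-Q₂ h)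
spinʳ-hex acc (hex-Q₂ {B = B} h)  = spinʳ-hex-acc B (hex-Q₃ h)
spinʳ-hex acc (hex-Q₃ h)          = spinʳ-hex _ h

span-rotate : ∀ w k → Span (w ++ diff ∷ sames k) → Span (sames k ++ diff ∷ w)
span-rotate w k sp = record
  { skeleton     = map-skeleton spin (spinʳ-swap •) (spinʳ-hex •) skeleton
  ; top-frontier = spin-frontier top top-frontier
  ; unique       = subst Unique (sym eq) (Unique.map⁺ spin-inj unique)
  ; spanning     = λ T T-fr → subst (T ∈_) (sym eq)
      (subst (_∈ map spin (nodes skeleton)) (spinʳ-spinˡ T •)
        (∈-map⁺ spin (spanning (unspin T) (unspin-frontier T T-fr))))
  }
  where
  open Span sp
  spin unspin : Tree → Tree
  spin T   = spinʳ T •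
  unspin T = spinˡ T •
  eq = nodes-map spin (spinʳ-swap •) (spinʳ-hex •) skeleton
  spin-inj : ∀ {S T} → spin S ≡ spin T → S ≡ T
  spin-inj {S} {T} e = trans (sym (spinˡ-spinʳ S •)) (trans (cong unspin e) (spinˡ-spinʳ T •))
  spin-frontier : ∀ T → frontier T ≡ w ++ diff ∷ sames k → frontier (spin T) ≡ sames k ++ diff ∷ w
  spin-frontier T e with p , k' , e' , e'' ← spinʳ-frontier T •
    with refl , refl ← last-run w p (trans (sym e) e') = e''
  unspin-frontier : ∀ T → frontier T ≡ sames k ++ diff ∷ w → frontier (unspin T) ≡ w ++ diff ∷ sames k
  unspin-frontier T e with p , k' , e' , e'' ← spinʳ-frontier (unspin T) •
    with refl , refl ← first-run k k' (trans (sym e) (trans (cong frontier (sym (spinʳ-spinˡ T •))) e'')) = e'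

leave : ∀ {x : Tree} {xs ys zs} → x ∷ xs ↭ ys ++ x ∷ zs → xs ↭ ys ++ zs
leave {x} {ys = ys} {zs} p = drop-∷ (↭-trans p (shift x ys zs))

-- Lifting a span through a projection of dissections

-- Replacing every node v of a skeleton by a fibre, which is traversed
-- alternately from its bottom to its top and from its top to its bottom.  Flips of v lift
-- to flips at both ends, and the end where a traversal leaves the fibre has no children within
-- the fibre, so no node gets more than two children.
module Fibration
  {w w' : List Side} (bot top : Tree → Tree) (fibre : Tree → List Tree) (π : Tree → Tree)
  (bot-swap : ∀ {S T} → Swap S T → Swap (bot S) (bot T))
  (top-swap : ∀ {S T} → Swap S T → Swap (top S) (top T))
  (bot-hex : ∀ {S T U} → Hex S T U → Hex (bot S) (bot T) (bot U))
  (top-hex : ∀ {S T U} → Hex S T U → Hex (top S) (top T) (top U))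
  (up : ∀ v → frontier v ≡ w → Skeleton (top v) → Skeleton (bot v))
  (down : ∀ v → frontier v ≡ w → Skeleton (bot v) → Skeleton (top v))
  -- `top v` is the last node of the fibre and also the root of `t`, so the right side counts it
  -- twice.
  (up-nodes : ∀ v (e : frontier v ≡ w) t → top v ∷ nodes (up v e t) ↭ fibre v ++ nodes t)
  (down-nodes : ∀ v (e : frontier v ≡ w) t → bot v ∷ nodes (down v e t) ↭ fibre v ++ nodes t)
  (bot-frontier : ∀ v → frontier v ≡ w → frontier (bot v) ≡ w')
  (fibre-unique : ∀ v → frontier v ≡ w → Unique (fibre v))
  (fibre-π : ∀ v → frontier v ≡ w → ∀ {T} → T ∈ fibre v → π T ≡ v)
  (π-frontier : ∀ T → frontier T ≡ w' → frontier (π T) ≡ w)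
  (∈-fibre-π : ∀ T → frontier T ≡ w' → T ∈ fibre (π T))
  where

  concatMap-++ : ∀ xs ys → concatMap fibre (xs ++ ys) ≡ concatMap fibre xs ++ concatMap fibre ys
  concatMap-++ []       ys = refl
  concatMap-++ (x ∷ xs) ys = trans (cong (fibre x ++_) (concatMap-++ xs ys)) (sym (++-assoc (fibre x) _ _))

  lift-up   : ∀ {v} → frontier v ≡ w → Skeleton v → Skeleton (bot v)
  lift-down : ∀ {v} → frontier v ≡ w → Skeleton v → Skeleton (top v)
  lift-up e tip = up _ e tip
  lift-up e (swap₁ s t) = up _ e (swap₁ (top-swap s) (lift-down (trans (sym (swap-frontier s)) e) t))
  lift-up e (swap₂ s s' t u) = up _ e (swap₂ (top-swap s) (top-swap s')
    (lift-down (trans (sym (swap-frontier s)) e) t) (lift-down (trans (sym (swap-frontier s')) e) u))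
  lift-up e (hex₁ h t) = up _ e (hex₁ (top-hex h) (lift-down (trans (sym (proj₁ (hex-frontier h))) e) t))
  lift-up e (hex₂ h t u) = up _ e (hex₂ (top-hex h)
    (lift-down (trans (sym (proj₁ (hex-frontier h))) e) t)
    (lift-down (trans (sym (proj₁ (hex-frontier (hex-mirror h)))) e) u))
  lift-down e tip = down _ e tip
  lift-down e (swap₁ s t) = down _ e (swap₁ (bot-swap s) (lift-up (trans (sym (swap-frontier s)) e) t))
  lift-down e (swap₂ s s' t u) = down _ e (swap₂ (bot-swap s) (bot-swap s')
    (lift-up (trans (sym (swap-frontier s)) e) t) (lift-up (trans (sym (swap-frontier s')) e) u))
  lift-down e (hex₁ h t) = down _ e (hex₁ (bot-hex h) (lift-up (trans (sym (proj₁ (hex-frontier h))) e) t))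
  lift-down e (hex₂ h t u) = down _ e (hex₂ (bot-hex h)
    (lift-up (trans (sym (proj₁ (hex-frontier h))) e) t)
    (lift-up (trans (sym (proj₁ (hex-frontier (hex-mirror h)))) e) u))

  fork : ∀ {v xs ys zs} (ts us : List Tree) → zs ↭ fibre v ++ xs ++ ys →
    xs ↭ concatMap fibre ts → ys ↭ concatMap fibre us → zs ↭ concatMap fibre (v ∷ ts ++ us)
  fork {v} ts us p q r = ↭-trans p (++⁺ˡ (fibre v)
    (↭-trans (++⁺ q r) (↭-reflexive (sym (concatMap-++ ts us)))))

  lift-up-nodes : ∀ {v} (e : frontier v ≡ w) (t : Skeleton v) → nodes (lift-up e t) ↭ concatMap fibre (nodes t)
  lift-down-nodes : ∀ {v} (e : frontier v ≡ w) (t : Skeleton v) → nodes (lift-down e t) ↭ concatMap fibre (nodes t)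
  lift-up-nodes e tip = leave (up-nodes _ e tip)
  lift-up-nodes {v} e (swap₁ s t) = ↭-trans (leave (up-nodes _ e _)) (++⁺ˡ (fibre v) (lift-down-nodes _ t))
  lift-up-nodes e (swap₂ s s' t u) = fork (nodes t) (nodes u) (leave (up-nodes _ e _)) (lift-down-nodes _ t) (lift-down-nodes _ u)
  lift-up-nodes {v} e (hex₁ h t) = ↭-trans (leave (up-nodes _ e _)) (++⁺ˡ (fibre v) (lift-down-nodes _ t))
  lift-up-nodes e (hex₂ h t u) = fork (nodes t) (nodes u) (leave (up-nodes _ e _)) (lift-down-nodes _ t) (lift-down-nodes _ u)
  lift-down-nodes e tip = leave (down-nodes _ e tip)
  lift-down-nodes {v} e (swap₁ s t) = ↭-trans (leave (down-nodes _ e _)) (++⁺ˡ (fibre v) (lift-up-nodes _ t))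
  lift-down-nodes e (swap₂ s s' t u) = fork (nodes t) (nodes u) (leave (down-nodes _ e _)) (lift-up-nodes _ t) (lift-up-nodes _ u)
  lift-down-nodes {v} e (hex₁ h t) = ↭-trans (leave (down-nodes _ e _)) (++⁺ˡ (fibre v) (lift-up-nodes _ t))
  lift-down-nodes e (hex₂ h t u) = fork (nodes t) (nodes u) (leave (down-nodes _ e _)) (lift-up-nodes _ t) (lift-up-nodes _ u)

  ∈-fibres : ∀ {vs v T} → v ∈ vs → T ∈ fibre v → T ∈ concatMap fibre vs
  ∈-fibres (here refl) T∈ = ∈-++⁺ˡ T∈
  ∈-fibres {v ∷ _} (there v∈) T∈ = ∈-++⁺ʳ (fibre v) (∈-fibres v∈ T∈)

  fibres-π : ∀ vs → (∀ {v} → v ∈ vs → frontier v ≡ w) → ∀ {T} → T ∈ concatMap fibre vs → π T ∈ vs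
  fibres-π (v ∷ vs) fr T∈ with ∈-++⁻ (fibre v) T∈
  ... | inj₁ T∈v  = here (fibre-π v (fr (here refl)) T∈v)
  ... | inj₂ T∈vs = there (fibres-π vs (fr ∘ there) T∈vs)

  fibres-unique : ∀ vs → (∀ {v} → v ∈ vs → frontier v ≡ w) → Unique vs → Unique (concatMap fibre vs)
  fibres-unique []       fr _ = []
  fibres-unique (v ∷ vs) fr (v# ∷ vs!) =
    Unique.++⁺ (fibre-unique v (fr (here refl))) (fibres-unique vs (fr ∘ there) vs!)
      λ (T∈v , T∈vs) → All.lookup v# (fibres-π vs (fr ∘ there) T∈vs) (sym (fibre-π v (fr (here refl)) T∈v))

  span-fibration : Span w → Span w'
  span-fibration sp = record
    { skeleton     = lift-up top-frontier skeleton
    ; top-frontier = bot-frontier _ top-frontier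
    ; unique       = Unique-resp-↭ (↭-sym perm)
        (fibres-unique _ (λ v∈ → trans (nodes-frontier skeleton v∈) top-frontier) unique)
    ; spanning     = λ T e → ∈-resp-↭ (↭-sym perm) (∈-fibres (spanning _ (π-frontier T e)) (∈-fibre-π T e))
    }
    where
    open Span sp hiding (top)
    perm = lift-up-nodes top-frontier skeleton

-- Right spines, grafts and contexts

-- A cell on the right spine, which leads from the root to the last `diff` side; new vertices are
-- added near that end.
data Frame : Set where
  fL fR : Frame
  fQ    : Tree → Tree → Frame

⟨_⟩ : Frame → Tree → Tree
⟨ fL ⟩     T = L T
⟨ fR ⟩     T = R T
⟨ fQ A B ⟩ T = Q A B T

⟦_⟧ : List Frame → Tree → Tree
⟦ [] ⟧     T = T
⟦ f ∷ fs ⟧ T = ⟨ f ⟩ (⟦ fs ⟧ T)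

frame-swap : ∀ f {S T} → Swap S T → Swap (⟨ f ⟩ S) (⟨ f ⟩ T)
frame-swap fL       = swap-L
frame-swap fR       = swap-R
frame-swap (fQ A B) = swap-Q₃

frame-hex : ∀ f {S T U} → Hex S T U → Hex (⟨ f ⟩ S) (⟨ f ⟩ T) (⟨ f ⟩ U)
frame-hex fL       = hex-L
frame-hex fR       = hex-R
frame-hex (fQ A B) = hex-Q₃

frames-swap : ∀ fs {S T} → Swap S T → Swap (⟦ fs ⟧ S) (⟦ fs ⟧ T)
frames-swap []       s = s
frames-swap (f ∷ fs) s = frame-swap f (frames-swap fs s)

frames-hex : ∀ fs {S T U} → Hex S T U → Hex (⟦ fs ⟧ S) (⟦ fs ⟧ T) (⟦ fs ⟧ U)
frames-hex []       h = h
frames-hex (f ∷ fs) h = frame-hex f (frames-hex fs h)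

frame-injective : ∀ f {S T} → ⟨ f ⟩ S ≡ ⟨ f ⟩ T → S ≡ T
frame-injective fL       refl = refl
frame-injective fR       refl = refl
frame-injective (fQ A B) refl = refl

spine : Tree → List Frame
spine •         = []
spine (L T)     = fL ∷ spine T
spine (R T)     = fR ∷ spine T
spine (Q A B C) = fQ A B ∷ spine C

spine-• : ∀ T → ⟦ spine T ⟧ • ≡ T
spine-• •         = refl
spine-• (L T)     = cong L (spine-• T)
spine-• (R T)     = cong R (spine-• T)
spine-• (Q A B C) = cong (Q A B) (spine-• C)

graft : Tree → Tree → Tree
graft z T = ⟦ spine T ⟧ z

-- Every rule leaves its subtrees arbitrary, so it does not notice what hangs on the last `diff`
-- side.
graft-swap : ∀ {z S T} → Swap S T → Swap (graft z S) (graft z T)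
graft-swap LR           = LR
graft-swap LQ           = LQ
graft-swap Q₁₂          = Q₁₂
graft-swap Q₂₃          = Q₂₃
graft-swap QR           = QR
graft-swap (swap-sym s) = swap-sym (graft-swap s)
graft-swap (swap-L s)   = swap-L (graft-swap s)
graft-swap (swap-R s)   = swap-R (graft-swap s)
graft-swap (swap-Q₁ s)  = swap-Q₁ s
graft-swap (swap-Q₂ s)  = swap-Q₂ s
graft-swap (swap-Q₃ s)  = swap-Q₃ (graft-swap s)

graft-hex : ∀ {z S T U} → Hex S T U → Hex (graft z S) (graft z T) (graft z U)
graft-hex hexagon        = hexagon
graft-hex (hex-rotate h) = hex-rotate (graft-hex h)
graft-hex (hex-mirror h) = hex-mirror (graft-hex h)
graft-hex (hex-L h)      = hex-L (graft-hex h)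
graft-hex (hex-R h)      = hex-R (graft-hex h)
graft-hex (hex-Q₁ h)     = hex-Q₁ h
graft-hex (hex-Q₂ h)     = hex-Q₂ h
graft-hex (hex-Q₃ h)     = hex-Q₃ (graft-hex h)

-- Carried through the recursions below, since the skeleton planted at the end of a fibre leaves the
-- context and cannot be obtained by mapping a smaller skeleton.
record Context : Set where
  field
    fill      : Tree → Tree
    fill-swap : ∀ {S T} → Swap S T → Swap (fill S) (fill T)
    fill-hex  : ∀ {S T U} → Hex S T U → Hex (fill S) (fill T) (fill U)

open Context

hole : Context
hole = record { fill = id ; fill-swap = id ; fill-hex = id }

infixl 5 _▹_

_▹_ : Context → Frame → Context
(c ▹ f) .fill      = fill c ∘ ⟨ f ⟩
(c ▹ f) .fill-swap = fill-swap c ∘ frame-swap f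
(c ▹ f) .fill-hex  = fill-hex c ∘ frame-hex f

middle : Context → Tree → Context
middle c A .fill T    = fill c (Q A T •)
middle c A .fill-swap = fill-swap c ∘ swap-Q₂
middle c A .fill-hex  = fill-hex c ∘ hex-Q₂

-- Inserting a quadrilateral into an alternating polygon

data Pure : Tree → Set where
  •ᵖ : Pure •
  Qᵖ : ∀ {A B C} → Pure A → Pure B → Pure C → Pure (Q A B C)

all-diff⇒pure : ∀ T → All (_≡ diff) (frontier T) → Pure T
all-diff⇒pure •     _ = •ᵖ
all-diff⇒pure (L T) (() ∷ _)
all-diff⇒pure (R T) d with () ∷ _ ← All.++⁻ʳ (frontier T) d
all-diff⇒pure (Q A B C) d =
  Qᵖ (all-diff⇒pure A (All.++⁻ˡ (frontier A) d)) (all-diff⇒pure B (All.++⁻ˡ (frontier B) dʳ))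
     (all-diff⇒pure C (All.++⁻ʳ (frontier B) dʳ))
  where dʳ = All.++⁻ʳ (frontier A) d

-- Insertion of a quadrilateral at the last vertex u of the polygon, which is split into
-- u, v, x with v of the other colour: the edges at u are distributed among u and x
-- in such a way that a nonempty interval of them is shared, and v is joined to the
-- opposite vertices of the quadrilaterals inside this interval.

fans : Tree → Tree → List Tree
fans A •         = [ Q A • • ]
fans A (L T)     = [ Q A (L T) • ]
fans A (R T)     = [ Q A (R T) • ]
fans A (Q B C D) = Q A (Q B C D) • ∷ map (Q A B) (fans C D)

insertions : Tree → List Tree
insertions •         = [ Q • • • ]
insertions (L T)     = []
insertions (R T)     = []
insertions (Q A B C) = Q (Q A B C) • • ∷ map (λ T → Q A T •) (fans B C) ++ map (Q A B) (insertions C)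

-- A path: each hexagon flip pushes the final `•` one quadrilateral further along the third
-- branches.
fan-skeleton : ∀ c A B → Skeleton (fill c (Q A B •))
fan-skeleton c A •         = tip
fan-skeleton c A (L T)     = tip
fan-skeleton c A (R T)     = tip
fan-skeleton c A (Q B C D) = hex₁ (fill-hex c (hex-rotate hexagon)) (fan-skeleton (c ▹ fQ A B) C D)

fan-nodes : ∀ c A B → nodes (fan-skeleton c A B) ≡ map (fill c) (fans A B)
fan-nodes c A •         = refl
fan-nodes c A (L T)     = refl
fan-nodes c A (R T)     = refl
fan-nodes c A (Q B C D) = cong (fill c (Q A (Q B C D) •) ∷_) (trans (fan-nodes (c ▹ fQ A B) C D) (map-∘ (fans C D)))

Q••• : Tree
Q••• = Q • • •

-- The fibre is a caterpillar. One flip in the hexagon at `Q (Q A B C) • •` moves the new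
-- quadrilateral down the right spine, the other enters the fan of `B` and `C`; `t` hangs at the far
-- end.
insert-down : ∀ c {T} → Pure T → Skeleton (fill c (graft Q••• T)) → Skeleton (fill c (Q T • •))
insert-down c •ᵖ t = t
insert-down c (Qᵖ {A} {B} {C} _ _ p) t =
  hex₂ (fill-hex c (hex-mirror hexagon)) (insert-down (c ▹ fQ A B) p t) (fan-skeleton (middle c A) B C)

-- The three dissections of a hexagon are pairwise adjacent, so in this direction each fan hangs on
-- `Q A B (Q C • •)` instead, and the far end `Q T • •` again carries no fan.
insert-up : ∀ c {T} → Pure T → Skeleton (fill c (Q T • •)) → Skeleton (fill c (graft Q••• T))
insert-up c •ᵖ t = t
insert-up c (Qᵖ {A} {B} {C} _ _ p) t =
  insert-up (c ▹ fQ A B) p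
    (hex₂ (fill-hex c (hex-rotate (hex-rotate hexagon))) t (fan-skeleton (middle c A) B C))

insertions-split : ∀ c {A B C} →
  map (fill c) (insertions (Q A B C)) ≡ fill c (Q (Q A B C) • •) ∷
    nodes (fan-skeleton (middle c A) B C) ++ map (fill (c ▹ fQ A B)) (insertions C)
insertions-split c {A} {B} {C} = cong (fill c (Q (Q A B C) • •) ∷_) (trans
  (map-++ (fill c) (map (λ T → Q A T •) (fans B C)) _)
  (cong₂ _++_ (trans (sym (map-∘ (fans B C))) (sym (fan-nodes (middle c A) B C)))
    (sym (map-∘ (insertions C)))))

insert-down-nodes : ∀ c {T} (p : Pure T) t →
  fill c (graft Q••• T) ∷ nodes (insert-down c p t) ↭ map (fill c) (insertions T) ++ nodes t
insert-down-nodes c •ᵖ t = ↭-refl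
insert-down-nodes c {T} (Qᵖ {A} {B} {C} _ _ p) t = begin
  b ∷ x ∷ d ++ fs              ↭⟨ ↭-swap b x ↭-refl ⟩
  x ∷ (b ∷ d) ++ fs            ↭⟨ ↭-prep x (++⁺ʳ fs (insert-down-nodes (c ▹ fQ A B) p t)) ⟩
  x ∷ (i ++ nodes t) ++ fs     ↭⟨ ↭-prep x (++-comm (i ++ nodes t) fs) ⟩
  x ∷ fs ++ i ++ nodes t       ≡⟨ cong (x ∷_) (++-assoc fs i (nodes t)) ⟨
  x ∷ (fs ++ i) ++ nodes t     ≡⟨ cong (_++ nodes t) (insertions-split c {A} {B} {C}) ⟨
  map (fill c) (insertions T) ++ nodes t ∎
  where
  open PermutationReasoning
  b  = fill c (graft Q••• T)
  x  = fill c (Q T • •)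
  d  = nodes (insert-down (c ▹ fQ A B) p t)
  fs = nodes (fan-skeleton (middle c A) B C)
  i  = map (fill (c ▹ fQ A B)) (insertions C)

insert-up-nodes : ∀ c {T} (p : Pure T) t →
  fill c (Q T • •) ∷ nodes (insert-up c p t) ↭ map (fill c) (insertions T) ++ nodes t
insert-up-nodes c •ᵖ t = ↭-refl
insert-up-nodes c {T} (Qᵖ {A} {B} {C} _ _ p) t = begin
  x ∷ nodes (insert-up c' p t') ↭⟨ ↭-prep x (leave (insert-up-nodes c' p t')) ⟩
  x ∷ i ++ nodes t ++ fs        ≡⟨ cong (x ∷_) (++-assoc i (nodes t) fs) ⟨
  x ∷ (i ++ nodes t) ++ fs      ↭⟨ ↭-prep x (++-comm (i ++ nodes t) fs) ⟩
  x ∷ fs ++ i ++ nodes t        ≡⟨ cong (x ∷_) (++-assoc fs i (nodes t)) ⟨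
  x ∷ (fs ++ i) ++ nodes t      ≡⟨ cong (_++ nodes t) (insertions-split c {A} {B} {C}) ⟨
  map (fill c) (insertions T) ++ nodes t ∎
  where
  open PermutationReasoning
  c' = c ▹ fQ A B
  t' = hex₂ (fill-hex c (hex-rotate (hex-rotate hexagon))) t (fan-skeleton (middle c A) B C)
  x  = fill c (Q T • •)
  fs = nodes (fan-skeleton (middle c A) B C)
  i  = map (fill c') (insertions C)

data IsQ : Tree → Set where
  isQ : ∀ {A B C} → IsQ (Q A B C)

fans-Q : ∀ A B {T} → T ∈ fans A B → IsQ T
fans-Q A •         (here refl) = isQ
fans-Q A (L B)     (here refl) = isQ
fans-Q A (R B)     (here refl) = isQ
fans-Q A (Q B C D) (here refl) = isQ
fans-Q A (Q B C D) (there T∈) with _ , _ , refl ← ∈-map⁻ (Q A B) T∈ = isQ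

insertions-Q : ∀ T {S} → S ∈ insertions T → IsQ S
insertions-Q •         (here refl) = isQ
insertions-Q (Q A B C) (here refl) = isQ
insertions-Q (Q A B C) (there S∈) with ∈-++⁻ (map (λ T → Q A T •) (fans B C)) S∈
... | inj₁ S∈ˡ with _ , _ , refl ← ∈-map⁻ (λ T → Q A T •) S∈ˡ = isQ
... | inj₂ S∈ʳ with _ , _ , refl ← ∈-map⁻ (Q A B) S∈ʳ = isQ

fans-unique : ∀ A B → Unique (fans A B)
fans-unique A •         = [] ∷ []
fans-unique A (L B)     = [] ∷ []
fans-unique A (R B)     = [] ∷ []
fans-unique A (Q B C D) = All.tabulate new ∷ Unique.map⁺ (λ { refl → refl }) (fans-unique C D)
  where
  new : ∀ {T} → T ∈ map (Q A B) (fans C D) → Q A (Q B C D) • ≢ T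
  new T∈ refl with ∈-map⁻ (Q A B) T∈
  ... | _ , _ , ()

insertions-unique : ∀ T → Unique (insertions T)
insertions-unique •         = [] ∷ []
insertions-unique (L T)     = []
insertions-unique (R T)     = []
insertions-unique (Q A B C) = All.tabulate new ∷
  Unique.++⁺ (Unique.map⁺ (λ { refl → refl }) (fans-unique B C))
             (Unique.map⁺ (λ { refl → refl }) (insertions-unique C)) disjoint
  where
  disjoint : ∀ {T} → ¬ (T ∈ map (λ T → Q A T •) (fans B C) × T ∈ map (Q A B) (insertions C))
  disjoint (p , q) with _ , _ , refl ← ∈-map⁻ (λ T → Q A T •) p | _ , S∈ , refl ← ∈-map⁻ (Q A B) q
    with () ← insertions-Q C S∈
  new : ∀ {T} → T ∈ map (λ T → Q A T •) (fans B C) ++ map (Q A B) (insertions C) → Q (Q A B C) • • ≢ T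
  new T∈ refl with ∈-++⁻ (map (λ T → Q A T •) (fans B C)) T∈
  ... | inj₁ p with ∈-map⁻ (λ T → Q A T •) p
  ...   | _ , _ , ()
  new T∈ refl | inj₂ q with ∈-map⁻ (Q A B) q
  ...   | _ , _ , ()

-- Recovers `A` and `B` from any member of `fans A B`. The last equation is a default value, as fans
-- consist of quadrilaterals.
unfan : Tree → Tree × Tree
unfan (Q A B (Q C D E)) with C' , D' ← unfan (Q C D E) = A , Q B C' D'
unfan (Q A B _)         = A , B
unfan _                 = • , •

-- Merges the last three vertices again. Which of the second and third branches are quadrilaterals
-- shows which kind of insertion took place.
delete : Tree → Tree
delete (Q A B (Q C D E))     = Q A B (delete (Q C D E))
delete (Q A (Q B C D) •)     with B' , C' ← unfan (Q B C D) = Q A B' C'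
delete (Q A _ _)             = A
delete _                     = •

unfan-fans : ∀ A B {T} → T ∈ fans A B → unfan T ≡ (A , B)
unfan-fans A •         (here refl) = refl
unfan-fans A (L B)     (here refl) = refl
unfan-fans A (R B)     (here refl) = refl
unfan-fans A (Q B C D) (here refl) = refl
unfan-fans A (Q B C D) (there T∈) with S , S∈ , refl ← ∈-map⁻ (Q A B) T∈
  with isQ ← fans-Q C D S∈ rewrite unfan-fans C D S∈ = refl

delete-insertions : ∀ {T S} → S ∈ insertions T → delete S ≡ T
delete-insertions {•}       (here refl) = refl
delete-insertions {Q A B C} (here refl) = refl
delete-insertions {Q A B C} (there S∈) with ∈-++⁻ (map (λ T → Q A T •) (fans B C)) S∈
... | inj₁ p with _ , T∈ , refl ← ∈-map⁻ (λ T → Q A T •) p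
  with isQ ← fans-Q B C T∈ rewrite unfan-fans B C T∈ = refl
... | inj₂ q with _ , T∈ , refl ← ∈-map⁻ (Q A B) q
  with isQ ← insertions-Q C T∈ = cong (Q A B) (delete-insertions T∈)

unfan-pure : ∀ {T} → Pure T → Pure (proj₁ (unfan T)) × Pure (proj₂ (unfan T))
unfan-pure •ᵖ = •ᵖ , •ᵖ
unfan-pure (Qᵖ p q •ᵖ) = p , q
unfan-pure (Qᵖ p q r@(Qᵖ _ _ _)) with p' , q' ← unfan-pure r = p , Qᵖ q p' q'

delete-pure : ∀ {T} → Pure T → Pure (delete T)
delete-pure •ᵖ = •ᵖ
delete-pure (Qᵖ p q (Qᵖ r s t)) = Qᵖ p q (delete-pure (Qᵖ r s t))
delete-pure (Qᵖ p •ᵖ •ᵖ) = p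
delete-pure (Qᵖ p (Qᵖ r s t) •ᵖ) with q' , r' ← unfan-pure (Qᵖ r s t) = Qᵖ p q' r'

∈-fans : ∀ {A B C} → Pure (Q A B C) → Q A B C ∈ fans (proj₁ (unfan (Q A B C))) (proj₂ (unfan (Q A B C)))
∈-fans {A} (Qᵖ _ •ᵖ •ᵖ) = here refl
∈-fans {A} (Qᵖ _ (Qᵖ _ _ _) •ᵖ) = here refl
∈-fans {A} {B} (Qᵖ _ _ r@(Qᵖ _ _ _)) = there (∈-map⁺ (Q A B) (∈-fans r))

∈-insertions : ∀ {A B C} → Pure (Q A B C) → Q A B C ∈ insertions (delete (Q A B C))
∈-insertions (Qᵖ •ᵖ •ᵖ •ᵖ)           = here refl
∈-insertions (Qᵖ (Qᵖ _ _ _) •ᵖ •ᵖ)   = here refl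
∈-insertions {A} (Qᵖ _ q@(Qᵖ _ _ _) •ᵖ) = there (∈-++⁺ˡ (∈-map⁺ (λ T → Q A T •) (∈-fans q)))
∈-insertions {A} {B} {Q C D E} (Qᵖ _ _ r@(Qᵖ _ _ _)) =
  there (∈-++⁺ʳ (map (λ T → Q A T •) (fans B (delete (Q C D E)))) (∈-map⁺ (Q A B) (∈-insertions r)))

diffs : ℕ → List Side
diffs n = replicate n diff

diffs-snoc : ∀ n → diffs n ++ diff ∷ diff ∷ [] ≡ diffs (2 + n)
diffs-snoc zero    = refl
diffs-snoc (suc n) = cong (diff ∷_) (diffs-snoc n)

pure : ∀ n T → frontier T ≡ diffs n → Pure T
pure n T eq = all-diff⇒pure T (subst (All (_≡ diff)) (sym eq) (All.replicate⁺ n refl))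

graft-Q-frontier : ∀ {T} → Pure T → frontier (graft Q••• T) ≡ frontier T ++ diff ∷ diff ∷ []
graft-Q-frontier •ᵖ = refl
graft-Q-frontier (Qᵖ {A} {B} {C} _ _ p) = trans
  (cong (λ w → a ++ b ++ w) (graft-Q-frontier p))
  (sym (trans (++-assoc a _ _) (cong (a ++_) (++-assoc b (frontier C) _))))
  where
  a = frontier A
  b = frontier B

insertions-frontier : ∀ {T S} → Pure T → S ∈ insertions T → frontier S ≡ frontier T ++ diff ∷ diff ∷ []
insertions-frontier {T} {S} p S∈ =
  nodes-frontier (insert-down hole p tip) (∈-resp-↭ (↭-sym (leave (insert-down-nodes hole p tip)))
    (∈-++⁺ˡ (subst (S ∈_) (sym (map-id (insertions T))) S∈)))

span-insert : ∀ n → Span (diffs n) → Span (diffs (2 + n))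
span-insert n = span-fibration
  where
  delete-frontier : ∀ T → frontier T ≡ diffs (2 + n) → T ∈ insertions (delete T) → frontier (delete T) ≡ diffs n
  delete-frontier T e T∈ = ++-cancelʳ (diff ∷ diff ∷ []) (frontier (delete T)) (diffs n) (trans
    (sym (insertions-frontier (delete-pure (pure (2 + n) T e)) T∈)) (trans e (sym (diffs-snoc n))))
  ∈-insertions-delete : ∀ T → frontier T ≡ diffs (2 + n) → T ∈ insertions (delete T)
  ∈-insertions-delete T e with p ← pure (2 + n) T e with T | p
  ... | • | _ = contradiction e λ ()
  ... | Q _ _ _ | p' = ∈-insertions p'
  map-hole : ∀ T {ys zs} → ys ↭ map id (insertions T) ++ zs → ys ↭ insertions T ++ zs
  map-hole T {ys} {zs} = subst (λ xs → ys ↭ xs ++ zs) (map-id (insertions T))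
  open Fibration {diffs n} {diffs (2 + n)} (graft Q•••) (λ T → Q T • •) insertions delete
    graft-swap swap-Q₁ graft-hex hex-Q₁
    (λ v e → insert-up hole (pure n v e)) (λ v e → insert-down hole (pure n v e))
    (λ v e t → map-hole v (insert-up-nodes hole (pure n v e) t))
    (λ v e t → map-hole v (insert-down-nodes hole (pure n v e) t))
    (λ v e → trans (graft-Q-frontier (pure n v e)) (trans (cong (_++ _) e) (diffs-snoc n)))
    (λ v e → insertions-unique v) (λ v e → delete-insertions)
    (λ T e → delete-frontier T e (∈-insertions-delete T e)) ∈-insertions-delete

open Context

-- Enlarging the last block

-- With `v` consisting of `fR` only, these are the ways to distribute the triangles on new sides at
-- the end of the word along the spine `u`.
shuffles : List Frame → List Frame → List Tree
shuffles []       v        = [ ⟦ v ⟧ • ]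
shuffles (f ∷ fs) []       = [ ⟦ f ∷ fs ⟧ • ]
shuffles (f ∷ fs) (g ∷ gs) = map ⟨ f ⟩ (shuffles fs (g ∷ gs)) ++ map ⟨ g ⟩ (shuffles (f ∷ fs) gs)

shuffles-[] : ∀ u → shuffles u [] ≡ [ ⟦ u ⟧ • ]
shuffles-[] []      = refl
shuffles-[] (_ ∷ _) = refl

shuffles-comm : ∀ u v → shuffles u v ↭ shuffles v u
shuffles-comm []       []       = ↭-refl
shuffles-comm []       (g ∷ gs) = ↭-refl
shuffles-comm (f ∷ fs) []       = ↭-refl
shuffles-comm (f ∷ fs) (g ∷ gs) = ↭-trans
  (++⁺ (map⁺ ⟨ f ⟩ (shuffles-comm fs (g ∷ gs))) (map⁺ ⟨ g ⟩ (shuffles-comm (f ∷ fs) gs)))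
  (++-comm (map ⟨ f ⟩ (shuffles (g ∷ gs) fs)) _)

Commute : List Frame → List Frame → Set
Commute u v = ∀ {f g} → f ∈ u → g ∈ v → ∀ T → Swap (⟨ f ⟩ (⟨ g ⟩ T)) (⟨ g ⟩ (⟨ f ⟩ T))

-- Besides its children within the group, the root of a group has a swap to the root of the next
-- group; this is the slot for it.
data Extra (S : Tree) : Set where
  ∅ : Extra S
  extra : ∀ {T} → Swap S T → Skeleton T → Extra S

extra-nodes : ∀ {S} → Extra S → List Tree
extra-nodes ∅       = []
extra-nodes (extra _ t) = nodes t

plant : ∀ {S} → Extra S → Skeleton S
plant ∅       = tip
plant (extra s t) = swap₁ s t

-- A skeleton on the shuffles of u and v, from u v to v u.  For v = g ∷ gs the shuffles are grouped by
-- the prefix f₁ … fᵢ of u that precedes g; the roots f₁ … fᵢ g fᵢ₊₁ … of the groups form a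
-- path, and the group of the empty prefix contains v u.  In a closed skeleton
-- v u is a leaf, in an open one the skeleton t is planted there.

closed : ∀ c u v → Commute u v → Extra (fill c (⟦ u ⟧ (⟦ v ⟧ •))) → Skeleton (fill c (⟦ u ⟧ (⟦ v ⟧ •)))
chain  : ∀ c f fs g gs → Commute (f ∷ fs) (g ∷ gs) →
  Extra (fill c (⟦ f ∷ fs ⟧ (⟦ g ∷ gs ⟧ •))) → Skeleton (fill (c ▹ g) (⟦ f ∷ fs ⟧ (⟦ gs ⟧ •))) →
  Skeleton (fill c (⟦ f ∷ fs ⟧ (⟦ g ∷ gs ⟧ •)))
open′  : ∀ c u v → Commute u v → Skeleton (fill c (⟦ v ⟧ (⟦ u ⟧ •))) → Skeleton (fill c (⟦ u ⟧ (⟦ v ⟧ •)))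

open′ c []       v        com t = t
open′ c (f ∷ fs) []       com t = t
open′ c (f ∷ fs) (g ∷ gs) com t =
  chain c f fs g gs com ∅ (open′ (c ▹ g) (f ∷ fs) gs (λ p q → com p (there q)) t)

closed c []       v        com x = plant x
closed c (f ∷ fs) []       com x = plant x
closed c (f ∷ fs) (g ∷ gs) com x =
  chain c f fs g gs com x (open′ (c ▹ g) (f ∷ fs) gs (λ p q → com p (there q)) tip)

chain c f [] g gs com ∅ t         = swap₁ (fill-swap c (com (here refl) (here refl) _)) t
chain c f [] g gs com (extra s t') t  = swap₂ (fill-swap c (com (here refl) (here refl) _)) s t t'
chain c f (f' ∷ fs) g gs com x t     =
  chain (c ▹ f) f' fs g gs (com ∘ there) x
    (closed (c ▹ f ▹ g) (f' ∷ fs) gs (λ p q → com (there p) (there q))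
      (extra (fill-swap c (com (here refl) (here refl) _)) t))

plant-nodes : ∀ {S} (x : Extra S) → nodes (plant x) ≡ S ∷ extra-nodes x
plant-nodes ∅       = refl
plant-nodes (extra _ _) = refl

map-shuffles : ∀ c f fs g gs → map (fill c) (shuffles (f ∷ fs) (g ∷ gs)) ≡
  map (fill (c ▹ f)) (shuffles fs (g ∷ gs)) ++ map (fill (c ▹ g)) (shuffles (f ∷ fs) gs)
map-shuffles c f fs g gs = trans (map-++ (fill c) (map ⟨ f ⟩ (shuffles fs (g ∷ gs))) _)
  (cong₂ _++_ (sym (map-∘ (shuffles fs (g ∷ gs)))) (sym (map-∘ (shuffles (f ∷ fs) gs))))

closed-nodes : ∀ c u v (com : Commute u v) x →
  nodes (closed c u v com x) ↭ map (fill c) (shuffles u v) ++ extra-nodes x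
chain-nodes : ∀ c f fs g gs (com : Commute (f ∷ fs) (g ∷ gs)) x t →
  nodes (chain c f fs g gs com x t) ↭ map (fill (c ▹ f)) (shuffles fs (g ∷ gs)) ++ extra-nodes x ++ nodes t
open-nodes : ∀ c u v (com : Commute u v) t →
  fill c (⟦ v ⟧ (⟦ u ⟧ •)) ∷ nodes (open′ c u v com t) ↭ map (fill c) (shuffles u v) ++ nodes t

open-nodes c []       v        com t = ↭-refl
open-nodes c (f ∷ fs) []       com t = ↭-refl
open-nodes c (f ∷ fs) (g ∷ gs) com t = begin
  z ∷ nodes (chain c f fs g gs com ∅ o) ↭⟨ ↭-prep z (chain-nodes c f fs g gs com ∅ o) ⟩
  z ∷ a ++ nodes o                         ↭⟨ shift z a (nodes o) ⟨
  a ++ z ∷ nodes o                         ↭⟨ ++⁺ˡ a (open-nodes (c ▹ g) (f ∷ fs) gs _ t) ⟩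
  a ++ b ++ nodes t                        ≡⟨ ++-assoc a b (nodes t) ⟨
  (a ++ b) ++ nodes t                      ≡⟨ cong (_++ nodes t) (map-shuffles c f fs g gs) ⟨
  map (fill c) (shuffles (f ∷ fs) (g ∷ gs)) ++ nodes t ∎
  where
  open PermutationReasoning
  z = fill c (⟦ g ∷ gs ⟧ (⟦ f ∷ fs ⟧ •))
  o = open′ (c ▹ g) (f ∷ fs) gs (λ p q → com p (there q)) t
  a = map (fill (c ▹ f)) (shuffles fs (g ∷ gs))
  b = map (fill (c ▹ g)) (shuffles (f ∷ fs) gs)

closed-nodes c []       v        com x = ↭-reflexive (plant-nodes x)
closed-nodes c (f ∷ fs) []       com x = ↭-reflexive (plant-nodes x)
closed-nodes c (f ∷ fs) (g ∷ gs) com x = begin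
  nodes (chain c f fs g gs com x o) ↭⟨ chain-nodes c f fs g gs com x o ⟩
  a ++ e ++ nodes o                 ↭⟨ ++⁺ˡ a (++⁺ˡ e o-nodes) ⟩
  a ++ e ++ b                       ↭⟨ ++⁺ˡ a (++-comm e b) ⟩
  a ++ b ++ e                       ≡⟨ ++-assoc a b e ⟨
  (a ++ b) ++ e                     ≡⟨ cong (_++ e) (map-shuffles c f fs g gs) ⟨
  map (fill c) (shuffles (f ∷ fs) (g ∷ gs)) ++ e ∎
  where
  open PermutationReasoning
  e = extra-nodes x
  o = open′ (c ▹ g) (f ∷ fs) gs (λ p q → com p (there q)) tip
  a = map (fill (c ▹ f)) (shuffles fs (g ∷ gs))
  b = map (fill (c ▹ g)) (shuffles (f ∷ fs) gs)
  o-nodes : nodes o ↭ b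
  o-nodes = ↭-trans (leave (open-nodes (c ▹ g) (f ∷ fs) gs (λ p q → com p (there q)) tip)) (↭-reflexive (++-identityʳ b))

chain-nodes c f [] g gs com ∅ t        = ↭-refl
chain-nodes c f [] g gs com (extra s t') t = ↭-prep _ (++-comm (nodes t) (nodes t'))
chain-nodes c f (f' ∷ fs) g gs com x t = begin
  nodes (chain (c ▹ f) f' fs g gs _ x k) ↭⟨ chain-nodes (c ▹ f) f' fs g gs (com ∘ there) x k ⟩
  a ++ e ++ nodes k          ↭⟨ ++⁺ˡ a (++⁺ˡ e (closed-nodes (c ▹ f ▹ g) (f' ∷ fs) gs _ y)) ⟩
  a ++ e ++ b ++ nodes t     ↭⟨ ++⁺ˡ a (shifts e b) ⟩
  a ++ b ++ e ++ nodes t     ≡⟨ ++-assoc a b (e ++ nodes t) ⟨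
  (a ++ b) ++ e ++ nodes t   ≡⟨ cong (_++ e ++ nodes t) (map-shuffles (c ▹ f) f' fs g gs) ⟨
  map (fill (c ▹ f)) (shuffles (f' ∷ fs) (g ∷ gs)) ++ e ++ nodes t ∎
  where
  open PermutationReasoning
  y = extra (fill-swap c (com (here refl) (here refl) _)) t
  k = closed (c ▹ f ▹ g) (f' ∷ fs) gs (λ p q → com (there p) (there q)) y
  e = extra-nodes x
  a = map (fill (c ▹ f ▹ f')) (shuffles fs (g ∷ gs))
  b = map (fill (c ▹ f ▹ g)) (shuffles (f' ∷ fs) gs)

data NotR : Frame → Set where
  notL : NotR fL
  notQ : ∀ {A B} → NotR (fQ A B)

Rs : ℕ → List Frame
Rs k = replicate k fR

R-commute : ∀ {f} → NotR f → ∀ T → Swap (⟨ f ⟩ (R T)) (R (⟨ f ⟩ T))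
R-commute notL T = LR
R-commute notQ T = QR

commuteʳ : ∀ {u} k → All NotR u → Commute u (Rs k)
commuteʳ k u f∈ g∈ T with refl ← All.lookup (All.replicate⁺ {P = _≡ fR} k refl) g∈ =
  R-commute (All.lookup u f∈) T

commuteˡ : ∀ {u} k → All NotR u → Commute (Rs k) u
commuteˡ k u f∈ g∈ T = swap-sym (commuteʳ k u g∈ f∈ T)

⟨⟩≢R : ∀ {f S T} → NotR f → ⟨ f ⟩ S ≢ R T
⟨⟩≢R notL ()
⟨⟩≢R notQ ()

shuffles-unique : ∀ {u} k → All NotR u → Unique (shuffles u (Rs k))
shuffles-unique k [] = [] ∷ []
shuffles-unique zero (_ ∷ _) = [] ∷ []
shuffles-unique {f ∷ fs} (suc k) (nf ∷ nfs) =
  Unique.++⁺ (Unique.map⁺ (frame-injective f) (shuffles-unique (suc k) nfs))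
    (Unique.map⁺ (frame-injective fR) (shuffles-unique k (nf ∷ nfs)))
    disjoint
  where
  disjoint : ∀ {T} → ¬ (T ∈ map ⟨ f ⟩ (shuffles fs (Rs (suc k))) × T ∈ map R (shuffles (f ∷ fs) (Rs k)))
  disjoint (p , q) with ∈-map⁻ ⟨ f ⟩ p | ∈-map⁻ R q
  ... | _ , _ , refl | _ , _ , eq = ⟨⟩≢R nf eq

-- The projection of the fibration: the `R` cells on the right spine are the triangles on the `same`
-- sides after the last `diff`.
strip : Tree → Tree
strip •         = •
strip (L T)     = L (strip T)
strip (R T)     = strip T
strip (Q A B C) = Q A B (strip C)

strip-NotR : ∀ T → All NotR (spine (strip T))
strip-NotR •         = []
strip-NotR (L T)     = notL ∷ strip-NotR T
strip-NotR (R T)     = strip-NotR T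
strip-NotR (Q A B C) = notQ ∷ strip-NotR C

strip-frame : ∀ {f} → NotR f → ∀ T → strip (⟨ f ⟩ T) ≡ ⟨ f ⟩ (strip T)
strip-frame notL T = refl
strip-frame notQ T = refl

strip-frames : ∀ {u} → All NotR u → strip (⟦ u ⟧ •) ≡ ⟦ u ⟧ •
strip-frames [] = refl
strip-frames {f ∷ fs} (nf ∷ nfs) = trans (strip-frame nf _) (cong ⟨ f ⟩ (strip-frames nfs))

strip-Rs : ∀ k → strip (⟦ Rs k ⟧ •) ≡ •
strip-Rs zero    = refl
strip-Rs (suc k) = strip-Rs k

strip-shuffles : ∀ {u} k → All NotR u → ∀ {T} → T ∈ shuffles u (Rs k) → strip T ≡ ⟦ u ⟧ •
strip-shuffles k [] (here refl) = strip-Rs k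
strip-shuffles zero (nf ∷ nfs) (here refl) = strip-frames (nf ∷ nfs)
strip-shuffles {f ∷ fs} (suc k) (nf ∷ nfs) T∈ = Sum.[
  (λ p → let S , S∈ , eq = ∈-map⁻ ⟨ f ⟩ p in
    trans (cong strip eq) (trans (strip-frame nf S) (cong ⟨ f ⟩ (strip-shuffles (suc k) nfs S∈)))) ,
  (λ q → let S , S∈ , eq = ∈-map⁻ R q in
    trans (cong strip eq) (strip-shuffles k (nf ∷ nfs) S∈)) ]
  (∈-++⁻ (map ⟨ f ⟩ (shuffles fs (Rs (suc k)))) T∈)

∈-shuffles-frame : ∀ {f u} k {T} → T ∈ shuffles u (Rs k) → ⟨ f ⟩ T ∈ shuffles (f ∷ u) (Rs k)
∈-shuffles-frame {f} {u} zero T∈ with here refl ← subst (_ ∈_) (shuffles-[] u) T∈ = here refl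
∈-shuffles-frame {f} (suc k) T∈ = ∈-++⁺ˡ (∈-map⁺ ⟨ f ⟩ T∈)

∈-shuffles-R : ∀ u k {T} → T ∈ shuffles u (Rs k) → R T ∈ shuffles u (Rs (suc k))
∈-shuffles-R []       k (here refl) = here refl
∈-shuffles-R (f ∷ fs) k T∈ = ∈-++⁺ʳ (map ⟨ f ⟩ (shuffles fs (Rs (suc k)))) (∈-map⁺ R T∈)

++-assoc₃ : ∀ (a b : List Side) {p q w} → w ≡ p ++ q → a ++ b ++ w ≡ (a ++ b ++ p) ++ q
++-assoc₃ a b {p} {q} refl = sym (trans (++-assoc a _ q) (cong (a ++_) (++-assoc b p q)))

strip-frontier : ∀ T → ∃₂ λ p k → frontier T ≡ p ++ diff ∷ sames k × frontier (strip T) ≡ p ++ [ diff ]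
  × T ∈ shuffles (spine (strip T)) (Rs k)
strip-frontier • = [] , 0 , refl , refl , here refl
strip-frontier (L T) with p , k , eq , eq' , T∈ ← strip-frontier T =
  same ∷ p , k , cong (same ∷_) eq , cong (same ∷_) eq' , ∈-shuffles-frame k T∈
strip-frontier (R T) with p , k , eq , eq' , T∈ ← strip-frontier T =
  p , suc k ,
  trans (cong (_++ [ same ]) eq) (trans (++-assoc p _ _) (cong (λ w → p ++ diff ∷ w) (sames-snoc k))) ,
  eq' , ∈-shuffles-R (spine (strip T)) k T∈
strip-frontier (Q A B C) with p , k , eq , eq' , C∈ ← strip-frontier C =
  frontier A ++ frontier B ++ p , k , ++-assoc₃ (frontier A) (frontier B) eq , ++-assoc₃ (frontier A) (frontier B) eq' ,
  ∈-shuffles-frame k C∈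

strip-fixed : ∀ w v → frontier v ≡ w ++ [ diff ] → strip v ≡ v
strip-fixed w v e with p , k , eq , _ , v∈ ← strip-frontier v
  with refl , refl ← last-run p w {k} {0} (trans (sym eq) e)
  with here eq ← subst (v ∈_) (shuffles-[] (spine (strip v))) v∈
  = sym (trans eq (spine-• (strip v)))

graft-frontier : ∀ v → All NotR (spine v) →
  ∃ λ p → frontier v ≡ p ++ [ diff ] × (∀ z → frontier (graft z v) ≡ p ++ frontier z)
graft-frontier • _ = [] , refl , λ _ → refl
graft-frontier (L v) (_ ∷ n) with p , eq , g ← graft-frontier v n =
  same ∷ p , cong (same ∷_) eq , λ z → cong (same ∷_) (g z)
graft-frontier (R v) (() ∷ _)
graft-frontier (Q A B C) (_ ∷ n) with p , eq , g ← graft-frontier C n =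
  frontier A ++ frontier B ++ p , ++-assoc₃ (frontier A) (frontier B) eq ,
  λ z → ++-assoc₃ (frontier A) (frontier B) (g z)

Rs-frontier : ∀ k → frontier (⟦ Rs k ⟧ •) ≡ diff ∷ sames k
Rs-frontier zero    = refl
Rs-frontier (suc k) = trans (cong (_++ [ same ]) (Rs-frontier k)) (cong (diff ∷_) (sames-snoc k))

-- A fibre distributes the `k` new triangles along the spine. Its ends are the extreme positions:
-- all at the last side, or all at the root.
span-extend : ∀ w k → Span (w ++ [ diff ]) → Span (w ++ diff ∷ sames k)
span-extend w k = span-fibration
  where
  w₁ = w ++ [ diff ]
  fibre = λ v → shuffles (spine v) (Rs k)
  bot = graft (⟦ Rs k ⟧ •)
  top = ⟦ Rs k ⟧
  spine-NotR : ∀ v → frontier v ≡ w₁ → All NotR (spine v)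
  spine-NotR v e = subst (All NotR ∘ spine) (strip-fixed w v e) (strip-NotR v)
  up : ∀ v → frontier v ≡ w₁ → Skeleton (top v) → Skeleton (bot v)
  up v e t = open′ hole (spine v) (Rs k) (commuteʳ k (spine-NotR v e))
    (subst (Skeleton ∘ top) (sym (spine-• v)) t)
  down : ∀ v → frontier v ≡ w₁ → Skeleton (bot v) → Skeleton (top v)
  down v e t = subst (Skeleton ∘ top) (spine-• v) (open′ hole (Rs k) (spine v) (commuteˡ k (spine-NotR v e)) t)
  nodes-subst : ∀ {S T} (eq : S ≡ T) (t : Skeleton (top S)) → nodes (subst (Skeleton ∘ top) eq t) ≡ nodes t
  nodes-subst refl t = refl
  up-nodes : ∀ v (e : frontier v ≡ w₁) t → top v ∷ nodes (up v e t) ↭ fibre v ++ nodes t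
  up-nodes v e t = subst₂ _↭_ (cong (λ T → top T ∷ nodes (up v e t)) (spine-• v))
    (cong₂ _++_ (map-id (fibre v)) (nodes-subst (sym (spine-• v)) t))
    (open-nodes hole (spine v) (Rs k) (commuteʳ k (spine-NotR v e)) _)
  down-nodes : ∀ v (e : frontier v ≡ w₁) t → bot v ∷ nodes (down v e t) ↭ fibre v ++ nodes t
  down-nodes v e t = begin
    bot v ∷ nodes (down v e t)                      ≡⟨ cong (bot v ∷_) (nodes-subst (spine-• v) _) ⟩
    bot v ∷ nodes (open′ hole (Rs k) (spine v) com t) ↭⟨ open-nodes hole (Rs k) (spine v) com t ⟩
    map id (shuffles (Rs k) (spine v)) ++ nodes t   ≡⟨ cong (_++ nodes t) (map-id _) ⟩
    shuffles (Rs k) (spine v) ++ nodes t            ↭⟨ ++⁺ʳ (nodes t) (shuffles-comm (Rs k) (spine v)) ⟩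
    fibre v ++ nodes t                              ∎
    where
    open PermutationReasoning
    com = commuteˡ k (spine-NotR v e)
  decompose : ∀ T → frontier T ≡ w ++ diff ∷ sames k → frontier (strip T) ≡ w₁ × T ∈ fibre (strip T)
  decompose T e with p , k' , eq , eq' , T∈ ← strip-frontier T
    with refl , refl ← last-run p w (trans (sym eq) e) = eq' , T∈
  bot-frontier : ∀ v → frontier v ≡ w₁ → frontier (bot v) ≡ w ++ diff ∷ sames k
  bot-frontier v e with p , eq , g ← graft-frontier v (spine-NotR v e)
    with refl , _ ← last-run p w {0} {0} (trans (sym eq) e) =
    trans (g (⟦ Rs k ⟧ •)) (cong (w ++_) (Rs-frontier k))
  open Fibration {w₁} {w ++ diff ∷ sames k} bot top fibre strip
    graft-swap (frames-swap (Rs k)) graft-hex (frames-hex (Rs k)) up down up-nodes down-nodes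
    bot-frontier
    (λ v e → shuffles-unique k (spine-NotR v e))
    (λ v e T∈ → trans (strip-shuffles k (spine-NotR v e) T∈) (spine-• v))
    (λ T e → proj₁ (decompose T e)) (λ T e → proj₂ (decompose T e))

-- A span for every coloring sequence

-- The side from the last point to the first is left out: it is bichromatic for even length and
-- becomes the root.
sides : List ℕ → List Side
sides []           = []
sides (a ∷ [])     = sames (a ∸ 1)
sides (a ∷ b ∷ as) = sames (a ∸ 1) ++ diff ∷ sides (b ∷ as)

ones : ℕ → List ℕ
ones r = replicate r 1

ones-snoc : ∀ r → ones r ++ [ 1 ] ≡ ones (suc r)
ones-snoc zero    = refl
ones-snoc (suc r) = cong (1 ∷_) (ones-snoc r)

sides-snoc : ∀ a as → sides ((a ∷ as) ++ [ 1 ]) ≡ sides (a ∷ as) ++ [ diff ]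
sides-snoc a []       = refl
sides-snoc a (b ∷ as) = trans (cong (λ w → sames (a ∸ 1) ++ diff ∷ w) (sides-snoc b as))
  (sym (++-assoc (sames (a ∸ 1)) _ _))

sides-ones : ∀ n → sides (ones (suc n)) ≡ diffs n
sides-ones zero    = refl
sides-ones (suc n) = cong (diff ∷_) (sides-ones n)

span-diffs : ∀ q → Span (diffs (suc (q + q)))
span-diffs zero = record
  { skeleton = tip ; top-frontier = refl ; unique = [] ∷ []
  ; spanning = λ T e → here (only-• T (pure 1 T e) e) }
  where
  only-• : ∀ T → Pure T → frontier T ≡ [ diff ] → T ≡ •
  only-• • _ _ = refl
  only-• (Q A B C) _ e = contradiction e (longer A B C)
    where
    nonempty : ∀ T → ∃₂ λ s w → frontier T ≡ s ∷ w
    nonempty • = _ , _ , refl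
    nonempty (L T) = _ , _ , refl
    nonempty (R T) with _ , _ , eq ← nonempty T = _ , _ , cong (_++ _) eq
    nonempty (Q A B C) with _ , _ , eq ← nonempty A = _ , _ , cong (_++ _) eq
    longer : ∀ A B C → frontier A ++ frontier B ++ frontier C ≢ [ diff ]
    longer A B C eq
      with frontier A | nonempty A | frontier B | nonempty B
    ... | _ | _ , [] , refl | _ | _ , _ , refl with () ← eq
    ... | _ | _ , _ ∷ _ , refl | _ | _ , _ , refl with () ← eq
span-diffs (suc q) = subst (Span ∘ diffs) (cong suc (cong suc (sym (+-suc q q)))) (span-insert _ (span-diffs q))

span-block : ∀ a b bs → Span (sides ((b ∷ bs) ++ [ 1 ])) → Span (sides (a ∷ b ∷ bs))
span-block a b bs sp = span-rotate (sides (b ∷ bs)) (a ∸ 1)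
  (span-extend (sides (b ∷ bs)) (a ∸ 1) (subst Span (sides-snoc b bs) sp))

-- One after the other, the last block, of size 1, gets its final size and is rotated to the front.
span-sides : ∀ {n} as r → length as + r ≡ 2 + n → Span (sides (ones (2 + n))) → Span (sides (as ++ ones r))
span-sides [] r refl sp = sp
span-sides (a ∷ as) r eq sp
  with as ++ ones r in e | span-sides as (suc r) (trans (+-suc (length as) r) eq) sp
... | b ∷ bs | sp' = span-block a b bs (subst (Span ∘ sides) last-one sp')
  where
  last-one : as ++ ones (suc r) ≡ (b ∷ bs) ++ [ 1 ]
  last-one = trans (cong (as ++_) (sym (ones-snoc r))) (trans (sym (++-assoc as (ones r) [ 1 ])) (cong (_++ [ 1 ]) e))
-- There are at least two blocks in total, so some block remains besides `a`.
... | [] | _ = contradiction (trans (sym eq) (cong suc empty)) λ ()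
  where
  empty : length as + r ≡ 0
  empty = trans (cong (length as +_) (sym (length-replicate r))) (trans (sym (length-++ as)) (cong length e))

span : ∀ q as → length as ≡ suc q + suc q → Span (sides as)
span q as eq = subst (Span ∘ sides) (++-identityʳ as)
  (span-sides as 0 (trans (+-identityʳ _) (trans eq (cong suc (+-suc q q))))
    (subst Span (sym (sides-ones (suc (q + q)))) (span-diffs q)))

-- Geometry of binary trees: edges, crossings, triangles

frontierᵇ : Bin → List Side
frontierᵇ (leaf s)   = [ s ]
frontierᵇ (node a b) = frontierᵇ a ++ frontierᵇ b

-- A tree rooted at the edge from point i spans the interval from i to right t i.
right : Bin → ℕ → ℕ
right (leaf _)   i = suc i
right (node a b) i = right b (right a i)

data Edge : Bin → ℕ → ℕ → ℕ → Set where
  base : ∀ {t i} → Edge t i i (right t i)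
  inˡ  : ∀ {a b i x y} → Edge a i x y → Edge (node a b) i x y
  inʳ  : ∀ {a b i x y} → Edge b (right a i) x y → Edge (node a b) i x y

<right : ∀ t i → i < right t i
<right (leaf _)   i = ≤-refl
<right (node a b) i = <-trans (<right a i) (<right b _)

edge-≥ : ∀ {t i x y} → Edge t i x y → i ≤ x
edge-≥ base            = ≤-refl
edge-≥ (inˡ e)         = edge-≥ e
edge-≥ (inʳ {a = a} e) = ≤-trans (<⇒≤ (<right a _)) (edge-≥ e)

edge-< : ∀ {t i x y} → Edge t i x y → x < y
edge-< {t} base = <right t _
edge-< (inˡ e)  = edge-< e
edge-< (inʳ e)  = edge-< e

edge-≤ : ∀ {t i x y} → Edge t i x y → y ≤ right t i
edge-≤ base            = ≤-refl
edge-≤ (inˡ {b = b} e) = ≤-trans (edge-≤ e) (<⇒≤ (<right b _))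
edge-≤ (inʳ e)         = edge-≤ e

crosses-sym : ∀ {x y k l} → Crosses x y k l → Crosses k l x y
crosses-sym (inj₁ c) = inj₂ c
crosses-sym (inj₂ c) = inj₁ c

base-not-crossed : ∀ {t i k l} → Edge t i k l → ¬ Crosses i (right t i) k l
base-not-crossed e (inj₁ (_ , _ , j<l)) = <⇒≱ j<l (edge-≤ e)
base-not-crossed e (inj₂ (k<i , _))     = <⇒≱ k<i (edge-≥ e)

apart-not-crossed : ∀ {x y k l} → y ≤ k → x < y → ¬ Crosses x y k l
apart-not-crossed y≤k x<y (inj₁ (_ , k<y , _)) = <⇒≱ k<y y≤k
apart-not-crossed y≤k x<y (inj₂ (k<x , _))     = <⇒≱ (<-trans k<x x<y) y≤k

edges-not-crossing : ∀ {t i x y k l} → Edge t i x y → Edge t i k l → ¬ Crosses x y k l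
edges-not-crossing base    e       = base-not-crossed e
edges-not-crossing {t} (inˡ e) base = base-not-crossed {t} (inˡ e) ∘ crosses-sym
edges-not-crossing {t} (inʳ e) base = base-not-crossed {t} (inʳ e) ∘ crosses-sym
edges-not-crossing (inˡ d) (inˡ e) = edges-not-crossing d e
edges-not-crossing (inʳ d) (inʳ e) = edges-not-crossing d e
edges-not-crossing (inˡ d) (inʳ e) = apart-not-crossed (≤-trans (edge-≤ d) (edge-≥ e)) (edge-< d)
edges-not-crossing (inʳ d) (inˡ e) =
  apart-not-crossed (≤-trans (edge-≤ e) (edge-≥ d)) (edge-< e) ∘ crosses-sym

-- A chord on one side of the apex is handled in a subtree. A chord passing over the apex is the
-- root edge or is crossed by an edge from the apex to an end of the root.
edges-maximal : ∀ t {i x y} → i ≤ x → x < y → y ≤ right t i →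
  Edge t i x y ⊎ ∃₂ λ k l → Edge t i k l × Crosses x y k l
edges-maximal (leaf s) {i} i≤x x<y y≤ with refl ← ≤-antisym i≤x (s≤s⁻¹ (≤-trans x<y y≤))
  with refl ← ≤-antisym x<y y≤ = inj₁ base
edges-maximal (node a b) {i} {x} {y} i≤x x<y y≤ with y ≤? right a i | right a i ≤? x
... | yes y≤m | _ = Sum.map inˡ (λ (k , l , e , c) → k , l , inˡ e , c) (edges-maximal a i≤x x<y y≤m)
... | no _ | yes m≤x = Sum.map inʳ (λ (k , l , e , c) → k , l , inʳ e , c) (edges-maximal b m≤x x<y y≤)
... | no y≰m | no m≰x with i ≟ x | y ≟ right b (right a i)
...   | yes refl | yes refl = inj₁ base
...   | yes refl | no y≢ = inj₂ (_ , _ , inʳ base , inj₁ (≰⇒> m≰x , ≰⇒> y≰m , ≤∧≢⇒< y≤ y≢))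
...   | no i≢x | _ = inj₂ (_ , _ , inˡ base , inj₂ (≤∧≢⇒< i≤x i≢x , ≰⇒> m≰x , ≰⇒> y≰m))

edge-side : ∀ t {i p} → i ≤ p → p < right t i → Edge t i p (suc p)
edge-side (leaf _) i≤p p< with refl ← ≤-antisym i≤p (s≤s⁻¹ p<) = base
edge-side (node a b) {i} {p} i≤p p< with suc p ≤? right a i
... | yes p<m = inˡ (edge-side a i≤p p<m)
... | no p≮m  = inʳ (edge-side b (s≤s⁻¹ (≰⇒> p≮m)) p<)

edge-restrictˡ : ∀ {a b i x y} → Edge (node a b) i x y → y ≤ right a i → Edge a i x y
edge-restrictˡ {a} {b} {i} base j≤m = contradiction j≤m (<⇒≱ (<right b _))
edge-restrictˡ (inˡ e) _   = e
edge-restrictˡ (inʳ e) y≤m = contradiction (≤-trans (edge-< e) (≤-trans y≤m (edge-≥ e))) (<-irrefl refl)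

edge-restrictʳ : ∀ {a b i x y} → Edge (node a b) i x y → right a i ≤ x → Edge b (right a i) x y
edge-restrictʳ {a} base m≤i = contradiction m≤i (<⇒≱ (<right a _))
edge-restrictʳ (inˡ e) m≤x = contradiction (≤-trans (edge-< e) (≤-trans (edge-≤ e) m≤x)) (<-irrefl refl)
edge-restrictʳ (inʳ e) _   = e

Monochromatic : (ℕ → Bool) → ℕ → ℕ → ℕ → Set
Monochromatic c x y z = c x ≡ c y × c y ≡ c z

ColorfulTree : (ℕ → Bool) → Bin → ℕ → Set
ColorfulTree c (leaf _)   i = ⊤
ColorfulTree c (node a b) i =
  ¬ Monochromatic c i (right a i) (right b (right a i)) × ColorfulTree c a i × ColorfulTree c b (right a i)

-- The longest edge determines the triangle: beneath it only the apex of its node is joined to both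
-- ends.
colorful-triangle : ∀ {c} t {i x y z} → ColorfulTree c t i →
  Edge t i x y → Edge t i y z → Edge t i x z → ¬ Monochromatic c x y z
colorful-triangle (leaf _) _ e e' base =
  contradiction (edge-< e') (≤⇒≯ (edge-< e))
colorful-triangle {c} (node a b) (mono , _ , _) e e' base m =
  mono (subst (λ y → Monochromatic c _ y _) (≤-antisym (below e e') (above e e')) m)
  where
  below : ∀ {i y} → Edge (node a b) i i y → Edge (node a b) i y (right b (right a i)) → y ≤ right a i
  below base    e' = contradiction (edge-< e') (<-irrefl refl)
  below (inˡ e) _  = edge-≤ e
  below {i} (inʳ e) _  = contradiction (edge-≥ e) (<⇒≱ (<right a i))
  above : ∀ {i y} → Edge (node a b) i i y → Edge (node a b) i y (right b (right a i)) → right a i ≤ y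
  above e base     = contradiction (edge-< e) (<-irrefl refl)
  above {i} _ (inˡ e') = contradiction (edge-≤ e') (<⇒≱ (<right b (right a i)))
  above _ (inʳ e') = edge-≥ e'
colorful-triangle (node a b) (_ , ca , _) e e' (inˡ e'') =
  colorful-triangle a ca
    (edge-restrictˡ e (≤-trans (<⇒≤ (edge-< e')) (edge-≤ e''))) (edge-restrictˡ e' (edge-≤ e'')) e''
colorful-triangle (node a b) (_ , _ , cb) e e' (inʳ e'') =
  colorful-triangle b cb
    (edge-restrictʳ e (edge-≥ e'')) (edge-restrictʳ e' (≤-trans (edge-≥ e'') (<⇒≤ (edge-< e)))) e''

advance : List Side → ℕ → ℕ
advance []      i = i
advance (_ ∷ w) i = advance w (suc i)

advance-++ : ∀ u v i → advance (u ++ v) i ≡ advance v (advance u i)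
advance-++ []      v i = refl
advance-++ (_ ∷ u) v i = advance-++ u v (suc i)

advance-length : ∀ w i → advance w i ≡ length w + i
advance-length []      i = refl
advance-length (_ ∷ w) i = trans (advance-length w (suc i)) (+-suc (length w) i)

right-advance : ∀ t i → right t i ≡ advance (frontierᵇ t) i
right-advance (leaf _)   i = refl
right-advance (node a b) i =
  trans (right-advance b _) (trans (cong (advance (frontierᵇ b)) (right-advance a i))
    (sym (advance-++ (frontierᵇ a) (frontierᵇ b) i)))

++-split : ∀ (u u' : List Side) {v v'} → length u ≡ length u' → u ++ v ≡ u' ++ v' → u ≡ u' × v ≡ v'
++-split []      []        _ eq = refl , eq
++-split (x ∷ u) (x' ∷ u') l eq with refl , eq' ← ∷-injective eq
  with refl , q ← ++-split u u' (suc-injective l) eq' = refl , q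

-- Were the apexes different, an edge at the apex of `t`, also present in `t'`, would cross an edge
-- at the apex of `t'`.
tree-injective : ∀ t t' i → frontierᵇ t ≡ frontierᵇ t' → (∀ {x y} → Edge t i x y → Edge t' i x y) → t ≡ t'
tree-injective (leaf s) (leaf .s) i refl _ = refl
tree-injective (leaf s) (node a b) i fr _ =
  contradiction (≤-trans (s≤s (<right a i)) (<right b (right a i)))
    (<-irrefl (trans (cong (λ w → advance w i) fr) (sym (right-advance (node a b) i))))
tree-injective (node a b) (leaf s) i fr _ =
  contradiction (≤-trans (s≤s (<right a i)) (<right b (right a i)))
    (<-irrefl (trans (cong (λ w → advance w i) (sym fr)) (sym (right-advance (node a b) i))))
tree-injective t@(node a b) t'@(node a' b') i fr ⊆ =
  cong₂ node (tree-injective a a' i (proj₁ split) ⊆ˡ) (tree-injective b b' (right a i) (proj₂ split) ⊆ʳ)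
  where
  right≡ : right t i ≡ right t' i
  right≡ = trans (right-advance t i) (trans (cong (λ w → advance w i) fr) (sym (right-advance t' i)))
  apex : right a i ≡ right a' i
  apex with <-cmp (right a i) (right a' i)
  ... | tri≈ _ eq _ = eq
  ... | tri< m<m' _ _ = contradiction
    (inj₁ (<right a i , m<m' , subst (right a' i <_) (sym right≡) (<right b' (right a' i))))
    (edges-not-crossing {t'} (inˡ base) (⊆ (inʳ base)))
  ... | tri> _ _ m'<m = contradiction
    (inj₁ (<right a' i , m'<m , subst (right a i <_) right≡ (<right b (right a i))))
    (edges-not-crossing {t'} (⊆ (inˡ base)) (inʳ base))
  lengths : length (frontierᵇ a) ≡ length (frontierᵇ a')
  lengths = +-cancelʳ-≡ i _ _ (trans (sym (advance-length (frontierᵇ a) i))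
    (trans (sym (right-advance a i)) (trans apex (trans (right-advance a' i) (advance-length (frontierᵇ a') i)))))
  split = ++-split (frontierᵇ a) (frontierᵇ a') lengths fr
  ⊆ˡ : ∀ {x y} → Edge a i x y → Edge a' i x y
  ⊆ˡ e = edge-restrictˡ (⊆ (inˡ e)) (subst (_ ≤_) apex (edge-≤ e))
  ⊆ʳ : ∀ {x y} → Edge b (right a i) x y → Edge b' (right a i) x y
  ⊆ʳ {x} {y} e = subst (λ m → Edge b' m x y) (sym apex)
    (edge-restrictʳ (⊆ (inʳ e)) (subst (_≤ x) apex (edge-≥ e)))

-- A flip in terms of edges. `same-right` ensures that a rotation in a left subtree does not shift
-- the positions in the right one.
record Exchange (t t' : Bin) (i : ℕ) : Set where
  field
    {x y x' y'} : ℕ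
    old     : Edge t i x y
    new     : Edge t' i x' y'
    cross   : Crosses x y x' y'
    same-right : right t i ≡ right t' i
    kept    : ∀ {k l} → Edge t i k l → Edge t' i k l ⊎ (k ≡ x × l ≡ y)
    kept′   : ∀ {k l} → Edge t' i k l → Edge t i k l ⊎ (k ≡ x' × l ≡ y')

open Exchange hiding (x; y; x'; y')

rot-exchange : ∀ {t t'} → Rot t t' → ∀ i → Exchange t t' i
rot-exchange (rot {a} {b} {c}) i = record
  { old = inˡ base ; new = inʳ base
  ; cross = inj₁ (<right a i , <right b _ , <right c _)
  ; same-right = refl
  ; kept = λ { base → inj₁ base ; (inˡ base) → inj₂ (refl , refl) ; (inˡ (inˡ e)) → inj₁ (inˡ e)
             ; (inˡ (inʳ e)) → inj₁ (inʳ (inˡ e)) ; (inʳ e) → inj₁ (inʳ (inʳ e)) }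
  ; kept′ = λ { base → inj₁ base ; (inʳ base) → inj₂ (refl , refl) ; (inˡ e) → inj₁ (inˡ (inˡ e))
             ; (inʳ (inˡ e)) → inj₁ (inˡ (inʳ e)) ; (inʳ (inʳ e)) → inj₁ (inʳ e) } }
rot-exchange (rotˡ {a} {a'} {b} r) i = record
  { old = inˡ (old ex) ; new = inˡ (new ex) ; cross = cross ex
  ; same-right = cong (right b) (same-right ex)
  ; kept = keep ; kept′ = keep′ }
  where
  ex = rot-exchange r i
  keep : ∀ {k l} → Edge (node a b) i k l → _
  keep {k} {l} base = inj₁ (subst (Edge (node a' b) i i) (sym (cong (right b) (same-right ex))) base)
  keep (inˡ e) = Sum.map₁ inˡ (kept ex e)
  keep {k} {l} (inʳ e) = inj₁ (inʳ (subst (λ m → Edge b m k l) (same-right ex) e))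
  keep′ : ∀ {k l} → Edge (node a' b) i k l → _
  keep′ base = inj₁ (subst (Edge (node a b) i i) (cong (right b) (same-right ex)) base)
  keep′ (inˡ e) = Sum.map₁ inˡ (kept′ ex e)
  keep′ {k} {l} (inʳ e) = inj₁ (inʳ (subst (λ m → Edge b m k l) (sym (same-right ex)) e))
rot-exchange (rotʳ {a} {b} {b'} r) i = record
  { old = inʳ (old ex) ; new = inʳ (new ex) ; cross = cross ex ; same-right = same-right ex
  ; kept = keep ; kept′ = keep′ }
  where
  ex = rot-exchange r (right a i)
  keep : ∀ {k l} → Edge (node a b) i k l → _
  keep base = inj₁ (subst (Edge (node a b') i i) (sym (same-right ex)) base)
  keep (inˡ e) = inj₁ (inˡ e)
  keep (inʳ e) = Sum.map₁ inʳ (kept ex e)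
  keep′ : ∀ {k l} → Edge (node a b') i k l → _
  keep′ base = inj₁ (subst (Edge (node a b) i i) (same-right ex) base)
  keep′ (inˡ e) = inj₁ (inˡ e)
  keep′ (inʳ e) = Sum.map₁ inʳ (kept′ ex e)

edge? : ∀ t i x y → Dec (Edge t i x y)
edge? t i x y with i ≟ x | right t i ≟ y
... | yes refl | yes refl = yes base
edge? (leaf s) i x y | no i≢x | _ = no λ { base → i≢x refl }
edge? (leaf s) i x y | yes _ | no j≢y = no λ { base → j≢y refl }
edge? (node a b) i x y | no i≢x | _ = map′ Sum.[ inˡ , inʳ ]
  (λ { base → contradiction refl i≢x ; (inˡ e) → inj₁ e ; (inʳ e) → inj₂ e })
  (edge? a i x y ⊎-dec edge? b (right a i) x y)
edge? (node a b) i x y | yes _ | no j≢y = map′ Sum.[ inˡ , inʳ ]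
  (λ { base → contradiction refl j≢y ; (inˡ e) → inj₁ e ; (inʳ e) → inj₂ e })
  (edge? a i x y ⊎-dec edge? b (right a i) x y)

side? : ∀ N i j → Dec (IsSide N i j)
side? N i j = (j ≟ suc i) ⊎-dec ((i ≟ 0) ×-dec (suc j ≟ N))

side-not-crossed : ∀ {N x y k l} → IsSide N k l → y < N → ¬ Crosses x y k l
side-not-crossed (inj₁ refl) y<N (inj₁ (_ , k<y , y<l)) = <⇒≱ k<y (s≤s⁻¹ y<l)
side-not-crossed (inj₁ refl) y<N (inj₂ (k<x , x<l , _)) = <⇒≱ k<x (s≤s⁻¹ x<l)
side-not-crossed (inj₂ (refl , refl)) y<N (inj₂ (_ , _ , l<y)) = <⇒≱ l<y (s≤s⁻¹ y<N)

-- Binary trees as sets of diagonals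

module Encoding (N : ℕ) where

  Diagonal : Bin → ℕ → ℕ → Set
  Diagonal t x y = Edge t 0 x y × ¬ IsSide N x y

  diagonal? : ∀ t x y → Dec (Diagonal t x y)
  diagonal? t x y = edge? t 0 x y ×-dec ¬? (side? N x y)

  encode : Bin → DiagSet N
  encode t = tabulate λ i → tabulate λ j → does (diagonal? t (toℕ i) (toℕ j))

  encode-∋ : ∀ t i j → encode t ∋[ i , j ] ≡ does (diagonal? t (toℕ i) (toℕ j))
  encode-∋ t i j = trans (cong (λ v → lookup v j) (lookup∘tabulate _ i)) (lookup∘tabulate _ j)

  ∋⇒diagonal : ∀ t i j → encode t ∋[ i , j ] ≡ true → Diagonal t (toℕ i) (toℕ j)
  ∋⇒diagonal t i j e = decidable-stable (diagonal? t (toℕ i) (toℕ j)) λ nd →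
    contradiction (trans (sym e) (trans (encode-∋ t i j) (dec-false (diagonal? t _ _) nd))) λ ()

  diagonal⇒∋ : ∀ t i j → Diagonal t (toℕ i) (toℕ j) → encode t ∋[ i , j ] ≡ true
  diagonal⇒∋ t i j d = trans (encode-∋ t i j) (dec-true (diagonal? t _ _) d)

  ¬diagonal⇒∌ : ∀ t i j → ¬ Diagonal t (toℕ i) (toℕ j) → encode t ∋[ i , j ] ≡ false
  ¬diagonal⇒∌ t i j d = trans (encode-∋ t i j) (dec-false (diagonal? t _ _) d)

  encode-exchange : ∀ {t t'} → N ≡ suc (right t 0) → Exchange t t' 0 → Flip (encode t) (encode t')
  encode-exchange {t} {t'} refl e =
    at x<N , at y<N , at x'<N , at y'<N ,
    diagonal⇒∋ t _ _ (at-diagonal (Diagonal t) x<N y<N (old e , x-diag)) ,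
    ¬diagonal⇒∌ t' _ _ (λ d → edges-not-crossing (proj₁ (un-at (Diagonal t') x<N y<N d)) (new e) (cross e)) ,
    ¬diagonal⇒∌ t _ _ (λ d → edges-not-crossing (old e) (proj₁ (un-at (Diagonal t) x'<N y'<N d)) (cross e)) ,
    diagonal⇒∋ t' _ _ (at-diagonal (Diagonal t') x'<N y'<N (new e , x'-diag)) ,
    only
    where
    at : ∀ {n} → n < N → Fin N
    at p = fromℕ< p
    y<N : Exchange.y e < N
    y<N = s≤s (edge-≤ (old e))
    x<N = <-trans (edge-< (old e)) y<N
    y'<N : Exchange.y' e < N
    y'<N = s≤s (≤-trans (edge-≤ (new e)) (≤-reflexive (sym (same-right e))))
    x'<N = <-trans (edge-< (new e)) y'<N
    at-diagonal : ∀ (P : ℕ → ℕ → Set) {k l} (k<N : k < N) (l<N : l < N) → P k l → P (toℕ (at k<N)) (toℕ (at l<N))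
    at-diagonal P p q = subst₂ P (sym (toℕ-fromℕ< p)) (sym (toℕ-fromℕ< q))
    un-at : ∀ (P : ℕ → ℕ → Set) {k l} (k<N : k < N) (l<N : l < N) → P (toℕ (at k<N)) (toℕ (at l<N)) → P k l
    un-at P p q = subst₂ P (toℕ-fromℕ< p) (toℕ-fromℕ< q)
    -- The exchanged edges cross each other, and a side is never crossed; so both are diagonals.
    x-diag : ¬ IsSide N (Exchange.x e) (Exchange.y e)
    x-diag s = side-not-crossed s y'<N (crosses-sym (cross e))
    x'-diag : ¬ IsSide N (Exchange.x' e) (Exchange.y' e)
    x'-diag s = side-not-crossed s y<N (cross e)
    fin≡ : ∀ {k l : ℕ} {i j} (k<N : k < N) (l<N : l < N) → toℕ i ≡ k × toℕ j ≡ l → i ≡ at k<N × j ≡ at l<N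
    fin≡ p q (refl , refl) = toℕ-injective (sym (toℕ-fromℕ< p)) , toℕ-injective (sym (toℕ-fromℕ< q))
    only : ∀ i j → encode t ∋[ i , j ] ≢ encode t' ∋[ i , j ] →
      (i ≡ at x<N × j ≡ at y<N) ⊎ (i ≡ at x'<N × j ≡ at y'<N)
    only i j ne with diagonal? t (toℕ i) (toℕ j) | diagonal? t' (toℕ i) (toℕ j)
    ... | yes d | yes d' = contradiction (trans (diagonal⇒∋ t i j d) (sym (diagonal⇒∋ t' i j d'))) ne
    ... | no d  | no d'  = contradiction (trans (¬diagonal⇒∌ t i j d) (sym (¬diagonal⇒∌ t' i j d'))) ne
    ... | yes (d , nd) | no d' with kept e d
    ...   | inj₁ d'' = contradiction (d'' , nd) d'
    ...   | inj₂ eq  = inj₁ (fin≡ x<N y<N eq)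
    only i j ne | no d | yes (d' , nd) with kept′ e d'
    ...   | inj₁ d'' = contradiction (d'' , nd) d
    ...   | inj₂ eq  = inj₂ (fin≡ x'<N y'<N eq)

  -- Sides are not recorded in the matrix, but every tree of this size contains all of them.
  encode-injective : ∀ {t t'} → N ≡ suc (right t 0) → frontierᵇ t ≡ frontierᵇ t' → encode t ≡ encode t' → t ≡ t'
  encode-injective {t} {t'} refl fr eq = tree-injective t t' 0 fr ⊆
    where
    right≡ : right t 0 ≡ right t' 0
    right≡ = trans (right-advance t 0) (trans (cong (λ w → advance w 0) fr) (sym (right-advance t' 0)))
    ⊆ : ∀ {x y} → Edge t 0 x y → Edge t' 0 x y
    ⊆ {x} {y} e with side? N x y
    ... | yes (inj₁ refl) = edge-side t' z≤n (subst (x <_) right≡ (edge-≤ e))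
    ... | yes (inj₂ (refl , y≡)) = subst (Edge t' 0 0) (trans (sym right≡) (suc-injective (sym y≡))) base
    ... | no ns = subst₂ (Edge t' 0) (toℕ-fromℕ< x<N) (toℕ-fromℕ< y<N)
      (proj₁ (∋⇒diagonal t' i j (trans (cong (_∋[ i , j ]) (sym eq))
        (diagonal⇒∋ t i j (subst₂ (Diagonal t) (sym (toℕ-fromℕ< x<N)) (sym (toℕ-fromℕ< y<N)) (e , ns))))))
      where
      y<N = s≤s (edge-≤ e)
      x<N = <-trans (edge-< e) y<N
      i = fromℕ< x<N
      j = fromℕ< y<N

  encode-triangulation : ∀ t → N ≡ suc (right t 0) → IsTriangulation (encode t)
  encode-triangulation t refl = record
    { onlyDiags = λ i j e → let d , nd = ∋⇒diagonal t i j e in edge-< d , nd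
    ; nonCross = λ i j k l e e' →
        edges-not-crossing (proj₁ (∋⇒diagonal t i j e)) (proj₁ (∋⇒diagonal t k l e'))
    ; maximal = maximal }
    where
    maximal : ∀ i j → IsDiag N (toℕ i) (toℕ j) → encode t ∋[ i , j ] ≡ false →
      ∃ λ k → ∃ λ l → encode t ∋[ k , l ] ≡ true × Crosses (toℕ i) (toℕ j) (toℕ k) (toℕ l)
    maximal i j (i<j , ns) e with edges-maximal t z≤n i<j (s≤s⁻¹ (toℕ<n j))
    ... | inj₁ d with () ← trans (sym e) (diagonal⇒∋ t i j (d , ns))
    ... | inj₂ (k , l , d , cr) = fromℕ< k<N , fromℕ< l<N ,
      diagonal⇒∋ t _ _ (subst₂ (Diagonal t) (sym k≡) (sym l≡) (d , λ s → side-not-crossed s (toℕ<n j) cr)) ,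
      subst₂ (Crosses (toℕ i) (toℕ j)) (sym k≡) (sym l≡) cr
      where
      l<N = s≤s (edge-≤ d)
      k<N = <-trans (edge-< d) l<N
      k≡ = toℕ-fromℕ< k<N
      l≡ = toℕ-fromℕ< l<N

  encode-colorful : ∀ c t → N ≡ suc (right t 0) → ColorfulTree c t 0 →
    ∀ i j k → IsTriangle (encode t) i j k → ¬ Monochromatic c (toℕ i) (toℕ j) (toℕ k)
  encode-colorful c t refl col i j k (_ , _ , e , e' , e'') =
    colorful-triangle t col (edge i j e) (edge j k e') (edge i k e'')
    where
    edge : ∀ i j → IsEdge (encode t) i j → Edge t 0 (toℕ i) (toℕ j)
    edge i j (inj₂ d) = proj₁ (∋⇒diagonal t i j d)
    edge i j (inj₁ (inj₁ eq)) = subst (Edge t 0 (toℕ i)) (sym eq)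
      (edge-side t z≤n (s≤s⁻¹ (subst (_< N) eq (toℕ<n j))))
    edge i j (inj₁ (inj₂ (eq , eq'))) = subst₂ (Edge t 0) (sym eq) (suc-injective (sym eq')) base

-- Colours: decorated dissections are the colorful triangulations

step-color : Side → Bool → Bool
step-color same b = b
step-color diff b = not b

Follows : (ℕ → Bool) → ℕ → List Side → Set
Follows c i []      = ⊤
Follows c i (s ∷ w) = c (suc i) ≡ step-color s (c i) × Follows c (suc i) w

follows-++⁻ : ∀ {c i} u {v} → Follows c i (u ++ v) → Follows c i u × Follows c (advance u i) v
follows-++⁻ []      f       = tt , f
follows-++⁻ (_ ∷ u) (e , f) = let f' , f'' = follows-++⁻ u f in (e , f') , f''

follows-++⁺ : ∀ {c i} u {v} → Follows c i u → Follows c (advance u i) v → Follows c i (u ++ v)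
follows-++⁺ []      _       g = g
follows-++⁺ (_ ∷ u) (e , f) g = e , follows-++⁺ u f g

step-color-injective : ∀ s s' {b} → step-color s b ≡ step-color s' b → s ≡ s'
step-color-injective same same e = refl
step-color-injective same diff e = contradiction e (not-¬ refl)
step-color-injective diff same e = contradiction (sym e) (not-¬ refl)
step-color-injective diff diff e = refl

follows-injective : ∀ {c i} u v → length u ≡ length v → Follows c i u → Follows c i v → u ≡ v
follows-injective []      []      _ _ _ = refl
follows-injective (s ∷ u) (s' ∷ v) l (e , f) (e' , f') =
  cong₂ _∷_ (step-color-injective s s' (trans (sym e) e')) (follows-injective u v (suc-injective l) f f')

bin-frontier : ∀ {T} (x : Bits T) → frontierᵇ (bin x) ≡ frontier T
bin-frontier •ᵇ = refl
bin-frontier (Lᵇ x) = cong (same ∷_) (bin-frontier x)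
bin-frontier (Rᵇ x) = cong (_++ [ same ]) (bin-frontier x)
bin-frontier (Qᵇ false a b c) = trans (++-assoc (frontierᵇ (bin a)) _ _)
  (cong₂ _++_ (bin-frontier a) (cong₂ _++_ (bin-frontier b) (bin-frontier c)))
bin-frontier (Qᵇ true a b c) =
  cong₂ _++_ (bin-frontier a) (cong₂ _++_ (bin-frontier b) (bin-frontier c))

two-steps : ∀ {b b' b'' : Bool} → b' ≡ not b → b'' ≡ not b' → b'' ≡ b
two-steps p q = trans q (trans (cong not p) (not-involutive _))

follows-node : ∀ {c i} a b → Follows c i (frontierᵇ (node a b)) →
  Follows c i (frontierᵇ a) × Follows c (right a i) (frontierᵇ b)
follows-node {c} {i} a b f with f' , f'' ← follows-++⁻ (frontierᵇ a) f =
  f' , subst (λ m → Follows c m (frontierᵇ b)) (sym (right-advance a i)) f''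

-- A triangle has one bichromatic edge besides its root edge, a quadrilateral has three; the number
-- of colour changes is odd.
opposite : ∀ {T c i} (x : Bits T) → Follows c i (frontierᵇ (bin x)) → c (right (bin x) i) ≡ not (c i)
opposite •ᵇ (e , _) = e
opposite (Lᵇ x) (e , f) = trans (opposite x f) (cong not e)
opposite {i = i} (Rᵇ x) f with f' , (e , _) ← follows-node (bin x) (leaf same) f =
  trans e (opposite x f')
opposite (Qᵇ false a b c) f
  with fab , fc ← follows-node (node (bin a) (bin b)) (bin c) f
  with fa , fb ← follows-node (bin a) (bin b) fab =
  trans (opposite c fc) (cong not (two-steps (opposite a fa) (opposite b fb)))
opposite (Qᵇ true a b c) f
  with fa , fbc ← follows-node (bin a) (node (bin b) (bin c)) f
  with fb , fc ← follows-node (bin b) (bin c) fbc =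
  trans (opposite c fc) (cong not (two-steps (opposite a fa) (opposite b fb)))

bin-colorful : ∀ {T c i} (x : Bits T) → Follows c i (frontierᵇ (bin x)) → ColorfulTree c (bin x) i
bin-colorful •ᵇ f = tt
bin-colorful (Lᵇ x) (_ , f) =
  (λ (_ , q) → not-¬ refl (trans q (opposite x f))) , tt , bin-colorful x f
bin-colorful (Rᵇ x) f with f' , (e , _) ← follows-node (bin x) (leaf same) f =
  (λ (p , _) → not-¬ refl (trans p (opposite x f'))) , bin-colorful x f' , tt
bin-colorful (Qᵇ false a b c) f
  with fab , fc ← follows-node (node (bin a) (bin b)) (bin c) f
  with fa , fb ← follows-node (bin a) (bin b) fab =
  (λ (_ , q) → not-¬ refl (trans q (opposite c fc))) ,
  ((λ (p , _) → not-¬ refl (trans p (opposite a fa))) , bin-colorful a fa , bin-colorful b fb) ,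
  bin-colorful c fc
bin-colorful (Qᵇ true a b c) f
  with fa , fbc ← follows-node (bin a) (node (bin b) (bin c)) f
  with fb , fc ← follows-node (bin b) (bin c) fbc =
  (λ (p , _) → not-¬ refl (trans p (opposite a fa))) ,
  bin-colorful a fa ,
  (λ (p , _) → not-¬ refl (trans p (opposite b fb))) , bin-colorful b fb , bin-colorful c fc

third : ∀ {a b c : Bool} → a ≢ b → c ≢ b → c ≡ a
third {a} {b} {c} a≢b c≢b = trans (¬-not c≢b) (sym (¬-not a≢b))

-- The apex shares its colour with exactly one end of the root edge. The edge to that end is a
-- monochromatic side, giving `L` or `R`, or a diagonal whose second triangle completes a
-- quadrilateral.
decode : ∀ {c} t {i} → ColorfulTree c t i → Follows c i (frontierᵇ t) → c i ≢ c (right t i) →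
  ∃₂ λ T (x : Bits T) → bin x ≡ t
decode (leaf same) _ (e , _) ne = contradiction (sym e) ne
decode (leaf diff) _ _ _ = • , •ᵇ , refl
decode {c} (node a b) {i} col f ne with c (right a i) ≟ᵇ c i | follows-node a b f
decode (node (leaf diff) b) _ _ ne | yes e | (e' , _) , _ = contradiction (trans (sym e) e') (not-¬ refl)
decode {c} (node (leaf same) b) (_ , _ , cb) _ ne | yes e | _ , fb
  with T , x , refl ← decode b cb fb (λ e' → ne (trans (sym e) e')) = L T , Lᵇ x , refl
decode {c} (node (node a₁ a₂) b) {i} (_ , (m , c₁ , c₂) , cb) _ ne | yes e | fa , fb
  with f₁ , f₂ ← follows-node a₁ a₂ fa
  with A , x , refl ← decode a₁ c₁ f₁ (λ p → m (p , trans (sym p) (sym e)))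
     | B , y , refl ← decode a₂ c₂ f₂ (λ p → m (sym (trans p e) , p))
     | C , z , refl ← decode b cb fb (λ p → ne (trans (sym e) p))
  = Q A B C , Qᵇ false x y z , refl
decode {c} (node a (leaf diff)) {i} _ _ ne | no e | _ , (e' , _) =
  contradiction (trans (third (ne ∘ sym) e) e') (not-¬ refl)
decode {c} (node a (leaf same)) {i} (_ , ca , _) _ ne | no e | fa , _
  with T , x , refl ← decode a ca fa (e ∘ sym) = R T , Rᵇ x , refl
decode {c} (node a (node b₁ b₂)) {i} (_ , ca , (m , c₁ , c₂)) _ ne | no e | fa , fb
  with m≡j ← third (ne ∘ sym) e | f₁ , f₂ ← follows-node b₁ b₂ fb
  with A , x , refl ← decode a ca fa (e ∘ sym)
     | B , y , refl ← decode b₁ c₁ f₁ (λ p → m (p , trans (sym p) m≡j))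
     | C , z , refl ← decode b₂ c₂ f₂ (λ p → m (trans m≡j (sym p) , p))
  = Q A B C , Qᵇ true x y z , refl

node-injective : ∀ {a a' b b'} → node a b ≡ node a' b' → a ≡ a' × b ≡ b'
node-injective refl = refl , refl

bin≢leaf : ∀ {T} (x : Bits T) → bin x ≢ leaf same
bin≢leaf •ᵇ               ()
bin≢leaf (Qᵇ false _ _ _) ()
bin≢leaf (Qᵇ true _ _ _)  ()

-- Two bichromatic edges in a row restore the colour, whereas the root edge of `bin z` changes it.
-- This separates the two values of a bit.
bin≢node : ∀ {A B C c i} (x : Bits A) (y : Bits B) (z : Bits C) →
  Follows c i (frontierᵇ (bin z)) → bin z ≢ node (bin x) (bin y)
bin≢node {c = c} {i} x y z f e with f' ← subst (λ t → Follows c i (frontierᵇ t)) e f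
  with fx , fy ← follows-node (bin x) (bin y) f' =
  not-¬ refl (trans (sym (two-steps (opposite x fx) (opposite y fy)))
    (trans (cong (λ t → c (right t i)) (sym e)) (opposite z f)))

bin-injective : ∀ {S T c i} (x : Bits S) (y : Bits T) → Follows c i (frontierᵇ (bin x)) →
  bin x ≡ bin y → _≡_ {A = State} (S , x) (T , y)
bin-injective •ᵇ •ᵇ f e = refl
bin-injective •ᵇ (Qᵇ false _ _ _) f ()
bin-injective •ᵇ (Qᵇ true _ _ _) f ()
bin-injective (Lᵇ x) (Lᵇ y) (_ , f) e with refl ← bin-injective x y f (proj₂ (node-injective e)) = refl
bin-injective (Lᵇ x) (Rᵇ y) f e = contradiction (sym (proj₁ (node-injective e))) (bin≢leaf y)
bin-injective (Lᵇ x) (Qᵇ false _ _ _) f e with () ← proj₁ (node-injective e)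
bin-injective (Lᵇ x) (Qᵇ true a _ _) f e = contradiction (sym (proj₁ (node-injective e))) (bin≢leaf a)
bin-injective (Rᵇ x) (Lᵇ y) f e = contradiction (proj₁ (node-injective e)) (bin≢leaf x)
bin-injective (Rᵇ x) (Rᵇ y) f e with f' , _ ← follows-node (bin x) (leaf same) f
  with refl ← bin-injective x y f' (proj₁ (node-injective e)) = refl
bin-injective (Rᵇ x) (Qᵇ false _ _ c) f e = contradiction (sym (proj₂ (node-injective e))) (bin≢leaf c)
bin-injective (Rᵇ x) (Qᵇ true _ _ _) f e with () ← proj₂ (node-injective e)
bin-injective (Qᵇ false _ _ _) •ᵇ f ()
bin-injective (Qᵇ false _ _ _) (Lᵇ y) f e with () ← proj₁ (node-injective e)
bin-injective (Qᵇ false _ _ c) (Rᵇ y) f e = contradiction (proj₂ (node-injective e)) (bin≢leaf c)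
bin-injective (Qᵇ false a b c) (Qᵇ false a' b' c') f e
  with ab≡ , c≡ ← node-injective e with a≡ , b≡ ← node-injective ab≡
  with fab , fc ← follows-node (node (bin a) (bin b)) (bin c) f
  with fa , fb ← follows-node (bin a) (bin b) fab
  with refl ← bin-injective a a' fa a≡ | refl ← bin-injective b b' fb b≡ | refl ← bin-injective c c' fc c≡
  = refl
bin-injective {c = γ} {i} (Qᵇ false a b c) (Qᵇ true a' _ _) f e with ab≡ , _ ← node-injective e
  with fab , _ ← follows-node (node (bin a) (bin b)) (bin c) f =
  contradiction (sym ab≡) (bin≢node a b a' (subst (λ t → Follows γ i (frontierᵇ t)) ab≡ fab))
bin-injective (Qᵇ true _ _ _) •ᵇ f ()
bin-injective (Qᵇ true a _ _) (Lᵇ y) f e = contradiction (proj₁ (node-injective e)) (bin≢leaf a)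
bin-injective (Qᵇ true _ _ _) (Rᵇ y) f e with () ← proj₂ (node-injective e)
bin-injective (Qᵇ true a b c) (Qᵇ false a' b' c') f e with ab≡ , _ ← node-injective e
  with fa , _ ← follows-node (bin a) (node (bin b) (bin c)) f = contradiction ab≡ (bin≢node a' b' a fa)
bin-injective (Qᵇ true a b c) (Qᵇ true a' b' c') f e
  with a≡ , bc≡ ← node-injective e with b≡ , c≡ ← node-injective bc≡
  with fa , fbc ← follows-node (bin a) (node (bin b) (bin c)) f
  with fb , fc ← follows-node (bin b) (bin c) fbc
  with refl ← bin-injective a a' fa a≡ | refl ← bin-injective b b' fb b≡ | refl ← bin-injective c c' fc c≡
  = refl

sides-suc : ∀ a as → sides (suc (suc a) ∷ as) ≡ same ∷ sides (suc a ∷ as)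
sides-suc a []      = refl
sides-suc a (_ ∷ _) = refl

sides-length : ∀ a as → All (1 ≤_) (a ∷ as) → suc (length (sides (a ∷ as))) ≡ sum (a ∷ as)
sides-length zero          _        (() ∷ _)
sides-length (suc zero)    []       _        = refl
sides-length (suc zero)    (b ∷ bs) (_ ∷ ps) = cong suc (sides-length b bs ps)
sides-length (suc (suc a)) as       (_ ∷ ps) =
  cong suc (trans (cong length (sides-suc a as)) (sides-length (suc a) as (s≤s z≤n ∷ ps)))

follows-sides : ∀ c i b a as → All (1 ≤_) (a ∷ as) →
  (∀ p → c (p + i) ≡ colorAux b (a ∷ as) p) → Follows c i (sides (a ∷ as))
follows-sides c i b zero _ (() ∷ _) h
follows-sides c i b (suc zero) (zero ∷ _) (_ ∷ () ∷ _) h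
follows-sides c i b (suc zero) [] _ h = tt
follows-sides c i b (suc zero) (suc a ∷ as) (_ ∷ ps) h =
  trans (h 1) (cong not (sym (h 0))) ,
  follows-sides c (suc i) (not b) (suc a) as ps (λ p → trans (cong c (+-suc p i)) (h (suc p)))
follows-sides c i b (suc (suc a)) as (_ ∷ ps) h = subst (Follows c i) (sym (sides-suc a as))
  (trans (h 1) (sym (h 0)) ,
   follows-sides c (suc i) b (suc a) as (s≤s z≤n ∷ ps) (λ p → trans (cong c (+-suc p i)) (h (suc p))))

-- Every triangulation comes from a binary tree

module Parsing {N : ℕ} (D : DiagSet N) (tri : IsTriangulation D) where

  open IsTriangulation tri
  open Encoding N

  InD : ℕ → ℕ → Set
  InD x y = ∃₂ λ i j → toℕ i ≡ x × toℕ j ≡ y × D ∋[ i , j ] ≡ true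

  Chord : ℕ → ℕ → Set
  Chord x y = IsSide N x y ⊎ InD x y

  chord? : ∀ x y → Dec (Chord x y)
  chord? x y = side? N x y ⊎-dec
    Fin.any? λ i → Fin.any? λ j → toℕ i ≟ x ×-dec toℕ j ≟ y ×-dec (D ∋[ i , j ] ≟ᵇ true)

  chords-not-crossing : ∀ {x y k l} → y < N → l < N → Chord x y → Chord k l → ¬ Crosses x y k l
  chords-not-crossing y<N l<N s (inj₁ s') = side-not-crossed s' y<N
  chords-not-crossing y<N l<N (inj₁ s) t = side-not-crossed s l<N ∘ crosses-sym
  chords-not-crossing _ _ (inj₂ (i , j , refl , refl , e)) (inj₂ (k , l , refl , refl , e')) = nonCross i j k l e e'

  as-fin : ∀ {x} → x < N → ∃ λ (i : Fin N) → toℕ i ≡ x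
  as-fin x<N = fromℕ< x<N , toℕ-fromℕ< x<N

  chord-maximal : ∀ {x y} → x < y → y < N → ¬ Chord x y →
    ∃₂ λ k l → Chord k l × l < N × Crosses x y k l
  chord-maximal x<y y<N nc
    with i , refl ← as-fin (<-trans x<y y<N) | j , refl ← as-fin y<N
    with k , l , e , cr ← maximal i j (x<y , nc ∘ inj₁) (¬-not λ e → nc (inj₂ (i , j , refl , refl , e)))
    = toℕ k , toℕ l , inj₂ (k , l , refl , refl , e) , toℕ<n l , cr

  -- A downward search, which stops at the side from `x` to `suc x` at the latest.
  last-chord : ∀ x n → x < n → ∃ λ m → x < m × m ≤ n × Chord x m × (∀ {l} → m < l → l ≤ n → ¬ Chord x l)
  last-chord x (suc n) x≤n with chord? x (suc n)
  ... | yes e = suc n , x≤n , ≤-refl , e , λ n<l l≤n → contradiction l≤n (<⇒≱ n<l)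
  ... | no ne with x <? n
  ...   | no x≮n = contradiction (inj₁ (inj₁ (cong suc (≤-antisym (≮⇒≥ x≮n) (s≤s⁻¹ x≤n))))) ne
  ...   | yes x<n with m , x<m , m≤n , e , none ← last-chord x n x<n =
    m , x<m , m≤n⇒m≤1+n m≤n , e , none'
    where
    none' : ∀ {l} → m < l → l ≤ suc n → ¬ Chord x l
    none' m<l l≤ with m≤n⇒m<n∨m≡n l≤
    ... | inj₁ l<  = none m<l (s≤s⁻¹ l<)
    ... | inj₂ refl = ne

  -- The apex is the furthest neighbour `m` of `x` before `y`. A chord crossing the segment from `m`
  -- to `y` would cross `x y` or `x m`, or join `x` to a point between `m` and `y`.
  apex : ∀ {x y} → suc x < y → y < N → Chord x y → ∃ λ m → x < m × m < y × Chord x m × Chord m y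
  apex {x} {suc y} x<y y<N xy with m , x<m , m≤y , xm , none ← last-chord x y (s≤s⁻¹ x<y)
    with chord? m (suc y)
  ... | yes my = m , x<m , s≤s m≤y , xm , my
  ... | no ¬my with chord-maximal (s≤s m≤y) y<N ¬my
  ...   | k , l , kl , l<N , inj₁ (m<k , k<y , y<l) = contradiction
    (inj₁ (<-trans x<m m<k , k<y , y<l)) (chords-not-crossing y<N l<N xy kl)
  ...   | k , l , kl , l<N , inj₂ (k<m , m<l , l<y) with <-cmp k x
  ...     | tri< k<x _ _ = contradiction
    (inj₂ (k<x , <-trans x<m m<l , l<y)) (chords-not-crossing y<N l<N xy kl)
  ...     | tri≈ _ refl _ = contradiction kl (none m<l (s≤s⁻¹ l<y))
  ...     | tri> _ _ x<k = contradiction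
    (inj₁ (x<k , k<m , m<l)) (chords-not-crossing (<-≤-trans (s≤s m≤y) (<⇒≤ y<N)) l<N xm kl)

  -- `n` bounds the length of the interval and makes the recursion structural. The labels of the
  -- leaves are read off from the colours.
  parse : ∀ c n {x y} → y ≤ n + x → x < y → y < N → Chord x y →
    ∃ λ t → right t x ≡ y × (∀ {k l} → Edge t x k l → Chord k l) × Follows c x (frontierᵇ t)
  parse c zero    y≤x x<y _ _ = contradiction y≤x (<⇒≱ x<y)
  parse c (suc n) {x} {y} y≤ x<y y<N xy with suc x ≟ y
  ... | yes refl with c (suc x) ≟ᵇ c x
  ...   | yes e = leaf same , refl , (λ { base → xy }) , e , tt
  ...   | no ne = leaf diff , refl , (λ { base → xy }) , ¬-not ne , tt
  parse c (suc n) {x} {y} y≤ x<y y<N xy | no ne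
    with m , x<m , m<y , xm , my ← apex (≤∧≢⇒< x<y ne) y<N xy
    with a , refl , a⊆ , fa ← parse c n (s≤s⁻¹ (<-≤-trans m<y y≤)) x<m (<-trans m<y y<N) xm
    with b , refl , b⊆ , fb ← parse c n
           (≤-trans y≤ (≤-trans (≤-reflexive (sym (+-suc n x))) (+-monoʳ-≤ n x<m))) m<y y<N my =
    node a b , refl , (λ { base → xy ; (inˡ e) → a⊆ e ; (inʳ e) → b⊆ e }) ,
    follows-++⁺ (frontierᵇ a) fa (subst (λ m → Follows c m (frontierᵇ b)) (right-advance a x) fb)

  parsed-colorful : ∀ c → (∀ i j k → IsTriangle D i j k → ¬ Monochromatic c (toℕ i) (toℕ j) (toℕ k)) →
    ∀ t {x} → right t x < N → (∀ {k l} → Edge t x k l → Chord k l) → ColorfulTree c t x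
  parsed-colorful c col (leaf s) _ _ = tt
  parsed-colorful c col (node a b) {x} y<N ⊆ =
    nonmono ,
    parsed-colorful c col a (<-trans (<right b _) y<N) (⊆ ∘ inˡ) ,
    parsed-colorful c col b y<N (⊆ ∘ inʳ)
    where
    chord⇒edge : ∀ i j → Chord (toℕ i) (toℕ j) → IsEdge D i j
    chord⇒edge i j (inj₁ s) = inj₁ s
    chord⇒edge i j (inj₂ (i' , j' , p , q , e))
      with refl ← toℕ-injective p | refl ← toℕ-injective q = inj₂ e
    triangle : ∀ {x y z} → x < y → y < z → z < N → Chord x y → Chord y z → Chord x z → ¬ Monochromatic c x y z
    triangle x<y y<z z<N xy yz xz
      with i , refl ← as-fin (<-trans x<y (<-trans y<z z<N)) | j , refl ← as-fin (<-trans y<z z<N) | k , refl ← as-fin z<N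
      = col i j k (x<y , y<z , chord⇒edge i j xy , chord⇒edge j k yz , chord⇒edge i k xz)
    nonmono : ¬ Monochromatic c x (right a x) (right b (right a x))
    nonmono = triangle (<right a x) (<right b _) y<N (⊆ (inˡ base)) (⊆ (inʳ base)) (⊆ base)

  -- Inclusion suffices: a diagonal of `D` missing from `t` would be crossed by an edge of `t`,
  -- which is a chord as well.
  parsed-encode : ∀ t → N ≡ suc (right t 0) → (∀ {k l} → Edge t 0 k l → Chord k l) → encode t ≡ D
  parsed-encode t N≡ ⊆ = trans (tabulate-cong λ i → trans (tabulate-cong (agree i)) (tabulate∘lookup (lookup D i)))
    (tabulate∘lookup D)
    where
    agree : ∀ i j → _ ≡ D ∋[ i , j ]
    agree i j with D ∋[ i , j ] in e
    ... | true with i<j , ns ← onlyDiags i j e = dec-true (diagonal? t _ _) (edge , ns)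
      where
      j≤ : toℕ j ≤ right t 0
      j≤ = s≤s⁻¹ (≤-trans (toℕ<n j) (≤-reflexive N≡))
      edge : Edge t 0 (toℕ i) (toℕ j)
      edge with edges-maximal t z≤n i<j j≤
      ... | inj₁ d = d
      ... | inj₂ (k , l , d , cr) = contradiction cr
        (chords-not-crossing (toℕ<n j) (≤-trans (s≤s (edge-≤ d)) (≤-reflexive (sym N≡)))
          (inj₂ (i , j , refl , refl , e)) (⊆ d))
    agree i j | false = dec-false (diagonal? t _ _) λ (d , ns) → absent ns (⊆ d)
      where
      absent : ¬ IsSide N (toℕ i) (toℕ j) → ¬ Chord (toℕ i) (toℕ j)
      absent ns (inj₁ s) = ns s
      absent ns (inj₂ (i' , j' , p , q , e'))
        with refl ← toℕ-injective p | refl ← toℕ-injective q with () ← trans (sym e) e'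

-- Counting quadrilaterals

count : List Side → ℕ
count []         = 0
count (same ∷ w) = count w
count (diff ∷ w) = suc (count w)

count-++ : ∀ u v → count (u ++ v) ≡ count u + count v
count-++ []         v = refl
count-++ (same ∷ u) v = count-++ u v
count-++ (diff ∷ u) v = cong suc (count-++ u v)

-- Each quadrilateral replaces one bichromatic edge by three, starting from a single one.
count-frontier : ∀ T → count (frontier T) ≡ suc (length (positions T) + length (positions T))
count-frontier •     = refl
count-frontier (L T) rewrite length-map inᴸ (positions T) = count-frontier T
count-frontier (R T) rewrite length-map inᴿ (positions T) | count-++ (frontier T) [ same ]
  | +-identityʳ (count (frontier T)) = count-frontier T
count-frontier (Q A B C)
  rewrite count-++ (frontier A) (frontier B ++ frontier C) | count-++ (frontier B) (frontier C)
  | length-++ (map (in₁ {A} {B} {C}) (positions A)) {map in₂ (positions B) ++ map in₃ (positions C)}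
  | length-++ (map (in₂ {A} {B} {C}) (positions B)) {map in₃ (positions C)}
  | length-map (in₁ {A} {B} {C}) (positions A) | length-map (in₂ {A} {B} {C}) (positions B)
  | length-map (in₃ {A} {B} {C}) (positions C)
  | count-frontier A | count-frontier B | count-frontier C =
  arith (length (positions A)) (length (positions B)) (length (positions C))
  where
  arith : ∀ a b c → suc (a + a) + (suc (b + b) + suc (c + c)) ≡ suc (suc (a + (b + c)) + suc (a + (b + c)))
  arith = solve-∀

count-sames : ∀ k w → count (sames k ++ w) ≡ count w
count-sames zero    w = refl
count-sames (suc k) w = count-sames k w

count-sides : ∀ a as → count (sides (a ∷ as)) ≡ length as
count-sides a []       = trans (cong count (sym (++-identityʳ (sames (a ∸ 1))))) (count-sames (a ∸ 1) [])
count-sides a (b ∷ as) = trans (count-sames (a ∸ 1) _) (cong suc (count-sides b as))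

-- Ten blocks give nine `diff` sides besides the root, and three quadrilaterals would account for
-- only seven.
four-positions : ∀ T → 9 ≤ count (frontier T) → 4 ≤ length (positions T)
four-positions T 9≤ with 4 ≤? length (positions T)
... | yes 4≤ = 4≤
... | no 4≰ = contradiction
  (≤-trans (≤-trans 9≤ (≤-reflexive (count-frontier T))) (s≤s (+-mono-≤ p≤3 p≤3))) λ { (s≤s (s≤s (s≤s (s≤s (s≤s (s≤s (s≤s ()))))))) }
  where
  p≤3 = s≤s⁻¹ (≰⇒> 4≰)

falses : ∀ T → Bits T
falses •         = •ᵇ
falses (L T)     = Lᵇ (falses T)
falses (R T)     = Rᵇ (falses T)
falses (Q A B C) = Qᵇ false (falses A) (falses B) (falses C)

Unique-map : ∀ {A B : Set} (f : A → B) (xs : List A) →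
  (∀ {x y} → x ∈ xs → y ∈ xs → f x ≡ f y → x ≡ y) → Unique xs → Unique (map f xs)
Unique-map f []       inj []        = []
Unique-map f (x ∷ xs) inj (x# ∷ u) =
  All.map⁺ (All.tabulate λ y∈ e → All.lookup x# y∈ (inj (here refl) (there y∈) e)) ∷
  Unique-map f xs (λ x∈ y∈ → inj (there x∈) (there y∈)) u

three-members : ∀ {A : Set} {x y z : A} (vs : List A) → x ∈ vs → y ∈ vs → z ∈ vs →
  x ≢ y → y ≢ z → x ≢ z → 3 ≤ length vs
three-members (_ ∷ _ ∷ _ ∷ _) _ _ _ _ _ _ = s≤s (s≤s (s≤s z≤n))
three-members (_ ∷ _) (here refl) (here refl) _ x≢y _ _ = contradiction refl x≢y
three-members (_ ∷ _) (here refl) _ (here refl) _ _ x≢z = contradiction refl x≢z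
three-members (_ ∷ _) _ (here refl) (here refl) _ y≢z _ = contradiction refl y≢z
three-members (_ ∷ _ ∷ []) (there (here refl)) (there (here refl)) _ x≢y _ _ = contradiction refl x≢y
three-members (_ ∷ _ ∷ []) (there (here refl)) _ (there (here refl)) _ _ x≢z = contradiction refl x≢z
three-members (_ ∷ _ ∷ []) _ (there (here refl)) (there (here refl)) _ y≢z _ = contradiction refl y≢z

path-start : ∀ {a b vs} → Path a b vs → ∃ λ rest → vs ≡ a ∷ rest
path-start end        = _ , refl
path-start (step _ _) = _ , refl

Flip-sym : ∀ {N} (D D' : DiagSet N) → Flip D D' → Flip D' D
Flip-sym D D' (e₁ , e₂ , f₁ , f₂ , De , D'e , Df , D'f , only) =
  f₁ , f₂ , e₁ , e₂ , D'f , Df , D'e , De , λ i j ne → Sum.swap (only i j (≢-sym ne))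

state-injective : ∀ {T} {x y : Bits T} → _≡_ {A = State} (T , x) (T , y) → x ≡ y
state-injective refl = refl

flip-≢ : ∀ {T} (k : Pos T) x → _≢_ {A = State} (T , x) (T , flip k x)
flip-≢ k x e = not-¬ refl (trans (cong (get k) (state-injective e)) (get-flip k x))

flips-≢ : ∀ {T} {j k : Pos T} → j ≢ k → ∀ x → _≢_ {A = State} (T , flip j x) (T , flip k x)
flips-≢ {j = j} {k} j≢k x e = not-¬ refl (trans (sym (get-flip-≢ j k x j≢k))
  (trans (cong (get j) (sym (state-injective e))) (get-flip j x)))

-- From the tour to the Hamilton cycle

module _ (a : ℕ) (as : List ℕ) (positive : All (1 ≤_) (a ∷ as)) where

  private
    α = a ∷ as
    N = sum α
    w = sides α

  open Encoding N

  w-follows : Follows (color α) 0 w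
  w-follows = follows-sides (color α) 0 true a as positive (λ p → cong (color α) (+-identityʳ p))

  follows : ∀ {T} (x : Bits T) → frontier T ≡ w → Follows (color α) 0 (frontierᵇ (bin x))
  follows x e = subst (Follows (color α) 0) (sym (trans (bin-frontier x) e)) w-follows

  right-length : ∀ t → right t 0 ≡ length (frontierᵇ t)
  right-length t = trans (right-advance t 0) (trans (advance-length (frontierᵇ t) 0) (+-identityʳ _))

  size : ∀ {T} (x : Bits T) → frontier T ≡ w → N ≡ suc (right (bin x) 0)
  size x e = trans (sym (sides-length a as positive))
    (cong suc (sym (trans (right-length (bin x)) (cong length (trans (bin-frontier x) e)))))

  encode-node : ∀ {T} (x : Bits T) → frontier T ≡ w → FNode α (encode (bin x))
  encode-node x e = encode-triangulation (bin x) (size x e) ,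
    encode-colorful (color α) (bin x) (size x e) (bin-colorful x (follows x e))

  encode-flip : ∀ {S T} (x : Bits S) (y : Bits T) → frontier S ≡ w → frontier T ≡ w →
    Rot± (bin x) (bin y) → Flip (encode (bin x)) (encode (bin y))
  encode-flip x y e e' (inj₁ r) = encode-exchange (size x e) (rot-exchange r 0)
  encode-flip x y e e' (inj₂ r) = Flip-sym (encode (bin y)) (encode (bin x)) (encode-exchange (size y e') (rot-exchange r 0))

  encode-state : State → DiagSet N
  encode-state (_ , x) = encode (bin x)

  encode-state-injective : ∀ {u v} → frontier (proj₁ u) ≡ w → frontier (proj₁ v) ≡ w →
    encode-state u ≡ encode-state v → u ≡ v
  encode-state-injective {_ , x} {_ , y} e e' eq = bin-injective x y (follows x e)
    (encode-injective (size x e) (trans (bin-frontier x) (trans e (sym (trans (bin-frontier y) e')))) eq)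

  module _ {S} (S-fr : frontier S ≡ w) (D : DiagSet N) (node : FNode α D) where

    open Parsing D (proj₁ node)

    private
      m  = right (bin (falses S)) 0
      N≡ = size (falses S) S-fr

    -- The known dissection `S` supplies the size of the polygon and the fact that the root side is
    -- bichromatic, which starts the decoding.
    decode-node : ∃ λ v → frontier (proj₁ v) ≡ w × encode-state v ≡ D
    decode-node
      with t , r , ⊆ , f ← parse (color α) m (≤-reflexive (sym (+-identityʳ m)))
             (<right (bin (falses S)) 0) (≤-reflexive (sym N≡)) (inj₁ (inj₂ (refl , sym N≡)))
      with T , x , refl ← decode t
             (parsed-colorful (color α) (proj₂ node) t (≤-reflexive (trans (cong suc r) (sym N≡))) ⊆) f
             (λ e → not-¬ refl (trans e (trans (cong (color α) r) (opposite (falses S) (follows (falses S) S-fr)))))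
      = (T , x) ,
        trans (sym (bin-frontier x)) (follows-injective _ w lengths f w-follows) ,
        parsed-encode (bin x) (trans N≡ (cong suc (sym r))) ⊆
      where
      lengths = trans (sym (right-length (bin x))) (trans r (trans (right-length (bin (falses S)))
        (cong length (trans (bin-frontier (falses S)) S-fr))))

  path-adjacent : ∀ {u v z vs} → Path u v vs → (∀ {v} → v ∈ vs → frontier (proj₁ v) ≡ w) →
    frontier (proj₁ z) ≡ w → v ∼ z → ConsecAdj Flip (map encode-state vs ++ [ encode-state z ])
  path-adjacent {_ , x} {z = _ , z} end fr z-fr r = encode-flip x z (fr (here refl)) z-fr r , tt
  path-adjacent (step s end) fr z-fr r =
    encode-flip _ _ (fr (here refl)) (fr (there (here refl))) s ,
    path-adjacent end (fr ∘ there) z-fr r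
  path-adjacent (step s (step s' p)) fr z-fr r =
    encode-flip _ _ (fr (here refl)) (fr (there (here refl))) s ,
    path-adjacent (step s' p) (fr ∘ there) z-fr r

  enough : 9 ≤ length as → ∀ T → frontier T ≡ w → 4 ≤ length (positions T)
  enough 9≤ T e = four-positions T
    (≤-trans 9≤ (≤-reflexive (sym (trans (cong count e) (count-sides a as)))))

  -- A tour of the whole spanning tree ends one flip of the bit `k` away from its start; this flip
  -- closes the cycle.
  hamilton : Span w → 9 ≤ length as → HamiltonCycle (FNode α) Flip
  hamilton sp 9≤
    with 4≤ ← enough 9≤ (Span.top sp) (Span.top-frontier sp)
    -- The direction `j` provides a third node, so that the cycle is not a single edge.
    with j , j∉ ← pick 4≤ [] z≤n
    with k , k∉ ← pick 4≤ [ j ] (s≤s z≤n)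
    with vs , p , cov ← skeleton-tour (enough 9≤) (Span.skeleton sp) (Span.top-frontier sp) k (falses _)
    with rest , refl ← path-start p =
    _ , map encode-state rest ,
    ≤-trans (s≤s⁻¹ long) (≤-reflexive (sym (length-map encode-state rest))) ,
    Unique-map encode-state vs (λ u∈ v∈ → encode-state-injective (fr u∈) (fr v∈)) (distinct cov unique) ,
    All.map⁺ (All.tabulate λ {v} v∈ → encode-node (proj₂ v) (fr v∈)) ,
    all-nodes ,
    path-adjacent p fr top-frontier (Rot±-sym (bin-flip k x))
    where
    open Span sp
    x = falses top
    fr : ∀ {v} → v ∈ vs → frontier (proj₁ v) ≡ w
    fr v∈ = trans (nodes-frontier skeleton (sound cov v∈)) top-frontier
    covered : ∀ {v} → frontier (proj₁ v) ≡ w → v ∈ vs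
    covered {T , _} e = complete cov (spanning T e)
    long : 3 ≤ length vs
    long = three-members vs (covered {_ , x} top-frontier) (covered {_ , flip j x} top-frontier)
      (covered {_ , flip k x} top-frontier)
      (flip-≢ j x) (flips-≢ (k∉ ∘ here ∘ sym) x) (flip-≢ k x)
    all-nodes : ∀ D → FNode α D → D ∈ map encode-state vs
    all-nodes D n with v , e , refl ← decode-node {top} top-frontier D n = ∈-map⁺ encode-state (covered e)

theorem2 : (α : List ℕ) → ColoringSequence α → 10 ≤ length α →
    HamiltonCycle (FNode α) Flip
theorem2 (a ∷ as) record { evenLength = suc q , eq ; entriesPos = positive } (s≤s 9≤) =
  hamilton a as positive (span q (a ∷ as) eq) 9≤
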